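{- For $p,q\in\mathbb{N}$ with $1\le q<p$ let \[ N(p,q)=\sum_{j\vdash q-1}\ \sum_{k\vdash p-q}\left(\prod_{i=1}^{q-1} j_i!\,i^{j_i}\prod_{i=1}^{p-q}k_i!\,i^{k_i}\right)^{ -1}\prod_{a,b=1}^{p-q}\Bigl(1+\sum_{d\mid \operatorname{lcm}(a,b)} d\,j_d\Bigr)^{k_ak_b\gcd(a,b)} \] and \[ L(p,q)=\tfrac12 N(p,q)+\tfrac12\sum_{j\vdash q-1}\ \sum_{k\vdash p-q}\left(\prod_{i=1}^{q-1} j_i!\,i^{j_i}\prod_{i=1}^{p-q}k_i!\,i^{k_i}\right)^{ -1}\prod_{a=1}^{p-q}\Bigl(q_a^{k_a}\,p_{a,a}^{k_a^2-k_a}\prod_{b=1}^{a-1}p_{a,b}^{2k_ak_b}\Bigr), \] where, writing $C_t=1+\sum_{d\mid t} d\,j_d$, \[ p_{a,b}=C_{\operatorname{lcm}(2,a,b)}^{\,ab/\operatorname{lcm}(2,a,b)},\qquad q_a=\begin{cases} C_a\,C_{2a}^{(a-1)/2} & a\equiv 1\pmod 2,\\ C_a^{\,a} & a\equiv 0\pmod 4,\\ C_{a/2}^{\,2}\,C_a^{\,a-1} & a\equiv 2\pmod 4.\end{cases} \] Then for every $n\in\mathbb{N}$ the number of nilpotent semigroups of degree $3$ of order $n$ up to isomorphism or anti-isomorphism equals \[ \sum_{m=2}^{a(n)}\bigl(L(n,m)-L(n-1,m-1)\bigr),\qquad a(n)=\left\lfloor n+\tfrac12-\sqrt{n-\tfrac34}\,\right\rfloor.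 \]
   Context: A semigroup $S$ is nilpotent of degree $3$ if $|S^3|=1$ and $|S^2|>1$, where $S^r=\{s_1\cdots s_r : s_i\in S\}$. The dual $S^*$ of $S$ is the set $S$ with multiplication $x\ast y=yx$; a bijection $f:S\to T$ is an anti-isomorphism if it is an isomorphism from $S^*$ to $T$. Two semigroups are identified "up to isomorphism or anti-isomorphism" if there is an isomorphism or an anti-isomorphism between them. $j\vdash n$ means $j$ is a partition of $n$ (empty if $n=0$), $j_i$ is the number of parts of $j$ equal to $i$; sums over $d\mid t$ range over positive divisors of $t$. -}

module Defs where

open import Level using (0ℓ) renaming (suc to lsuc)
open import Algebra.Bundles using (Semigroup)
import Algebra.Construct.Flip.Op as Op
import Algebra.Morphism.Construct.Composition as Composition
import Algebra.Morphism.Construct.Identity as Identity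
open import Algebra.Morphism.Structures using (module MagmaMorphisms)
open import Data.Fin.Base using (Fin)
open import Data.Integer.Base using (+_)
open import Data.List.Base
  using (List; [_]; map; foldr; filter; applyUpTo; upTo; cartesianProductWith)
open import Data.List.Extrema.Nat using (max)
import Data.List.Relation.Unary.All.Properties as All
open import Data.Nat.Base
  using (ℕ; zero; suc; _+_; _*_; _∸_; _^_; _<_; _!; NonZero; ≢-nonZero; ≢-nonZero⁻¹)
open import Data.Nat.DivMod using (_/_; _%_)
open import Data.Nat.Divisibility using (_∣?_)
open import Data.Nat.GCD using (gcd)
open import Data.Nat.LCM using (lcm; gcd*lcm)
open import Data.Nat.ListAction using (sum; product)
open import Data.Nat.ListAction.Properties using (product≢0)
open import Data.Nat.Properties using (_≟_; m*n≢0; m^n≢0; _!≢0; *-zeroʳ)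
open import Data.Product.Base using (∃; _×_; _,_; proj₁; proj₂)
import Data.Rational.Base as ℚ
open import Data.Rational.Base using (ℚ; 0ℚ; ½)
import Data.Rational.Properties as ℚ
open import Data.Sum.Base using (_⊎_; inj₁; inj₂)
open import Data.Vec.Base using (Vec; []; _∷_; foldr₁)
open import Function.Bundles using (Bijection)
open import Function.Base using (id)
open import Relation.Binary.Bundles using (Setoid)
import Relation.Binary.Construct.On as On
open import Relation.Binary.PropositionalEquality using (_≡_; refl; sym; trans; cong; setoid)
open import Relation.Nullary using (Dec; _×-dec_)

-- Elements of a setoid are counted up to its equality.
∣_∣≡_ : ∀ {c ℓ} → Setoid c ℓ → ℕ → Set _
∣ X ∣≡ k = Bijection (setoid (Fin k)) X

-- S ^1+ r is the subset S^{r+1} of products of r + 1 elements.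
_^1+_ : Semigroup 0ℓ 0ℓ → ℕ → Setoid 0ℓ 0ℓ
S ^1+ r = On.setoid (Semigroup.setoid S) (proj₁ {B = isProduct})
  where
  open Semigroup S
  isProduct : Carrier → Set
  isProduct x = ∃ λ (s : Vec Carrier (suc r)) → foldr₁ _∙_ s ≈ x

NilpotentOfDegree3 : Semigroup 0ℓ 0ℓ → Set
NilpotentOfDegree3 S = (∣ S ^1+ 2 ∣≡ 1) × (∃ λ k → (∣ S ^1+ 1 ∣≡ k) × 1 < k)

record NilpotentSemigroup (n : ℕ) : Set (lsuc 0ℓ) where
  field
    semigroup : Semigroup 0ℓ 0ℓ
    order     : ∣ Semigroup.setoid semigroup ∣≡ n
    nilpotent : NilpotentOfDegree3 semigroup

_* : Semigroup 0ℓ 0ℓ → Semigroup 0ℓ 0ℓ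
S * = Op.semigroup S

_≅_ : Semigroup 0ℓ 0ℓ → Semigroup 0ℓ 0ℓ → Set
S ≅ T = ∃ λ (f : Semigroup.Carrier S → Semigroup.Carrier T) →
  MagmaMorphisms.IsMagmaIsomorphism (Semigroup.rawMagma S) (Semigroup.rawMagma T) f

_≅±_ : Semigroup 0ℓ 0ℓ → Semigroup 0ℓ 0ℓ → Set
S ≅± T = (S ≅ T) ⊎ ((S *) ≅ T)

≅-refl : ∀ S → S ≅ S
≅-refl S = id , Identity.isMagmaIsomorphism (Semigroup.rawMagma S) (Semigroup.refl S)

≅-trans : ∀ S T U → S ≅ T → T ≅ U → S ≅ U
≅-trans S T U (_ , p) (_ , q) =
  _ , Composition.isMagmaIsomorphism (Semigroup.trans U) p q

≅-sym : ∀ S T → S ≅ T → T ≅ S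
≅-sym S T (f , iso) = g , record
  { isMagmaMonomorphism = record
    { isMagmaHomomorphism = record
      { isRelHomomorphism = record
        { cong = λ {y} {z} y≈z → injective
            (T.trans (f∘g y) (T.trans y≈z (T.sym (f∘g z)))) }
      ; homo = λ y z → injective
          (T.trans (f∘g (y T.∙ z))
            (T.sym (T.trans (homo (g y) (g z)) (T.∙-cong (f∘g y) (f∘g z)))))
      }
    ; injective = λ {y} {z} gy≈gz →
        T.trans (T.sym (f∘g y)) (T.trans (⟦⟧-cong gy≈gz) (f∘g z))
    }
  ; surjective = λ x → f x , λ {y} y≈fx → injective (T.trans (f∘g y) y≈fx)
  }
  where
  module S = Semigroup S
  module T = Semigroup T
  open MagmaMorphisms.IsMagmaIsomorphism iso
  g : T.Carrier → S.Carrier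
  g y = proj₁ (surjective y)
  f∘g : ∀ y → f (g y) T.≈ y
  f∘g y = proj₂ (surjective y) S.refl

≅-dual : ∀ S T → S ≅ T → (S *) ≅ (T *)
≅-dual S T (f , iso) = f , record
  { isMagmaMonomorphism = record
    { isMagmaHomomorphism = record
      { isRelHomomorphism = isRelHomomorphism
      ; homo = λ x y → homo y x
      }
    ; injective = injective
    }
  ; surjective = surjective
  }
  where open MagmaMorphisms.IsMagmaIsomorphism iso

≅±-sym : ∀ S T → S ≅± T → T ≅± S
≅±-sym S T (inj₁ p) = inj₁ (≅-sym S T p)
≅±-sym S T (inj₂ p) = inj₂ (≅-dual T (S *) (≅-sym (S *) T p))

≅±-trans : ∀ S T U → S ≅± T → T ≅± U → S ≅± U
≅±-trans S T U (inj₁ p) (inj₁ q) = inj₁ (≅-trans S T U p q)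
≅±-trans S T U (inj₁ p) (inj₂ q) = inj₂ (≅-trans (S *) (T *) U (≅-dual S T p) q)
≅±-trans S T U (inj₂ p) (inj₁ q) = inj₂ (≅-trans (S *) T U p q)
≅±-trans S T U (inj₂ p) (inj₂ q) = inj₁ (≅-trans S (T *) U (≅-dual (S *) T p) q)

nilpotentSemigroups : ℕ → Setoid (lsuc 0ℓ) 0ℓ
nilpotentSemigroups n = record
  { Carrier       = NilpotentSemigroup n
  ; _≈_           = λ S T → semigroup S ≅± semigroup T
  ; isEquivalence = record
    { refl  = λ {S} → inj₁ (≅-refl (semigroup S))
    ; sym   = λ {S} {T} → ≅±-sym (semigroup S) (semigroup T)
    ; trans = λ {S} {T} {U} → ≅±-trans (semigroup S) (semigroup T) (semigroup U)
    }
  }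
  where open NilpotentSemigroup

Σℚ : ∀ {A : Set} → List A → (A → ℚ) → ℚ
Σℚ xs f = foldr ℚ._+_ 0ℚ (map f xs)

range : ℕ → ℕ → List ℕ
range a b = applyUpTo (λ i → a + i) (suc b ∸ a)

-- ∏ m f is f 1 * ⋯ * f m.
∏ : ℕ → ((i : ℕ) .{{_ : NonZero i}} → ℕ) → ℕ
∏ m f = product (applyUpTo (λ i → f (suc i)) m)

∏≢0 : ∀ m (f : (i : ℕ) .{{_ : NonZero i}} → ℕ) →
      (∀ i .{{_ : NonZero i}} → NonZero (f i)) → NonZero (∏ m f)
∏≢0 m f f≢0 = product≢0 (All.applyUpTo⁺₂ (λ i → f (suc i)) m (λ i → f≢0 (suc i)))

-- The vector (j₁ , … , jₙ) with j₁ + 2 j₂ + ⋯ + n jₙ = n encodes the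
-- partition of n with jᵢ parts equal to i; j # i is jᵢ, and is 0 for i > n.
infixl 8 _#_
_#_ : ∀ {n} → Vec ℕ n → ℕ → ℕ
_       # zero        = 0
[]      # suc i       = 0
(x ∷ _) # suc zero    = x
(_ ∷ v) # suc (suc i) = v # suc i

weight : ∀ {n} → Vec ℕ n → ℕ
weight {n} j = sum (applyUpTo (λ i → suc i * j # suc i) n)

vectors : ℕ → (l : ℕ) → List (Vec ℕ l)
vectors b zero    = [ [] ]
vectors b (suc l) = cartesianProductWith _∷_ (upTo (suc b)) (vectors b l)

-- The bound n loses nothing, as jᵢ ≤ n in every partition of n.
partitions : (n : ℕ) → List (Vec ℕ n)
partitions n = filter (λ j → weight j ≟ n) (vectors n n)

z : ∀ {n} → Vec ℕ n → ℕ
z {n} j = ∏ n (λ i → (j # i) ! * i ^ (j # i))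

z≢0 : ∀ {n} (j : Vec ℕ n) → NonZero (z j)
z≢0 {n} j = ∏≢0 n _ λ i →
  m*n≢0 ((j # i) !) (i ^ (j # i)) {{(j # i) !≢0}} {{m^n≢0 i (j # i)}}

divisors : ℕ → List ℕ
divisors t = filter (_∣? t) (range 1 t)

C : ∀ {n} → Vec ℕ n → ℕ → ℕ
C j t = 1 + sum (map (λ d → d * j # d) (divisors t))

lcm≢0 : ∀ a b .{{_ : NonZero a}} .{{_ : NonZero b}} → NonZero (lcm a b)
lcm≢0 a b = ≢-nonZero λ lcm≡0 → ≢-nonZero⁻¹ (a * b) {{m*n≢0 a b}}
  (trans (sym (gcd*lcm a b)) (trans (cong (gcd a b *_) lcm≡0) (*-zeroʳ (gcd a b))))

-- pPow j a b e is p_{a,b}^e with p_{a,b} = C_l^{ab/l} and l = lcm(2,a,b).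
-- For odd a and b the number ab/l is only a half-integer, but every e below
-- is even, so that (ab/l)e is a natural number and the division is exact.
pPow : ∀ {n} → Vec ℕ n → (a b e : ℕ) .{{_ : NonZero a}} .{{_ : NonZero b}} → ℕ
pPow j a b e = C j l ^ ((a * b * e) / l)
  where
  l : ℕ
  l = lcm 2 (lcm a b)
  instance
    l≢0 : NonZero l
    l≢0 = lcm≢0 2 (lcm a b) {{_}} {{lcm≢0 a b}}

qFactor : ∀ {n} → Vec ℕ n → ℕ → ℕ
qFactor j a = byResidue (a % 4)
  where
  byResidue : ℕ → ℕ
  byResidue 0 = C j a ^ a
  byResidue 2 = C j (a / 2) ^ 2 * C j a ^ (a ∸ 1)
  byResidue _ = C j a * C j (2 * a) ^ ((a ∸ 1) / 2)

-- Only meaningful for 1 ≤ q < p: the subtractions are truncated.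
module _ (p q : ℕ) where

  weightedSum : (Vec ℕ (q ∸ 1) → Vec ℕ (p ∸ q) → ℕ) → ℚ
  weightedSum f =
    Σℚ (partitions (q ∸ 1)) λ j →
    Σℚ (partitions (p ∸ q)) λ k →
      ((+ 1 ℚ./ (z j * z k)) {{m*n≢0 (z j) (z k) {{z≢0 j}} {{z≢0 k}}}})
        ℚ.* (+ f j k ℚ./ 1)

  N : ℚ
  N = weightedSum λ j k →
    ∏ (p ∸ q) λ a → ∏ (p ∸ q) λ b →
      C j (lcm a b) ^ (k # a * k # b * gcd a b)

  L : ℚ
  L = ½ ℚ.* N ℚ.+ ½ ℚ.* weightedSum λ j k →
    ∏ (p ∸ q) λ a →
      qFactor j a ^ (k # a) * pPow j a a ((k # a) ^ 2 ∸ k # a)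
        * ∏ (a ∸ 1) (λ b → pPow j a b (2 * k # a * k # b))

-- √ s ≤ t for rational s ≥ 0.
√_≤_ : ℚ → ℚ → Set
√ s ≤ t = (0ℚ ℚ.≤ t) × (s ℚ.≤ t ℚ.* t)

√_≤?_ : ∀ s t → Dec (√ s ≤ t)
√ s ≤? t = (0ℚ ℚ.≤? t) ×-dec (s ℚ.≤? t ℚ.* t)

-- m ≤ n + 1/2 - √(n - 3/4), rearranged as √(n - 3/4) ≤ n + 1/2 - m.
_≤bound_ : ℕ → ℕ → Set
m ≤bound n =
  √ ((+ n ℚ./ 1) ℚ.- (+ 3 ℚ./ 4)) ≤ ((+ n ℚ./ 1) ℚ.+ ½ ℚ.- (+ m ℚ./ 1))

_≤bound?_ : ∀ m n → Dec (m ≤bound n)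
m ≤bound? n = √ _ ≤? _

-- ⌊n + 1/2 - √(n - 3/4)⌋ for n ≥ 1, the greatest integer m with m ≤bound n.
-- It lies between 0 and n because 1/2 ≤ √(n - 3/4) ≤ n + 1/2.
upperLimit : ℕ → ℕ
upperLimit n = max 0 (filter (_≤bound? n) (upTo (suc n)))

{-# OPTIONS --safe #-}

{- A nilpotent semigroup of degree 3 is a set X of x non-products, a set Y of y
non-zero products and a zero, with a multiplication table X × X → Y ∪ {0} that
hits all of Y and with all other products zero. (Anti-)isomorphisms correspond
to the action of Sym Y × Sym X × ℤ/2 on such tables, where ℤ/2 swaps the
factors of X × X. Tables that need not hit Y have L(x+y+1, y+1) orbits by
Burnside's lemma, and the orbits of tables missing a point of Y are those for
y - 1, whence the difference in the theorem.

In Burnside's sum the tables fixed by (h, g, ε) are the maps intertwining the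
permutation of X × X with h; each cycle of length t on X × X contributes the
number C_t of fixed points of h^t. It remains to find the cycle lengths on
X × X from those of g, and the number of permutations of each cycle type. The
latter follows by inserting a new point into the cycles of a permutation. -}
module Submission where

open import Defs hiding (_*)
open import Level using (0ℓ)
open import Algebra.Bundles using (Semigroup; CommutativeMonoid)
import Algebra.Properties.CommutativeSemigroup as CommutativeSemigroupProperties
open import Algebra.Morphism.Structures using (module MagmaMorphisms)
open import Data.Bool.Base using (Bool; true; false; if_then_else_; _xor_)
import Data.Bool.Properties as Bool
open import Data.Fin.Base using (Fin; zero; suc; toℕ; fromℕ<; combine; remQuot; splitAt; join; _↑ˡ_; _↑ʳ_)
open import Data.Fin.Permutation.Components using (transpose; transpose-inverse)
import Data.Fin.Properties as Fin
open import Data.List.Base as List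
  using (List; []; _∷_; _++_; map; filter; allFin; cartesianProductWith; upTo; applyUpTo; length)
open import Data.List.Extrema.Nat using (xs≤max; max≤v⁺)
open import Data.List.Membership.Propositional using (_∈_; find; lose)
open import Data.List.Membership.Propositional.Properties
  using (∈-filter⁺; ∈-filter⁻; ∈-upTo⁺; ∈-upTo⁻; ∈-lookup)
import Data.List.Properties as List
import Data.List.Relation.Unary.All as All
open import Data.List.Relation.Unary.Any using (here; there; any?)
open import Data.Nat.Base as ℕ hiding (_/_)
open import Data.Nat.Divisibility
open import Data.Nat.DivMod using (_%_; m%n<n; m≡m%n+[m/n]*n; m*[n/m]≡n; m*n/n≡m)
open import Data.Nat.GCD using (gcd)
open import Data.Nat.LCM using (lcm; lcm-comm; gcd*lcm; lcm-least; m∣lcm[m,n]; n∣lcm[m,n])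
open import Data.Nat.ListAction using (sum; product)
open import Data.Nat.ListAction.Properties using (product-++)
open import Data.Nat.Properties
open import Data.Nat.Tactic.RingSolver using (solve-∀)
open import Data.Product.Base using (Σ; ∃; _×_; _,_; proj₁; proj₂; uncurry′)
open import Data.Product.Properties using (≡-dec)
open import Data.Sum.Base as Sum using (_⊎_; inj₁; inj₂)
open import Data.Sum.Properties using (inj₁-injective; inj₂-injective)
open import Data.Vec.Base as Vec using (Vec; []; _∷_; lookup)
import Data.Vec.Properties as Vec
open import Function.Base using (_∘_; id)
open import Function.Bundles using (Bijection)
open import Function.Definitions using (Injective)
open import Relation.Binary.Definitions using (DecidableEquality)
open import Relation.Binary.PropositionalEquality
open import Relation.Binary.Structures using (IsEquivalence)
open import Relation.Nullary using (Dec; yes; no; does; ¬_; _×-dec_; ¬?; contradiction; map′)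

open CommutativeSemigroupProperties +-commutativeSemigroup using ()
  renaming (interchange to +-interchange; x∙yz≈y∙xz to +-x∙yz≈y∙xz)
open CommutativeSemigroupProperties *-commutativeSemigroup using ()
  renaming (interchange to *-interchange; x∙yz≈y∙xz to *-x∙yz≈y∙xz)
open ≡-Reasoning

-- Everything is counted by sums of indicators over lists in which each element occurs exactly once;
-- a bijection of finite sets then becomes an exchange of summations. For this the permutations must
-- form a type that can be listed and has decidable equality. `Perm` is therefore an inductive code,
-- and n!, the cycles and the cycle type are all obtained by recursion on it; codes are equal as
-- soon as their actions agree pointwise.
--
-- The obstacle is the cycle structure on X × X, which the code of a permutation of X × X does not
-- reveal. No cycle there is exhibited: the length of the cycle through a pair is found as its
-- period, the pairs with each length are counted, and cancelling the length gives the number of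
-- cycles. The cases of q_a come from pairs on one cycle of `g`, the only ones to which an odd power
-- of the swapped action can return.
--
-- A table that hits all of Y needs |Y| ≤ |X|², that is m - 1 ≤ (n - m)², and a(n) is the greatest m
-- that allows this. So the upper limit of the sum cuts off only terms without semigroups.

private variable
  n : ℕ
  A B AB P Q : Set

-- Finite sums

𝟙 : Dec P → ℕ
𝟙 p? = if does p? then 1 else 0

𝟙-yes : (p? : Dec P) → P → 𝟙 p? ≡ 1
𝟙-yes (yes _) _ = refl
𝟙-yes (no ¬p) p = contradiction p ¬p

𝟙-no : (p? : Dec P) → ¬ P → 𝟙 p? ≡ 0
𝟙-no (yes p) ¬p = contradiction p ¬p
𝟙-no (no _)  _  = refl

-- A sum often meets different decision procedures for equivalent propositions; only their truth
-- values enter, so one can be exchanged for the other.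
𝟙-⇔ : (P → Q) → (Q → P) → (p? : Dec P) (q? : Dec Q) → 𝟙 p? ≡ 𝟙 q?
𝟙-⇔ to from p? (yes q) = 𝟙-yes p? (from q)
𝟙-⇔ to from p? (no ¬q) = 𝟙-no p? (¬q ∘ to)

𝟙-× : (p? : Dec P) (q? : Dec Q) → 𝟙 (p? ×-dec q?) ≡ 𝟙 p? * 𝟙 q?
𝟙-× (yes _) (yes _) = refl
𝟙-× (yes _) (no _)  = refl
𝟙-× (no _)  _       = refl

𝟙+𝟙¬ : (p? : Dec P) → 𝟙 p? + 𝟙 (¬? p?) ≡ 1
𝟙+𝟙¬ (yes _) = refl
𝟙+𝟙¬ (no _)  = refl

-- The factor `𝟙 p?` vanishes unless `P` holds. This is how an assumption about the summation index
-- is used inside a sum.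
𝟙*-cong : (p? : Dec P) {a b : ℕ} → (P → a ≡ b) → 𝟙 p? * a ≡ 𝟙 p? * b
𝟙*-cong (yes p) a≡b = cong (1 *_) (a≡b p)
𝟙*-cong (no _)  _   = refl

∑ : List A → (A → ℕ) → ℕ
∑ xs f = sum (map f xs)

module _ {f g : A → ℕ} where

  ∑-cong : ∀ xs → (∀ x → f x ≡ g x) → ∑ xs f ≡ ∑ xs g
  ∑-cong xs eq = cong sum (List.map-cong eq xs)

  ∑-+ : ∀ xs → ∑ xs (λ x → f x + g x) ≡ ∑ xs f + ∑ xs g
  ∑-+ []       = refl
  ∑-+ (x ∷ xs) = trans (cong (f x + g x +_) (∑-+ xs)) (+-interchange (f x) (g x) (∑ xs f) (∑ xs g))

∑-*ˡ : ∀ (xs : List A) a {f} → ∑ xs (λ x → a * f x) ≡ a * ∑ xs f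
∑-*ˡ []       a     = sym (*-zeroʳ a)
∑-*ˡ (x ∷ xs) a {f} = trans (cong (a * f x +_) (∑-*ˡ xs a)) (sym (*-distribˡ-+ a (f x) _))

∑-*ʳ : ∀ (xs : List A) a {f} → ∑ xs (λ x → f x * a) ≡ ∑ xs f * a
∑-*ʳ xs a {f} = trans (∑-cong xs (λ x → *-comm (f x) a)) (trans (∑-*ˡ xs a) (*-comm a _))

∑-const : ∀ (xs : List A) a → ∑ xs (λ _ → a) ≡ length xs * a
∑-const []       a = refl
∑-const (x ∷ xs) a = cong (a +_) (∑-const xs a)

∑-zero : ∀ (xs : List A) {f} → (∀ x → f x ≡ 0) → ∑ xs f ≡ 0
∑-zero xs eq = trans (∑-cong xs eq) (trans (∑-const xs 0) (*-zeroʳ (length xs)))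

∑-1 : ∀ (xs : List A) → ∑ xs (λ _ → 1) ≡ length xs
∑-1 xs = trans (∑-const xs 1) (*-identityʳ _)

∑-swap : ∀ (xs : List A) (ys : List B) (f : A → B → ℕ) →
         ∑ xs (λ x → ∑ ys (f x)) ≡ ∑ ys (λ y → ∑ xs (λ x → f x y))
∑-swap []       ys f = sym (∑-zero ys (λ _ → refl))
∑-swap (x ∷ xs) ys f = trans (cong (∑ ys (f x) +_) (∑-swap xs ys f)) (sym (∑-+ ys))

∑-++ : ∀ (xs ys : List A) {f} → ∑ (xs ++ ys) f ≡ ∑ xs f + ∑ ys f
∑-++ []       ys     = refl
∑-++ (x ∷ xs) ys {f} = trans (cong (f x +_) (∑-++ xs ys)) (sym (+-assoc (f x) _ _))

∑-map : ∀ (h : A → B) (xs : List A) {f} → ∑ (map h xs) f ≡ ∑ xs (f ∘ h)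
∑-map h xs = cong sum (sym (List.map-∘ xs))

∑-filter : ∀ {P : A → Set} (P? : ∀ x → Dec (P x)) (xs : List A) {f} →
           ∑ (filter P? xs) f ≡ ∑ xs (λ x → 𝟙 (P? x) * f x)
∑-filter P? []           = refl
∑-filter P? (x ∷ xs) {f} with P? x
... | yes _ = cong₂ _+_ (sym (*-identityˡ (f x))) (∑-filter P? xs)
... | no _  = ∑-filter P? xs

∑-cartesianProductWith : ∀ (h : A → B → AB) xs ys {f} →
  ∑ (cartesianProductWith h xs ys) f ≡ ∑ xs (λ x → ∑ ys (λ y → f (h x y)))
∑-cartesianProductWith h []       ys = refl
∑-cartesianProductWith h (x ∷ xs) ys =
  trans (∑-++ (map (h x) ys) _) (cong₂ _+_ (∑-map (h x) ys) (∑-cartesianProductWith h xs ys))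

∑-applyUpTo-suc : ∀ (g : ℕ → ℕ) n → sum (applyUpTo g (suc n)) ≡ sum (applyUpTo g n) + g n
∑-applyUpTo-suc g zero    = +-comm (g 0) 0
∑-applyUpTo-suc g (suc n) = trans (cong (g 0 +_) (∑-applyUpTo-suc (g ∘ suc) n)) (sym (+-assoc (g 0) _ _))

sum-applyUpTo : ∀ (g : ℕ → ℕ) n → sum (applyUpTo g n) ≡ ∑ (upTo n) g
sum-applyUpTo g n = cong sum (sym (List.map-upTo g n))

∑-upTo-suc : ∀ n (f : ℕ → ℕ) → ∑ (upTo (suc n)) f ≡ f 0 + ∑ (upTo n) (f ∘ suc)
∑-upTo-suc n f = cong (f 0 +_) (trans (cong sum (List.map-applyUpTo suc f n)) (sum-applyUpTo (f ∘ suc) n))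

∑-upTo-cong : ∀ n {f g : ℕ → ℕ} → (∀ i → i < n → f i ≡ g i) → ∑ (upTo n) f ≡ ∑ (upTo n) g
∑-upTo-cong zero            eq = refl
∑-upTo-cong (suc n) {f} {g} eq = trans (∑-upTo-suc n f)
  (trans (cong₂ _+_ (eq 0 z<s) (∑-upTo-cong n (λ i → eq (suc i) ∘ s<s))) (sym (∑-upTo-suc n g)))

∑-upTo-extend : ∀ m n {f : ℕ → ℕ} → (∀ i → m ≤ i → f i ≡ 0) → m ≤ n → ∑ (upTo n) f ≡ ∑ (upTo m) f
∑-upTo-extend zero    n           f≡0 _   = ∑-zero (upTo n) (λ i → f≡0 i z≤n)
∑-upTo-extend (suc m) (suc n) {f} f≡0 m≤n = trans (∑-upTo-suc n f)
  (trans (cong (f 0 +_) (∑-upTo-extend m n (λ i → f≡0 (suc i) ∘ s≤s) (s≤s⁻¹ m≤n))) (sym (∑-upTo-suc m f)))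

∑-upTo-δ : ∀ n m → m < n → ∑ (upTo n) (λ i → 𝟙 (i ≟ m)) ≡ 1
∑-upTo-δ (suc n) zero    _         = trans (∑-upTo-suc n (λ i → 𝟙 (i ≟ 0)))
  (cong suc (∑-zero (upTo n) (λ _ → refl)))
∑-upTo-δ (suc n) (suc m) (s≤s m<n) = trans (∑-upTo-suc n (λ i → 𝟙 (i ≟ suc m)))
  (trans (∑-cong (upTo n) (λ i → 𝟙-⇔ suc-injective (cong suc) (suc i ≟ suc m) (i ≟ m))) (∑-upTo-δ n m m<n))

∑-δ-list : ∀ (_≟_ : DecidableEquality A) (xs : List A) x → ∑ xs (λ a → 𝟙 (a ≟ x)) ≡ 1 →
           ∀ (f : A → ℕ) → ∑ xs (λ a → 𝟙 (a ≟ x) * f a) ≡ f x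
∑-δ-list _≟_ xs x once f = begin
  ∑ xs (λ a → 𝟙 (a ≟ x) * f a)  ≡⟨ ∑-cong xs (λ a → 𝟙*-cong (a ≟ x) (cong f)) ⟩
  ∑ xs (λ a → 𝟙 (a ≟ x) * f x)  ≡⟨ ∑-*ʳ xs (f x) ⟩
  ∑ xs (λ a → 𝟙 (a ≟ x)) * f x  ≡⟨ cong (_* f x) once ⟩
  1 * f x                       ≡⟨ *-identityˡ (f x) ⟩
  f x                           ∎

∑-upTo-pick : ∀ n m → m < n → ∀ (f : ℕ → ℕ) → ∑ (upTo n) (λ i → 𝟙 (i ≟ m) * f i) ≡ f m
∑-upTo-pick n m m<n = ∑-δ-list _≟_ (upTo n) m (∑-upTo-δ n m m<n)

∑-allFin-suc : ∀ n (f : Fin (suc n) → ℕ) → ∑ (allFin (suc n)) f ≡ f zero + ∑ (allFin n) (f ∘ suc)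
∑-allFin-suc n f = cong (λ l → f zero + sum l)
  (trans (List.map-tabulate {n = n} suc f) (sym (List.map-tabulate {n = n} id (f ∘ suc))))

length-allFin : ∀ n → length (allFin n) ≡ n
length-allFin n = List.length-tabulate {n = n} id

-- `once` expresses completeness and absence of repetition together, in the form in which sums
-- consume it.
record Finite (A : Set) : Set where
  infix 4 _≟ᶠ_
  field
    _≟ᶠ_     : DecidableEquality A
    elements : List A
    once     : ∀ x → ∑ elements (λ a → 𝟙 (a ≟ᶠ x)) ≡ 1

open Finite public

∑ᶠ : Finite A → (A → ℕ) → ℕ
∑ᶠ F = ∑ (elements F)

∣_∣ᶠ : Finite A → ℕ
∣ F ∣ᶠ = length (elements F)

∑-δ : ∀ (F : Finite A) x (f : A → ℕ) → ∑ᶠ F (λ a → 𝟙 (_≟ᶠ_ F a x) * f a) ≡ f x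
∑-δ F x f = ∑-δ-list (_≟ᶠ_ F) (elements F) x (once F x) f

-- Each `f (φ a)` is expanded into a sum over `b` by a delta; after the exchange of sums, `b ≡ φ a`
-- reads `a ≡ φ⁻¹ b` and the inner sum collapses. The two lists are never matched with each other.
∑-reindex : (F : Finite A) (G : Finite B) (φ : A → B) (φ⁻¹ : B → A) →
            (∀ a → φ⁻¹ (φ a) ≡ a) → (∀ b → φ (φ⁻¹ b) ≡ b) →
            ∀ (f : B → ℕ) → ∑ᶠ F (f ∘ φ) ≡ ∑ᶠ G f
∑-reindex F G φ φ⁻¹ li ri f = begin
  ∑ᶠ F (λ a → f (φ a))
    ≡⟨ ∑-cong (elements F) (λ a → ∑-δ G (φ a) f) ⟨
  ∑ᶠ F (λ a → ∑ᶠ G (λ b → 𝟙 (_≟ᶠ_ G b (φ a)) * f b))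
    ≡⟨ ∑-swap (elements F) (elements G) _ ⟩
  ∑ᶠ G (λ b → ∑ᶠ F (λ a → 𝟙 (_≟ᶠ_ G b (φ a)) * f b))
    ≡⟨ ∑-cong (elements G) (λ b → trans
         (∑-cong (elements F) (λ a → cong (_* f b)
           (𝟙-⇔ (λ { refl → sym (li a) }) (λ { refl → sym (ri b) }) (_≟ᶠ_ G b (φ a)) (_≟ᶠ_ F a (φ⁻¹ b)))))
         (∑-δ F (φ⁻¹ b) (λ _ → f b))) ⟩
  ∑ᶠ G f ∎

finFin : ∀ n → Finite (Fin n)
finFin n = record { _≟ᶠ_ = Fin._≟_ ; elements = allFin n ; once = λ x → allFin-once n x }
  where
  allFin-once : ∀ n x → ∑ (allFin n) (λ a → 𝟙 (a Fin.≟ x)) ≡ 1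
  allFin-once (suc n) zero    = trans (∑-allFin-suc n (λ a → 𝟙 (a Fin.≟ zero))) (cong suc (∑-zero (allFin n) (λ _ → refl)))
  allFin-once (suc n) (suc x) = trans (∑-allFin-suc n (λ a → 𝟙 (a Fin.≟ suc x)))
    (trans (∑-cong (allFin n) (λ a → 𝟙-⇔ Fin.suc-injective (cong suc) (suc a Fin.≟ suc x) (a Fin.≟ x))) (allFin-once n x))

-- The last three hypotheses say that `h` is a bijection from pairs. It serves pairs, vectors and
-- permutation codes alike.
finCartesianWith : Finite A → Finite B → (_≟_ : DecidableEquality AB) (h : A → B → AB) (fst : AB → A) (snd : AB → B) →
                   (∀ d → h (fst d) (snd d) ≡ d) → (∀ a b → fst (h a b) ≡ a) → (∀ a b → snd (h a b) ≡ b) → Finite AB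
finCartesianWith F G _≟_ h fst snd eta β₁ β₂ = record
  { _≟ᶠ_     = _≟_
  ; elements = cartesianProductWith h (elements F) (elements G)
  ; once     = λ d → begin
      ∑ (cartesianProductWith h (elements F) (elements G)) (λ e → 𝟙 (e ≟ d))
        ≡⟨ ∑-cartesianProductWith h (elements F) (elements G) ⟩
      ∑ᶠ F (λ a → ∑ᶠ G (λ b → 𝟙 (h a b ≟ d)))
        ≡⟨ ∑-cong (elements F) (λ a → trans (∑-cong (elements G) (λ b → trans
             (𝟙-⇔ (λ { refl → sym (β₁ a b) , sym (β₂ a b) }) (λ { (refl , refl) → eta d })
               (h a b ≟ d) ((_≟ᶠ_ F a (fst d)) ×-dec (_≟ᶠ_ G b (snd d))))
             (𝟙-× (_≟ᶠ_ F a (fst d)) (_≟ᶠ_ G b (snd d))))) (∑-*ˡ (elements G) (𝟙 (_≟ᶠ_ F a (fst d))))) ⟩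
      ∑ᶠ F (λ a → 𝟙 (_≟ᶠ_ F a (fst d)) * ∑ᶠ G (λ b → 𝟙 (_≟ᶠ_ G b (snd d))))
        ≡⟨ ∑-δ F (fst d) _ ⟩
      ∑ᶠ G (λ b → 𝟙 (_≟ᶠ_ G b (snd d)))
        ≡⟨ once G (snd d) ⟩
      1 ∎
  }

fin× : Finite A → Finite B → Finite (A × B)
fin× F G = finCartesianWith F G (≡-dec (_≟ᶠ_ F) (_≟ᶠ_ G)) _,_ proj₁ proj₂ (λ _ → refl) (λ _ _ → refl) (λ _ _ → refl)

∑-fin× : (F : Finite A) (G : Finite B) (f : A × B → ℕ) →
         ∑ᶠ (fin× F G) f ≡ ∑ᶠ F (λ a → ∑ᶠ G (λ b → f (a , b)))
∑-fin× F G f = ∑-cartesianProductWith _,_ (elements F) (elements G)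

finVec : Finite A → ∀ n → Finite (Vec A n)
finVec F zero    = record { _≟ᶠ_ = Vec.≡-dec (_≟ᶠ_ F) ; elements = [] ∷ [] ; once = λ { [] → refl } }
finVec F (suc n) = finCartesianWith F (finVec F n) (Vec.≡-dec (_≟ᶠ_ F)) _∷_ Vec.head Vec.tail
  (λ { (_ ∷ _) → refl }) (λ _ _ → refl) (λ _ _ → refl)

finBool : Finite Bool
finBool = record
  { _≟ᶠ_ = Bool._≟_ ; elements = true ∷ false ∷ []
  ; once = λ { true → refl ; false → refl } }

-- Permutations

-- zero ∷ π has the new fixed point 0; suc j ∷ π has 0 inserted in front of j
-- in its cycle.  All other points are shifted by one.
data Perm : ℕ → Set where
  []  : Perm 0
  _∷_ : ∀ {n} → Fin (suc n) → Perm n → Perm (suc n)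

-- Corrects an image `v` after 0 has been inserted in front of `j`: the point that went to `j` now
-- goes to 0.
insertBefore : Fin (suc n) → Fin n → Fin (suc n)
insertBefore zero    v = suc v
insertBefore (suc j) v with v Fin.≟ j
... | yes _ = zero
... | no _  = suc v

act : Perm n → Fin n → Fin n
act (j ∷ π) zero    = j
act (j ∷ π) (suc k) = insertBefore j (act π k)

act⁻ : Perm n → Fin n → Fin n
act⁻ (zero ∷ π)  zero    = zero
act⁻ (zero ∷ π)  (suc v) = suc (act⁻ π v)
act⁻ (suc j ∷ π) zero    = suc (act⁻ π j)
act⁻ (suc j ∷ π) (suc v) with v Fin.≟ j
... | yes _ = zero
... | no _  = suc (act⁻ π v)

act-act⁻ : ∀ (π : Perm n) v → act π (act⁻ π v) ≡ v
act-act⁻ (zero ∷ π)  zero    = refl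
act-act⁻ (zero ∷ π)  (suc v) = cong suc (act-act⁻ π v)
act-act⁻ (suc j ∷ π) zero    rewrite act-act⁻ π j with j Fin.≟ j
... | yes _  = refl
... | no j≢j = contradiction refl j≢j
act-act⁻ (suc j ∷ π) (suc v) with v Fin.≟ j
... | yes v≡j = cong suc (sym v≡j)
... | no v≢j rewrite act-act⁻ π v with v Fin.≟ j
...   | yes v≡j = contradiction v≡j v≢j
...   | no _    = refl

act⁻-act : ∀ (π : Perm n) v → act⁻ π (act π v) ≡ v
act⁻-act (zero ∷ π)  zero    = refl
act⁻-act (zero ∷ π)  (suc v) = cong suc (act⁻-act π v)
act⁻-act (suc j ∷ π) zero    with j Fin.≟ j
... | yes _  = refl
... | no j≢j = contradiction refl j≢j
act⁻-act (suc j ∷ π) (suc v) with act π v Fin.≟ j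
... | yes eq = cong suc (trans (cong (act⁻ π) (sym eq)) (act⁻-act π v))
... | no neq with act π v Fin.≟ j
...   | yes eq = contradiction eq neq
...   | no _   = cong suc (act⁻-act π v)

act-injective : ∀ (π : Perm n) → Injective _≡_ _≡_ (act π)
act-injective π {u} {v} eq = trans (sym (act⁻-act π u)) (trans (cong (act⁻ π) eq) (act⁻-act π v))

-- The value at j itself is junk.
removeBefore : Fin (suc n) → Fin (suc n) → Fin n → Fin n
removeBefore j       (suc v) _    = v
removeBefore (suc j) zero    _    = j
removeBefore zero    zero    junk = junk

-- Takes 0 out of its cycle: the point that `f` sends to 0 is sent to `f zero` instead.
contract : (Fin (suc n) → Fin (suc n)) → Fin n → Fin n
contract f k = removeBefore (f zero) (f (suc k)) k

-- Accepts any function, so composites and inverses can be encoded without carrying an injectivity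
-- proof.
encode : (Fin n → Fin n) → Perm n
encode {zero}  f = []
encode {suc n} f = f zero ∷ encode (contract f)

encode-cong : {f g : Fin n → Fin n} → f ≗ g → encode f ≡ encode g
encode-cong {zero}  f≗g = refl
encode-cong {suc n} f≗g = cong₂ _∷_ (f≗g zero)
  (encode-cong (λ k → cong₂ (λ a b → removeBefore a b k) (f≗g zero) (f≗g (suc k))))

remove-insertBefore : ∀ (j : Fin (suc n)) v junk → removeBefore j (insertBefore j v) junk ≡ v
remove-insertBefore zero    v junk = refl
remove-insertBefore (suc j) v junk with v Fin.≟ j
... | yes v≡j = sym v≡j
... | no _    = refl

encode-act : (π : Perm n) → encode (act π) ≡ π
encode-act []      = refl
encode-act (j ∷ π) = cong (j ∷_) (trans (encode-cong (λ k → remove-insertBefore j (act π k) k)) (encode-act π))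

-- `encode` respects pointwise equality and recovers a code from its action. Group laws thus become
-- propositional equalities that can be checked pointwise.
act-ext : {π ρ : Perm n} → act π ≗ act ρ → π ≡ ρ
act-ext {π = π} {ρ} eq = trans (sym (encode-act π)) (trans (encode-cong eq) (encode-act ρ))

insert-removeBefore : ∀ (j u : Fin (suc n)) junk → j ≢ u → insertBefore j (removeBefore j u junk) ≡ u
insert-removeBefore zero    zero    junk j≢u = contradiction refl j≢u
insert-removeBefore zero    (suc u) junk j≢u = refl
insert-removeBefore (suc j) zero    junk j≢u with j Fin.≟ j
... | yes _  = refl
... | no j≢j = contradiction refl j≢j
insert-removeBefore (suc j) (suc u) junk j≢u with u Fin.≟ j
... | yes u≡j = contradiction (cong suc (sym u≡j)) j≢u
... | no _    = refl

removeBefore-injective : ∀ (j u v : Fin (suc n)) {k l} → j ≢ u → j ≢ v → removeBefore j u k ≡ removeBefore j v l → u ≡ v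
removeBefore-injective j u v {k} {l} j≢u j≢v eq = trans (sym (insert-removeBefore j u k j≢u))
  (trans (cong (insertBefore j) eq) (insert-removeBefore j v l j≢v))

contract-injective : (f : Fin (suc n) → Fin (suc n)) → Injective _≡_ _≡_ f → Injective _≡_ _≡_ (contract f)
contract-injective f inj {k} {l} eq = Fin.suc-injective (inj
  (removeBefore-injective (f zero) (f (suc k)) (f (suc l)) (Fin.0≢1+n ∘ inj) (Fin.0≢1+n ∘ inj) eq))

act-encode : (f : Fin n → Fin n) → Injective _≡_ _≡_ f → act (encode f) ≗ f
act-encode f inj zero    = refl
act-encode f inj (suc k) = trans
  (cong (insertBefore (f zero)) (act-encode (contract f) (contract-injective f inj) k))
  (insert-removeBefore (f zero) (f (suc k)) k (Fin.0≢1+n ∘ inj))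

infixl 7 _⊙_
_⊙_ : Perm n → Perm n → Perm n
π ⊙ ρ = encode (act π ∘ act ρ)

act-⊙ : (π ρ : Perm n) → act (π ⊙ ρ) ≗ act π ∘ act ρ
act-⊙ π ρ = act-encode (act π ∘ act ρ) (act-injective ρ ∘ act-injective π)

inverse : Perm n → Perm n
inverse π = encode (act⁻ π)

act-inverse : (π : Perm n) → act (inverse π) ≗ act⁻ π
act-inverse π = act-encode (act⁻ π) (λ {u} {v} eq →
  trans (sym (act-act⁻ π u)) (trans (cong (act π) eq) (act-act⁻ π v)))

⊙-inverse : (π ρ : Perm n) → (π ⊙ ρ) ⊙ inverse ρ ≡ π
⊙-inverse π ρ = act-ext λ v → begin
  act (π ⊙ ρ ⊙ inverse ρ) v        ≡⟨ act-⊙ (π ⊙ ρ) (inverse ρ) v ⟩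
  act (π ⊙ ρ) (act (inverse ρ) v)  ≡⟨ act-⊙ π ρ _ ⟩
  act π (act ρ (act (inverse ρ) v)) ≡⟨ cong (act π ∘ act ρ) (act-inverse ρ v) ⟩
  act π (act ρ (act⁻ ρ v))         ≡⟨ cong (act π) (act-act⁻ ρ v) ⟩
  act π v                          ∎

⊙-inverse′ : (π ρ : Perm n) → (π ⊙ inverse ρ) ⊙ ρ ≡ π
⊙-inverse′ π ρ = act-ext λ v → begin
  act (π ⊙ inverse ρ ⊙ ρ) v         ≡⟨ act-⊙ (π ⊙ inverse ρ) ρ v ⟩
  act (π ⊙ inverse ρ) (act ρ v)     ≡⟨ act-⊙ π (inverse ρ) _ ⟩
  act π (act (inverse ρ) (act ρ v)) ≡⟨ cong (act π) (act-inverse ρ _) ⟩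
  act π (act⁻ ρ (act ρ v))          ≡⟨ cong (act π) (act⁻-act ρ v) ⟩
  act π v                           ∎

headᵖ : Perm (suc n) → Fin (suc n)
headᵖ (j ∷ π) = j

tailᵖ : Perm (suc n) → Perm n
tailᵖ (j ∷ π) = π

_≟ᵖ_ : DecidableEquality (Perm n)
[]      ≟ᵖ []      = yes refl
(j ∷ π) ≟ᵖ (k ∷ ρ) = map′ (λ { (refl , refl) → refl }) (λ { refl → refl , refl }) ((j Fin.≟ k) ×-dec (π ≟ᵖ ρ))

finPerm : ∀ n → Finite (Perm n)
finPerm zero    = record { _≟ᶠ_ = _≟ᵖ_ ; elements = [] ∷ [] ; once = λ { [] → refl } }
finPerm (suc n) = finCartesianWith (finFin (suc n)) (finPerm n) _≟ᵖ_ _∷_ headᵖ tailᵖ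
  (λ { (_ ∷ _) → refl }) (λ _ _ → refl) (λ _ _ → refl)

∑-finPerm : ∀ n (f : Perm (suc n) → ℕ) →
  ∑ᶠ (finPerm (suc n)) f ≡ ∑ᶠ (finPerm n) (λ π → f (zero ∷ π) + ∑ (allFin n) (λ j → f (suc j ∷ π)))
∑-finPerm n f = begin
  ∑ᶠ (finPerm (suc n)) f
    ≡⟨ ∑-cartesianProductWith _∷_ (allFin (suc n)) (elements (finPerm n)) ⟩
  ∑ (allFin (suc n)) (λ j → ∑ᶠ (finPerm n) (λ π → f (j ∷ π)))
    ≡⟨ ∑-swap (allFin (suc n)) (elements (finPerm n)) _ ⟩
  ∑ᶠ (finPerm n) (λ π → ∑ (allFin (suc n)) (λ j → f (j ∷ π)))
    ≡⟨ ∑-cong (elements (finPerm n)) (λ π → ∑-allFin-suc n (λ j → f (j ∷ π))) ⟩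
  ∑ᶠ (finPerm n) (λ π → f (zero ∷ π) + ∑ (allFin n) (λ j → f (suc j ∷ π))) ∎

∣finPerm∣ : ∀ n → ∣ finPerm n ∣ᶠ ≡ n !
∣finPerm∣ zero    = refl
∣finPerm∣ (suc n) = begin
  length (elements (finPerm (suc n)))             ≡⟨ ∑-1 (elements (finPerm (suc n))) ⟨
  ∑ᶠ (finPerm (suc n)) (λ _ → 1)                  ≡⟨ ∑-finPerm n (λ _ → 1) ⟩
  ∑ᶠ (finPerm n) (λ _ → 1 + ∑ (allFin n) (λ _ → 1)) ≡⟨ ∑-const (elements (finPerm n)) _ ⟩
  ∣ finPerm n ∣ᶠ * (1 + ∑ (allFin n) (λ _ → 1)) ≡⟨ cong₂ (λ a b → a * suc b) (∣finPerm∣ n) (trans (∑-1 (allFin n)) (length-allFin n)) ⟩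
  n ! * suc n                                     ≡⟨ *-comm (n !) (suc n) ⟩
  suc n !                                         ∎

-- Iterates and cycles of a permutation

iter : (A → A) → ℕ → A → A
iter f zero    a = a
iter f (suc s) a = f (iter f s a)

iter-+ : ∀ (f : A → A) s t a → iter f (s + t) a ≡ iter f s (iter f t a)
iter-+ f zero    t a = refl
iter-+ f (suc s) t a = cong f (iter-+ f s t a)

iter-comm : ∀ (f : A → A) s t a → iter f s (iter f t a) ≡ iter f t (iter f s a)
iter-comm f s t a = trans (sym (iter-+ f s t a)) (trans (cong (λ k → iter f k a) (+-comm s t)) (iter-+ f t s a))

iter-*-fixed : ∀ (f : A → A) q p a → iter f p a ≡ a → iter f (q * p) a ≡ a
iter-*-fixed f zero    p a eq = refl
iter-*-fixed f (suc q) p a eq = trans (iter-+ f p (q * p) a) (trans (cong (iter f p) (iter-*-fixed f q p a eq)) eq)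

iter-injective : ∀ {f : A → A} → Injective _≡_ _≡_ f → ∀ s → Injective _≡_ _≡_ (iter f s)
iter-injective inj zero    eq = eq
iter-injective inj (suc s) eq = iter-injective inj s (inj eq)

least : {P : ℕ → Set} → (∀ s → Dec (P s)) → ∀ m → P m → ∃ λ s → P s × (∀ r → r < s → ¬ P r)
least P? zero    pm = 0 , pm , λ _ ()
least P? (suc m) pm with P? 0
... | yes p0 = 0 , p0 , λ _ ()
... | no ¬p0 with least (P? ∘ suc) m pm
...   | s , ps , below = suc s , ps , λ { zero _ → ¬p0 ; (suc r) (s≤s r<s) → below r r<s }

-- cl π v numbers the cycle of π through v, and ncyc π counts the cycles.
ncyc : Perm n → ℕ
ncyc []          = 0
ncyc (zero ∷ π)  = suc (ncyc π)
ncyc (suc _ ∷ π) = ncyc π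

cl : (π : Perm n) → Fin n → Fin (ncyc π)
cl (zero ∷ π)  zero    = zero
cl (zero ∷ π)  (suc k) = suc (cl π k)
cl (suc j ∷ π) zero    = cl π j
cl (suc j ∷ π) (suc k) = cl π k

cl-act : ∀ (π : Perm n) v → cl π (act π v) ≡ cl π v
cl-act (zero ∷ π)  zero    = refl
cl-act (zero ∷ π)  (suc k) = cong suc (cl-act π k)
cl-act (suc j ∷ π) zero    = refl
cl-act (suc j ∷ π) (suc k) with act π k Fin.≟ j
... | yes eq = trans (cong (cl π) (sym eq)) (cl-act π k)
... | no _   = cl-act π k

cl-iter : ∀ (π : Perm n) s v → cl π (iter (act π) s v) ≡ cl π v
cl-iter π zero    v = refl
cl-iter π (suc s) v = trans (cl-act π _) (cl-iter π s v)

cl-surjective : ∀ (π : Perm n) c → ∃ λ v → cl π v ≡ c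
cl-surjective (zero ∷ π)  zero    = zero , refl
cl-surjective (zero ∷ π)  (suc c) = let v , eq = cl-surjective π c in suc v , cong suc eq
cl-surjective (suc j ∷ π) c       = let v , eq = cl-surjective π c in suc v , eq

Reaches : (π : Perm n) → Fin n → Fin n → Set
Reaches π u v = ∃ λ s → iter (act π) s u ≡ v

reaches-trans : (π : Perm n) → ∀ {u v w} → Reaches π u v → Reaches π v w → Reaches π u w
reaches-trans π {u} (s , refl) (t , refl) = t + s , iter-+ (act π) t s u

-- A step of `π` remains one step, except that a step onto `j` now passes through 0 and takes two.
reaches-suc : ∀ j (π : Perm n) {u v} → Reaches π u v → Reaches (j ∷ π) (suc u) (suc v)
reaches-suc j π (zero , refl) = 0 , refl
reaches-suc j π {u} (suc s , refl) = reaches-trans (j ∷ π) (reaches-suc j π (s , refl)) (step j (iter (act π) s u))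
  where
  step : ∀ j k → Reaches (j ∷ π) (suc k) (suc (act π k))
  step zero    k = 1 , refl
  step (suc j) k with act π k Fin.≟ j in eq
  ... | no _     = 1 , lemma
    where
    lemma : insertBefore (suc j) (act π k) ≡ suc (act π k)
    lemma rewrite eq = refl
  ... | yes refl = 2 , lemma
    where
    lemma : act (suc j ∷ π) (insertBefore (suc j) (act π k)) ≡ suc (act π k)
    lemma rewrite eq = refl

cl≡⇒reaches : ∀ (π : Perm n) {u v} → cl π u ≡ cl π v → Reaches π u v
cl≡⇒reaches (zero ∷ π)  {zero}  {zero}  eq = 0 , refl
cl≡⇒reaches (zero ∷ π)  {suc u} {suc v} eq = reaches-suc zero π (cl≡⇒reaches π (Fin.suc-injective eq))
cl≡⇒reaches (suc j ∷ π) {zero}  {zero}  eq = 0 , refl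
cl≡⇒reaches (suc j ∷ π) {suc u} {suc v} eq = reaches-suc (suc j) π (cl≡⇒reaches π eq)
cl≡⇒reaches (suc j ∷ π) {zero}  {suc v} eq =
  reaches-trans (suc j ∷ π) (1 , refl) (reaches-suc (suc j) π (cl≡⇒reaches π eq))
-- 0 is entered from `act⁻ π j`, the former predecessor of `j`, which lies in the class of `j`.
cl≡⇒reaches (suc j ∷ π) {suc u} {zero}  eq =
  reaches-trans (suc j ∷ π)
    (reaches-suc (suc j) π (cl≡⇒reaches π (trans eq (trans (cong (cl π) (sym (act-act⁻ π j))) (cl-act π (act⁻ π j))))))
    (1 , trans (cong (insertBefore (suc j)) (act-act⁻ π j)) (insertBefore-self j))
  where
  insertBefore-self : ∀ {n} (j : Fin n) → insertBefore (suc j) j ≡ zero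
  insertBefore-self j with j Fin.≟ j
  ... | yes _  = refl
  ... | no j≢j = contradiction refl j≢j

-- The length is the size of a class of `cl`; that it is also the least period of each point of the
-- class is proved below as `ℓ≡p`.
len : (π : Perm n) → Fin (ncyc π) → ℕ
len {n} π c = ∑ (allFin n) (λ v → 𝟙 (cl π v Fin.≟ c))

ℓ : (π : Perm n) → Fin n → ℕ
ℓ π v = len π (cl π v)

∑-by-class : (π : Perm n) (φ : Fin (ncyc π) → ℕ) →
             ∑ (allFin n) (φ ∘ cl π) ≡ ∑ (allFin (ncyc π)) (λ c → len π c * φ c)
∑-by-class {n} π φ = begin
  ∑ (allFin n) (φ ∘ cl π)
    ≡⟨ ∑-cong (allFin n) (λ v → trans (sym (∑-δ (finFin (ncyc π)) (cl π v) φ))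
         (∑-cong (allFin (ncyc π)) (λ c → cong (_* φ c) (𝟙-⇔ sym sym (c Fin.≟ cl π v) (cl π v Fin.≟ c))))) ⟩
  ∑ (allFin n) (λ v → ∑ (allFin (ncyc π)) (λ c → 𝟙 (cl π v Fin.≟ c) * φ c))
    ≡⟨ ∑-swap (allFin n) (allFin (ncyc π)) _ ⟩
  ∑ (allFin (ncyc π)) (λ c → ∑ (allFin n) (λ v → 𝟙 (cl π v Fin.≟ c) * φ c))
    ≡⟨ ∑-cong (allFin (ncyc π)) (λ c → ∑-*ʳ (allFin n) (φ c)) ⟩
  ∑ (allFin (ncyc π)) (λ c → len π c * φ c) ∎

module _ (π : Perm n) (v : Fin n) where

  private
    ^ : ℕ → Fin n → Fin n
    ^ = iter (act π)

    -- `act π v` lies in the class of `v`, so some iterate leads from it back to `v`; the least such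
    -- number of steps makes `p` the least period.
    returns : ∃ λ s → ^ (suc s) v ≡ v × (∀ r → r < s → ^ (suc r) v ≢ v)
    returns with cl≡⇒reaches π (cl-act π v)
    ... | s , eq = least (λ s → ^ (suc s) v Fin.≟ v) s (trans (iter-comm (act π) 1 s v) eq)

    p : ℕ
    p = suc (proj₁ returns)

    ^p : ^ p v ≡ v
    ^p = proj₁ (proj₂ returns)

    minimal : ∀ r → r < p → ^ r v ≡ v → r ≡ 0
    minimal zero    _         _  = refl
    minimal (suc r) (s≤s r<p) eq = contradiction eq (proj₂ (proj₂ returns) r r<p)

    ^-% : ∀ s → ^ s v ≡ ^ (s % p) v
    ^-% s = begin
      ^ s v                          ≡⟨ cong (λ k → ^ k v) (m≡m%n+[m/n]*n s p) ⟩
      ^ (s % p + s ℕ./ p * p) v        ≡⟨ iter-+ (act π) (s % p) (s ℕ./ p * p) v ⟩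
      ^ (s % p) (^ (s ℕ./ p * p) v)    ≡⟨ cong (^ (s % p)) (iter-*-fixed (act π) (s ℕ./ p) p v ^p) ⟩
      ^ (s % p) v                    ∎

    ^-unique-≤ : ∀ i j → i ≤ j → j < p → ^ i v ≡ ^ j v → i ≡ j
    ^-unique-≤ i j i≤j j<p eq = ≤-antisym i≤j (m∸n≡0⇒m≤n (minimal (j ∸ i) (≤-<-trans (m∸n≤m j i) j<p)
      (iter-injective (act-injective π) i (trans (sym (iter-+ (act π) i (j ∸ i) v))
        (trans (cong (λ k → ^ k v) (m+[n∸m]≡n i≤j)) (sym eq))))))

    ^-unique : ∀ i j → i < p → j < p → ^ i v ≡ ^ j v → i ≡ j
    ^-unique i j i<p j<p eq with ≤-total i j
    ... | inj₁ i≤j = ^-unique-≤ i j i≤j j<p eq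
    ... | inj₂ j≤i = sym (^-unique-≤ j i j≤i i<p (sym eq))

    -- A point of the class is `^ i v` for exactly one `i < p`, found by reducing an exponent modulo
    -- `p`; a point outside the class is never reached. Summed over `u`, this converts a sum over
    -- the class into a sum over exponents.
    hits-once : ∀ u → 𝟙 (cl π u Fin.≟ cl π v) ≡ ∑ (upTo p) (λ i → 𝟙 (u Fin.≟ ^ i v))
    hits-once u with cl π u Fin.≟ cl π v
    ... | no cl≢ = sym (∑-zero (upTo p) (λ i → 𝟙-no (u Fin.≟ ^ i v) (λ { refl → cl≢ (cl-iter π i v) })))
    ... | yes cl≡ with cl≡⇒reaches π (sym cl≡)
    ...   | s , refl = sym (trans
      (∑-upTo-cong p (λ i i<p → 𝟙-⇔
        (λ eq → sym (^-unique (s % p) i (m%n<n s p) i<p (trans (sym (^-% s)) eq)))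
        (λ { refl → ^-% s }) (^ s v Fin.≟ ^ i v) (i ≟ s % p)))
      (∑-upTo-δ p (s % p) (m%n<n s p)))

    ∑-orbit-p : ∀ (f : Fin n → ℕ) → ∑ (allFin n) (λ u → 𝟙 (cl π u Fin.≟ cl π v) * f u) ≡ ∑ (upTo p) (λ i → f (^ i v))
    ∑-orbit-p f = begin
      ∑ (allFin n) (λ u → 𝟙 (cl π u Fin.≟ cl π v) * f u)
        ≡⟨ ∑-cong (allFin n) (λ u → trans (cong (_* f u) (hits-once u)) (sym (∑-*ʳ (upTo p) (f u) {λ i → 𝟙 (u Fin.≟ ^ i v)}))) ⟩
      ∑ (allFin n) (λ u → ∑ (upTo p) (λ i → 𝟙 (u Fin.≟ ^ i v) * f u))
        ≡⟨ ∑-swap (allFin n) (upTo p) _ ⟩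
      ∑ (upTo p) (λ i → ∑ (allFin n) (λ u → 𝟙 (u Fin.≟ ^ i v) * f u))
        ≡⟨ ∑-cong (upTo p) (λ i → ∑-δ (finFin n) (^ i v) f) ⟩
      ∑ (upTo p) (λ i → f (^ i v)) ∎

    ℓ≡p : ℓ π v ≡ p
    ℓ≡p = begin
      ∑ (allFin n) (λ u → 𝟙 (cl π u Fin.≟ cl π v)) ≡⟨ ∑-cong (allFin n) (λ u → sym (*-identityʳ _)) ⟩
      ∑ (allFin n) (λ u → 𝟙 (cl π u Fin.≟ cl π v) * 1) ≡⟨ ∑-orbit-p (λ _ → 1) ⟩
      ∑ (upTo p) (λ _ → 1)                             ≡⟨ ∑-1 (upTo p) ⟩
      length (upTo p)                                  ≡⟨ List.length-upTo p ⟩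
      p                                                ∎

  ∑-orbit : ∀ (f : Fin n → ℕ) →
    ∑ (allFin n) (λ u → 𝟙 (cl π u Fin.≟ cl π v) * f u) ≡ ∑ (upTo (ℓ π v)) (λ i → f (iter (act π) i v))
  ∑-orbit f = trans (∑-orbit-p f) (cong (λ k → ∑ (upTo k) (λ i → f (^ i v))) (sym ℓ≡p))

  fixed⇒ℓ∣ : ∀ s → iter (act π) s v ≡ v → ℓ π v ∣ s
  fixed⇒ℓ∣ s eq = subst (_∣ s) (sym ℓ≡p) (m%n≡0⇒n∣m s p (minimal (s % p) (m%n<n s p) (trans (sym (^-% s)) eq)))

  ℓ∣⇒fixed : ∀ s → ℓ π v ∣ s → iter (act π) s v ≡ v
  ℓ∣⇒fixed s ℓ∣s with subst (_∣ s) ℓ≡p ℓ∣s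
  ... | divides q refl = iter-*-fixed (act π) q p v ^p

  ℓ>0 : 0 < ℓ π v
  ℓ>0 = subst (0 <_) (sym ℓ≡p) z<s

len>0 : (π : Perm n) (c : Fin (ncyc π)) → 0 < len π c
len>0 π c with cl-surjective π c
... | v , refl = ℓ>0 π v

-- Counting equivariant maps

fix : Finite A → (A → A) → ℕ → ℕ
fix F h t = ∑ᶠ F (λ a → 𝟙 (_≟ᶠ_ F (iter h t a) a))

∏ᶜ : (k : ℕ) → (Fin k → ℕ) → ℕ
∏ᶜ k g = product (List.tabulate g)

∏ᶜ-cong : ∀ k {f g : Fin k → ℕ} → f ≗ g → ∏ᶜ k f ≡ ∏ᶜ k g
∏ᶜ-cong k eq = cong product (List.tabulate-cong eq)

module _ (F : Finite A) (h : A → A) where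

  private
    _≟ᴬ_ = _≟ᶠ_ F

  -- Only the weights `w v = 1` are wanted in the end, but removing a point from a cycle merges two
  -- steps into one, so the induction on `π` needs steps of arbitrary weight.
  Equivariant : (π : Perm n) (w : Fin n → ℕ) → Vec A n → Set
  Equivariant π w f = ∀ v → lookup f (act π v) ≡ iter h (w v) (lookup f v)

  equivariant? : ∀ (π : Perm n) w f → Dec (Equivariant π w f)
  equivariant? π w f = Fin.all? λ v → lookup f (act π v) ≟ᴬ iter h (w v) (lookup f v)

  -- The number of times `h` is applied on one tour of the cycle `c`; the value at a point of `c`
  -- must be fixed by that power of `h`.
  classWeight : (π : Perm n) (w : Fin n → ℕ) → Fin (ncyc π) → ℕ
  classWeight {n} π w c = ∑ (allFin n) (λ v → 𝟙 (cl π v Fin.≟ c) * w v)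

  -- Induction on π.  A fixed point contributes a free factor; an inserted
  -- point is determined by its predecessor, which takes over its weight.
  ∑-equivariant : ∀ {n} (π : Perm n) w →
    ∑ᶠ (finVec F n) (λ f → 𝟙 (equivariant? π w f)) ≡ ∏ᶜ (ncyc π) (fix F h ∘ classWeight π w)
  ∑-equivariant []         w = cong (_+ 0) (𝟙-yes (equivariant? [] w []) (λ ()))
  ∑-equivariant {suc n} (zero ∷ π) w = begin
    ∑ᶠ (finVec F (suc n)) (λ f → 𝟙 (equivariant? (zero ∷ π) w f))
      ≡⟨ ∑-cartesianProductWith _∷_ (elements F) (elements (finVec F n)) ⟩
    ∑ᶠ F (λ a → ∑ᶠ (finVec F n) (λ f → 𝟙 (equivariant? (zero ∷ π) w (a ∷ f))))
      ≡⟨ ∑-cong (elements F) (λ a → trans (∑-cong (elements (finVec F n)) (λ f → split a f))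
           (∑-*ˡ (elements (finVec F n)) (𝟙 (iter h (w zero) a ≟ᴬ a)))) ⟩
    ∑ᶠ F (λ a → 𝟙 (iter h (w zero) a ≟ᴬ a) * ∑ᶠ (finVec F n) (λ f → 𝟙 (equivariant? π (w ∘ suc) f)))
      ≡⟨ ∑-*ʳ (elements F) _ ⟩
    fix F h (w zero) * ∑ᶠ (finVec F n) (λ f → 𝟙 (equivariant? π (w ∘ suc) f))
      ≡⟨ cong₂ _*_ (cong (fix F h) (sym weight-zero)) (trans (∑-equivariant π (w ∘ suc))
           (∏ᶜ-cong (ncyc π) (λ c → cong (fix F h) (sym (weight-suc c))))) ⟩
    ∏ᶜ (ncyc (zero ∷ π)) (fix F h ∘ classWeight (zero ∷ π) w) ∎
    where
    split : ∀ a f → 𝟙 (equivariant? (zero ∷ π) w (a ∷ f)) ≡ 𝟙 (iter h (w zero) a ≟ᴬ a) * 𝟙 (equivariant? π (w ∘ suc) f)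
    split a f = trans
      (𝟙-⇔ (λ eq → sym (eq zero) , eq ∘ suc) (λ { (eq , eqs) → λ { zero → sym eq ; (suc v) → eqs v } })
        (equivariant? (zero ∷ π) w (a ∷ f)) ((iter h (w zero) a ≟ᴬ a) ×-dec equivariant? π (w ∘ suc) f))
      (𝟙-× (iter h (w zero) a ≟ᴬ a) (equivariant? π (w ∘ suc) f))
    weight-zero : classWeight (zero ∷ π) w zero ≡ w zero
    weight-zero = trans (∑-allFin-suc n (λ v → 𝟙 (cl (zero ∷ π) v Fin.≟ zero) * w v))
      (trans (cong₂ _+_ (*-identityˡ (w zero)) (∑-zero (allFin n) (λ _ → refl))) (+-identityʳ (w zero)))
    weight-suc : ∀ c → classWeight (zero ∷ π) w (suc c) ≡ classWeight π (w ∘ suc) c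
    weight-suc c = trans (∑-allFin-suc n (λ v → 𝟙 (cl (zero ∷ π) v Fin.≟ suc c) * w v))
      (∑-cong (allFin n) (λ v → cong (_* w (suc v))
        (𝟙-⇔ Fin.suc-injective (cong suc) (suc (cl π v) Fin.≟ suc c) (cl π v Fin.≟ c))))
  ∑-equivariant {suc n} (suc j ∷ π) w = begin
    ∑ᶠ (finVec F (suc n)) (λ f → 𝟙 (equivariant? (suc j ∷ π) w f))
      ≡⟨ ∑-cartesianProductWith _∷_ (elements F) (elements (finVec F n)) ⟩
    ∑ᶠ F (λ a → ∑ᶠ (finVec F n) (λ f → 𝟙 (equivariant? (suc j ∷ π) w (a ∷ f))))
      ≡⟨ ∑-swap (elements F) (elements (finVec F n)) _ ⟩
    ∑ᶠ (finVec F n) (λ f → ∑ᶠ F (λ a → 𝟙 (equivariant? (suc j ∷ π) w (a ∷ f))))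
      ≡⟨ ∑-cong (elements (finVec F n)) (λ f → trans (∑-cong (elements F) (λ a → split a f))
           (∑-δ F (iter h (w (suc pre)) (lookup f pre)) _)) ⟩
    ∑ᶠ (finVec F n) (λ f → 𝟙 (equivariant? π w′ f))
      ≡⟨ ∑-equivariant π w′ ⟩
    ∏ᶜ (ncyc π) (fix F h ∘ classWeight π w′)
      ≡⟨ ∏ᶜ-cong (ncyc π) (λ c → cong (fix F h) (weight-eq c)) ⟩
    ∏ᶜ (ncyc π) (fix F h ∘ classWeight (suc j ∷ π) w) ∎
    where
    pre : Fin n
    pre = act⁻ π j
    w′ : Fin n → ℕ
    w′ v = 𝟙 (v Fin.≟ pre) * w zero + w (suc v)
    w′-pre : w′ pre ≡ w zero + w (suc pre)
    w′-pre = cong (_+ w (suc pre)) (trans (cong (_* w zero) (𝟙-yes (pre Fin.≟ pre) refl)) (*-identityˡ (w zero)))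
    w′-other : ∀ v → v ≢ pre → w′ v ≡ w (suc v)
    w′-other v v≢pre = cong (λ k → k * w zero + w (suc v)) (𝟙-no (v Fin.≟ pre) v≢pre)
    act-pre : act (suc j ∷ π) (suc pre) ≡ zero
    act-pre with act π pre Fin.≟ j
    ... | yes _  = refl
    ... | no neq = contradiction (act-act⁻ π j) neq
    act-other : ∀ v → v ≢ pre → act (suc j ∷ π) (suc v) ≡ suc (act π v)
    act-other v v≢pre with act π v Fin.≟ j
    ... | yes eq = contradiction (act-injective π (trans eq (sym (act-act⁻ π j)))) v≢pre
    ... | no _   = refl
    to : ∀ a f → Equivariant (suc j ∷ π) w (a ∷ f) → a ≡ iter h (w (suc pre)) (lookup f pre) × Equivariant π w′ f
    to a f eq = a≡ , eqs
      where
      a≡ : a ≡ iter h (w (suc pre)) (lookup f pre)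
      a≡ = trans (cong (lookup (a ∷ f)) (sym act-pre)) (eq (suc pre))
      eqs : Equivariant π w′ f
      eqs v with v Fin.≟ pre
      ... | yes refl = begin
        lookup f (act π pre)                               ≡⟨ cong (lookup f) (act-act⁻ π j) ⟩
        lookup f j                                         ≡⟨ eq zero ⟩
        iter h (w zero) a                                  ≡⟨ cong (iter h (w zero)) a≡ ⟩
        iter h (w zero) (iter h (w (suc pre)) (lookup f pre)) ≡⟨ iter-+ h (w zero) (w (suc pre)) _ ⟨
        iter h (w zero + w (suc pre)) (lookup f pre) ≡⟨ cong (λ k → iter h (k + w (suc pre)) (lookup f pre)) (*-identityˡ (w zero)) ⟨
        iter h (1 * w zero + w (suc pre)) (lookup f pre)   ∎
      ... | no v≢pre = trans (cong (lookup (a ∷ f)) (sym (act-other v v≢pre))) (eq (suc v))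
    from : ∀ a f → a ≡ iter h (w (suc pre)) (lookup f pre) × Equivariant π w′ f → Equivariant (suc j ∷ π) w (a ∷ f)
    from a f (a≡ , eqs) zero = begin
      lookup f j                                         ≡⟨ cong (lookup f) (act-act⁻ π j) ⟨
      lookup f (act π pre)                               ≡⟨ eqs pre ⟩
      iter h (w′ pre) (lookup f pre) ≡⟨ cong (λ k → iter h k (lookup f pre)) w′-pre ⟩
      iter h (w zero + w (suc pre)) (lookup f pre)       ≡⟨ iter-+ h (w zero) (w (suc pre)) _ ⟩
      iter h (w zero) (iter h (w (suc pre)) (lookup f pre)) ≡⟨ cong (iter h (w zero)) a≡ ⟨
      iter h (w zero) a                                  ∎
    from a f (a≡ , eqs) (suc v) with v Fin.≟ pre
    ... | yes refl = trans (cong (lookup (a ∷ f)) act-pre) a≡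
    ... | no v≢pre = begin
      lookup (a ∷ f) (act (suc j ∷ π) (suc v))  ≡⟨ cong (lookup (a ∷ f)) (act-other v v≢pre) ⟩
      lookup f (act π v)                        ≡⟨ eqs v ⟩
      iter h (w′ v) (lookup f v) ≡⟨ cong (λ k → iter h k (lookup f v)) (w′-other v v≢pre) ⟩
      iter h (w (suc v)) (lookup f v)           ∎
    split : ∀ a f → 𝟙 (equivariant? (suc j ∷ π) w (a ∷ f)) ≡
                    𝟙 (a ≟ᴬ iter h (w (suc pre)) (lookup f pre)) * 𝟙 (equivariant? π w′ f)
    split a f = trans
      (𝟙-⇔ (to a f) (from a f) (equivariant? (suc j ∷ π) w (a ∷ f))
        ((a ≟ᴬ iter h (w (suc pre)) (lookup f pre)) ×-dec equivariant? π w′ f))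
      (𝟙-× (a ≟ᴬ iter h (w (suc pre)) (lookup f pre)) (equivariant? π w′ f))
    weight-eq : ∀ c → classWeight π w′ c ≡ classWeight (suc j ∷ π) w c
    weight-eq c = begin
      ∑ (allFin n) (λ v → 𝟙 (cl π v Fin.≟ c) * (𝟙 (v Fin.≟ pre) * w zero + w (suc v)))
        ≡⟨ ∑-cong (allFin n) (λ v → trans (*-distribˡ-+ (𝟙 (cl π v Fin.≟ c)) _ _)
             (cong (_+ 𝟙 (cl π v Fin.≟ c) * w (suc v)) (*-x∙yz≈y∙xz (𝟙 (cl π v Fin.≟ c)) (𝟙 (v Fin.≟ pre)) (w zero)))) ⟩
      ∑ (allFin n) (λ v → 𝟙 (v Fin.≟ pre) * (𝟙 (cl π v Fin.≟ c) * w zero) + 𝟙 (cl π v Fin.≟ c) * w (suc v))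
        ≡⟨ ∑-+ (allFin n) ⟩
      ∑ (allFin n) (λ v → 𝟙 (v Fin.≟ pre) * (𝟙 (cl π v Fin.≟ c) * w zero)) + ∑ (allFin n) (λ v → 𝟙 (cl π v Fin.≟ c) * w (suc v))
        ≡⟨ cong (_+ ∑ (allFin n) (λ v → 𝟙 (cl π v Fin.≟ c) * w (suc v))) (trans
             (∑-δ (finFin n) pre (λ v → 𝟙 (cl π v Fin.≟ c) * w zero))
             (cong (λ d → 𝟙 (d Fin.≟ c) * w zero) (trans (sym (cl-act π pre)) (cong (cl π) (act-act⁻ π j))))) ⟩
      𝟙 (cl π j Fin.≟ c) * w zero + ∑ (allFin n) (λ v → 𝟙 (cl π v Fin.≟ c) * w (suc v))
        ≡⟨ ∑-allFin-suc n (λ v → 𝟙 (cl (suc j ∷ π) v Fin.≟ c) * w v) ⟨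
      ∑ (allFin (suc n)) (λ v → 𝟙 (cl (suc j ∷ π) v Fin.≟ c) * w v) ∎

  ∑-commuting : (π : Perm n) →
    ∑ᶠ (finVec F n) (λ f → 𝟙 (Fin.all? λ v → lookup f (act π v) ≟ᴬ h (lookup f v))) ≡ ∏ᶜ (ncyc π) (fix F h ∘ len π)
  ∑-commuting {n} π = trans (∑-equivariant π (λ _ → 1))
    (∏ᶜ-cong (ncyc π) (λ c → cong (fix F h) (∑-cong (allFin n) (λ v → *-identityʳ _))))

-- Cycle types

∑-mono-≤ : ∀ (xs : List A) {f g : A → ℕ} → (∀ x → f x ≤ g x) → ∑ xs f ≤ ∑ xs g
∑-mono-≤ []       le = z≤n
∑-mono-≤ (x ∷ xs) le = +-mono-≤ (le x) (∑-mono-≤ xs le)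

𝟙≤1 : {P : Set} (p? : Dec P) → 𝟙 p? ≤ 1
𝟙≤1 (yes _) = ≤-refl
𝟙≤1 (no _)  = z≤n

∑𝟙≤length : ∀ (xs : List A) {P : A → Set} (P? : ∀ x → Dec (P x)) → ∑ xs (𝟙 ∘ P?) ≤ length xs
∑𝟙≤length xs P? = subst (∑ xs (𝟙 ∘ P?) ≤_) (∑-1 xs) (∑-mono-≤ xs (𝟙≤1 ∘ P?))

ncyc≤n : (π : Perm n) → ncyc π ≤ n
ncyc≤n []          = z≤n
ncyc≤n (zero ∷ π)  = s≤s (ncyc≤n π)
ncyc≤n (suc _ ∷ π) = m≤n⇒m≤1+n (ncyc≤n π)

len≤n : (π : Perm n) (c : Fin (ncyc π)) → len π c ≤ n
len≤n {n} π c = subst (len π c ≤_) (length-allFin n) (∑𝟙≤length (allFin n) (λ v → cl π v Fin.≟ c))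

type : Perm n → ℕ → ℕ
type π t = ∑ (allFin (ncyc π)) (λ c → 𝟙 (len π c ≟ t))

type≤n : (π : Perm n) → ∀ t → type π t ≤ n
type≤n π t = ≤-trans (subst (type π t ≤_) (length-allFin (ncyc π)) (∑𝟙≤length (allFin (ncyc π)) (λ c → len π c ≟ t)))
                     (ncyc≤n π)

type-zero : (π : Perm n) → type π 0 ≡ 0
type-zero π = ∑-zero (allFin (ncyc π)) (λ c → 𝟙-no (len π c ≟ 0) (λ eq → <⇒≢ (len>0 π c) (sym eq)))

type-> : (π : Perm n) → ∀ t → n < t → type π t ≡ 0
type-> π t n<t = ∑-zero (allFin (ncyc π)) (λ c → 𝟙-no (len π c ≟ t) (λ eq → <⇒≱ n<t (subst (_≤ _) eq (len≤n π c))))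

-- The bound `b` is left free because the uses sum up to different limits, among them `n` and
-- `n + t`.
∑-by-length : (π : Perm n) → ∀ b → n ≤ b → (φ : ℕ → ℕ) →
  ∑ (allFin (ncyc π)) (φ ∘ len π) ≡ ∑ (upTo b) (λ i → type π (suc i) * φ (suc i))
∑-by-length {n} π b n≤b φ = begin
  ∑ (allFin (ncyc π)) (φ ∘ len π)
    ≡⟨ ∑-cong (allFin (ncyc π)) pick ⟩
  ∑ (allFin (ncyc π)) (λ c → ∑ (upTo b) (λ i → 𝟙 (len π c ≟ suc i) * φ (suc i)))
    ≡⟨ ∑-swap (allFin (ncyc π)) (upTo b) _ ⟩
  ∑ (upTo b) (λ i → ∑ (allFin (ncyc π)) (λ c → 𝟙 (len π c ≟ suc i) * φ (suc i)))
    ≡⟨ ∑-cong (upTo b) (λ i → ∑-*ʳ (allFin (ncyc π)) (φ (suc i))) ⟩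
  ∑ (upTo b) (λ i → type π (suc i) * φ (suc i)) ∎
  where
  pick : ∀ c → φ (len π c) ≡ ∑ (upTo b) (λ i → 𝟙 (len π c ≟ suc i) * φ (suc i))
  pick c with len π c | len>0 π c | len≤n π c
  ... | suc l | _ | l<n = sym (trans
    (∑-cong (upTo b) (λ i → cong (_* φ (suc i))
      (𝟙-⇔ (sym ∘ suc-injective) (cong suc ∘ sym) (suc l ≟ suc i) (i ≟ l))))
    (∑-upTo-pick b l (≤-trans l<n n≤b) (φ ∘ suc)))

∑-ℓ : (π : Perm n) → ∀ b → n ≤ b → (φ : ℕ → ℕ) →
  ∑ (allFin n) (φ ∘ ℓ π) ≡ ∑ (upTo b) (λ i → type π (suc i) * (suc i * φ (suc i)))
∑-ℓ π b n≤b φ = trans (∑-by-class π (φ ∘ len π)) (∑-by-length π b n≤b (λ t → t * φ t))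

type-weight : (π : Perm n) → ∀ b → n ≤ b → ∑ (upTo b) (λ i → suc i * type π (suc i)) ≡ n
type-weight {n} π b n≤b = begin
  ∑ (upTo b) (λ i → suc i * type π (suc i))
    ≡⟨ ∑-cong (upTo b) (λ i → trans (*-comm (suc i) (type π (suc i))) (cong (type π (suc i) *_) (sym (*-identityʳ (suc i))))) ⟩
  ∑ (upTo b) (λ i → type π (suc i) * (suc i * 1)) ≡⟨ ∑-ℓ π b n≤b (λ _ → 1) ⟨
  ∑ (allFin n) (λ _ → 1)                          ≡⟨ ∑-1 (allFin n) ⟩
  length (allFin n)                               ≡⟨ length-allFin n ⟩
  n                                               ∎

-- The type `k` with one more cycle of length `s`. Removing a cycle is expressed by adding it on the
-- other side of an equation, which avoids truncated subtraction.
infixl 6 _⊕_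
_⊕_ : (ℕ → ℕ) → ℕ → ℕ → ℕ
(k ⊕ s) t = 𝟙 (t ≟ s) + k t

type-fixed-point : (π : Perm n) → ∀ t → type (zero ∷ π) t ≡ (type π ⊕ 1) t
type-fixed-point {n} π t = trans (∑-allFin-suc (ncyc π) (λ c → 𝟙 (len (zero ∷ π) c ≟ t)))
  (cong₂ _+_ (𝟙-⇔ (λ eq → trans (sym eq) len-zero) (λ eq → trans len-zero (sym eq)) (len (zero ∷ π) zero ≟ t) (t ≟ 1))
    (∑-cong (allFin (ncyc π)) (λ c → cong (λ l → 𝟙 (l ≟ t)) (len-suc c))))
  where
  len-zero : len (zero ∷ π) zero ≡ 1
  len-zero = trans (∑-allFin-suc n (λ v → 𝟙 (cl (zero ∷ π) v Fin.≟ zero))) (cong suc (∑-zero (allFin n) (λ _ → refl)))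
  len-suc : ∀ c → len (zero ∷ π) (suc c) ≡ len π c
  len-suc c = trans (∑-allFin-suc n (λ v → 𝟙 (cl (zero ∷ π) v Fin.≟ suc c)))
    (∑-cong (allFin n) (λ v → 𝟙-⇔ Fin.suc-injective (cong suc) (suc (cl π v) Fin.≟ suc c) (cl π v Fin.≟ c)))

-- Class by class, only `cl π j` changes its length, by one: a cycle of length `ℓ π j` is traded for
-- one of length `suc (ℓ π j)`.
type-insert : (j : Fin n) (π : Perm n) → ∀ t → (type (suc j ∷ π) ⊕ ℓ π j) t ≡ (type π ⊕ suc (ℓ π j)) t
type-insert {n} j π t = begin
  𝟙 (t ≟ ℓ π j) + ∑ cs (λ c → 𝟙 (len (suc j ∷ π) c ≟ t))
    ≡⟨ cong (_+ ∑ cs (λ c → 𝟙 (len (suc j ∷ π) c ≟ t))) (∑-δ (finFin (ncyc π)) cj (λ c → 𝟙 (t ≟ len π c))) ⟨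
  ∑ cs (λ c → 𝟙 (c Fin.≟ cj) * 𝟙 (t ≟ len π c)) + ∑ cs (λ c → 𝟙 (len (suc j ∷ π) c ≟ t))
    ≡⟨ ∑-+ cs ⟨
  ∑ cs (λ c → 𝟙 (c Fin.≟ cj) * 𝟙 (t ≟ len π c) + 𝟙 (len (suc j ∷ π) c ≟ t))
    ≡⟨ ∑-cong cs exchange ⟩
  ∑ cs (λ c → 𝟙 (c Fin.≟ cj) * 𝟙 (t ≟ suc (len π c)) + 𝟙 (len π c ≟ t))
    ≡⟨ ∑-+ cs ⟩
  ∑ cs (λ c → 𝟙 (c Fin.≟ cj) * 𝟙 (t ≟ suc (len π c))) + type π t
    ≡⟨ cong (_+ type π t) (∑-δ (finFin (ncyc π)) cj (λ c → 𝟙 (t ≟ suc (len π c)))) ⟩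
  𝟙 (t ≟ suc (ℓ π j)) + type π t ∎
  where
  cs : List (Fin (ncyc π))
  cs = allFin (ncyc π)
  cj : Fin (ncyc π)
  cj = cl π j
  len-insert : ∀ c → len (suc j ∷ π) c ≡ 𝟙 (cj Fin.≟ c) + len π c
  len-insert c = ∑-allFin-suc n (λ v → 𝟙 (cl (suc j ∷ π) v Fin.≟ c))
  exchange : ∀ c → 𝟙 (c Fin.≟ cj) * 𝟙 (t ≟ len π c) + 𝟙 (len (suc j ∷ π) c ≟ t) ≡
                   𝟙 (c Fin.≟ cj) * 𝟙 (t ≟ suc (len π c)) + 𝟙 (len π c ≟ t)
  exchange c rewrite len-insert c with c Fin.≟ cj
  ... | no c≢ rewrite 𝟙-no (cj Fin.≟ c) (c≢ ∘ sym) = refl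
  ... | yes refl rewrite 𝟙-yes (c Fin.≟ c) refl = begin
    𝟙 (t ≟ len π c) + 0 + 𝟙 (suc (len π c) ≟ t) ≡⟨ cong₂ _+_ (+-identityʳ _) (𝟙-⇔ sym sym (suc (len π c) ≟ t) (t ≟ suc (len π c))) ⟩
    𝟙 (t ≟ len π c) + 𝟙 (t ≟ suc (len π c))     ≡⟨ +-comm (𝟙 (t ≟ len π c)) _ ⟩
    𝟙 (t ≟ suc (len π c)) + 𝟙 (t ≟ len π c) ≡⟨ cong₂ _+_ (sym (+-identityʳ _)) (𝟙-⇔ sym sym (t ≟ len π c) (len π c ≟ t)) ⟩
    𝟙 (t ≟ suc (len π c)) + 0 + 𝟙 (len π c ≟ t) ∎

product-upTo-1 : ∀ b → product (applyUpTo (λ _ → 1) b) ≡ 1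
product-upTo-1 zero    = refl
product-upTo-1 (suc b) = cong (1 *_) (product-upTo-1 b)

product-cong-< : ∀ b {f g : ℕ → ℕ} → (∀ i → i < b → f i ≡ g i) → product (applyUpTo f b) ≡ product (applyUpTo g b)
product-cong-< zero    eq = refl
product-cong-< (suc b) eq = cong₂ _*_ (eq 0 z<s) (product-cong-< b (λ i → eq (suc i) ∘ s<s))

product-change : ∀ b i → i < b → ∀ {f g : ℕ → ℕ} a → f i ≡ a * g i → (∀ m → m ≢ i → f m ≡ g m) →
                 product (applyUpTo f b) ≡ a * product (applyUpTo g b)
product-change (suc b) zero    _         {f} {g} a at off = trans
  (cong₂ _*_ at (product-cong-< b (λ m _ → off (suc m) (λ ())))) (*-assoc a (g 0) _)
product-change (suc b) (suc i) (s≤s i<b) {f} {g} a at off = trans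
  (cong₂ _*_ (off 0 (λ ())) (product-change b i i<b a at (λ m m≢i → off (suc m) (m≢i ∘ suc-injective))))
  (*-x∙yz≈y∙xz (g 0) a _)

-- Types are functions compared at 1, ..., b, not vectors of length n, so that the recursion on n
-- can keep one `b` throughout and change single entries by `⊕`.
module Multiplicity (b : ℕ) where

  Agree : (k l : ℕ → ℕ) → Set
  Agree k l = ∀ {i} → i < b → k (suc i) ≡ l (suc i)

  agree? : ∀ k l → Dec (Agree k l)
  agree? k l = allUpTo? (λ i → k (suc i) ≟ l (suc i)) b

  weightᶠ : (ℕ → ℕ) → ℕ
  weightᶠ k = ∑ (upTo b) (λ i → suc i * k (suc i))

  zᶠ : (ℕ → ℕ) → ℕ
  zᶠ k = product (applyUpTo (λ i → (k (suc i)) ! * suc i ^ k (suc i)) b)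

  multiplicity : ℕ → (ℕ → ℕ) → ℕ
  multiplicity n k = ∑ᶠ (finPerm n) (λ π → 𝟙 (agree? (type π) k))

  -- The number of ways to lengthen a cycle of length e in a permutation of type k;
  -- creating a new fixed point counts as lengthening an empty cycle.
  ways : ℕ → (ℕ → ℕ) → ℕ
  ways zero    k = 1
  ways (suc i) k = k (suc i) * suc i

  private
    zᶠ-cong : ∀ k l → Agree k l → zᶠ k ≡ zᶠ l
    zᶠ-cong k l ag = product-cong-< b (λ i i<b → cong (λ m → m ! * suc i ^ m) (ag i<b))

    weightᶠ-cong : ∀ k l → Agree k l → weightᶠ k ≡ weightᶠ l
    weightᶠ-cong k l ag = ∑-upTo-cong b (λ i i<b → cong (suc i *_) (ag i<b))

    ways-cong : ∀ e {k l} → e ≤ b → Agree k l → ways e k ≡ ways e l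
    ways-cong zero    _   ag = refl
    ways-cong (suc i) i<b ag = cong (_* suc i) (ag i<b)

    ⊕-≡ : ∀ k s → (k ⊕ s) s ≡ suc (k s)
    ⊕-≡ k s = cong (_+ k s) (𝟙-yes (s ≟ s) refl)

    ⊕-≢ : ∀ k s t → t ≢ s → (k ⊕ s) t ≡ k t
    ⊕-≢ k s t t≢s = cong (_+ k t) (𝟙-no (t ≟ s) t≢s)

    -- When k_e grows by one, k_e! e^k_e is multiplied by the new k_e times e, which is
    -- `ways e (k ⊕ e)`. For e = 0 the changed entry lies outside the product.
    zᶠ-⊕ : ∀ k e → e ≤ b → zᶠ (k ⊕ e) ≡ ways e (k ⊕ e) * zᶠ k
    zᶠ-⊕ k zero    _   = trans (zᶠ-cong (k ⊕ 0) k (λ _ → refl)) (sym (*-identityˡ _))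
    zᶠ-⊕ k (suc i) i<b = product-change b i i<b ((k ⊕ suc i) (suc i) * suc i) at (λ m m≢i → cong (λ v → v ! * suc m ^ v) (⊕-≢ k (suc i) (suc m) (m≢i ∘ suc-injective)))
      where
      at : ((k ⊕ suc i) (suc i)) ! * suc i ^ ((k ⊕ suc i) (suc i)) ≡ (k ⊕ suc i) (suc i) * suc i * (k (suc i) ! * suc i ^ k (suc i))
      at rewrite ⊕-≡ k (suc i) = *-interchange (suc (k (suc i))) (k (suc i) !) (suc i) (suc i ^ k (suc i))

    weightᶠ-⊕ : ∀ k e → e ≤ b → weightᶠ (k ⊕ e) ≡ e + weightᶠ k
    weightᶠ-⊕ k zero    _   = weightᶠ-cong (k ⊕ 0) k (λ _ → refl)
    weightᶠ-⊕ k (suc i) i<b = begin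
      ∑ (upTo b) (λ m → suc m * (𝟙 (suc m ≟ suc i) + k (suc m)))
        ≡⟨ ∑-cong (upTo b) (λ m → trans (*-distribˡ-+ (suc m) (𝟙 (suc m ≟ suc i)) (k (suc m)))
             (cong (_+ suc m * k (suc m)) (trans (*-comm (suc m) (𝟙 (suc m ≟ suc i)))
               (cong (_* suc m) (𝟙-⇔ suc-injective (cong suc) (suc m ≟ suc i) (m ≟ i)))))) ⟩
      ∑ (upTo b) (λ m → 𝟙 (m ≟ i) * suc m + suc m * k (suc m))
        ≡⟨ ∑-+ (upTo b) ⟩
      ∑ (upTo b) (λ m → 𝟙 (m ≟ i) * suc m) + weightᶠ k
        ≡⟨ cong (_+ weightᶠ k) (∑-upTo-pick b i i<b suc) ⟩
      suc i + weightᶠ k ∎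

    -- `k ⊕ 0` does not differ from `k` at positive indices; it is written to make a new fixed point
    -- the case e = 0 of the pattern in `agree-insert`.
    agree-fixed-point : (π : Perm n) → ∀ k → 𝟙 (agree? (type (zero ∷ π)) k) ≡ 𝟙 (agree? (type π ⊕ 1) (k ⊕ 0))
    agree-fixed-point π k = 𝟙-⇔
      (λ ag {i} i<b → trans (sym (type-fixed-point π (suc i))) (ag i<b))
      (λ ag {i} i<b → trans (type-fixed-point π (suc i)) (ag i<b))
      (agree? (type (zero ∷ π)) k) (agree? (type π ⊕ 1) (k ⊕ 0))

    agree-insert : (j : Fin n) (π : Perm n) → ∀ k → 𝟙 (agree? (type (suc j ∷ π)) k) ≡ 𝟙 (agree? (type π ⊕ suc (ℓ π j)) (k ⊕ ℓ π j))
    agree-insert j π k = 𝟙-⇔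
      (λ ag {i} i<b → trans (sym (type-insert j π (suc i))) (cong (𝟙 (suc i ≟ ℓ π j) +_) (ag i<b)))
      (λ ag {i} i<b → +-cancelˡ-≡ (𝟙 (suc i ≟ ℓ π j)) _ _ (trans (type-insert j π (suc i)) (ag i<b)))
      (agree? (type (suc j ∷ π)) k) (agree? (type π ⊕ suc (ℓ π j)) (k ⊕ ℓ π j))

  -- The type of `suc j ∷ π` depends on `j` only through `ℓ π j`, so the sum over `j` can be grouped
  -- by cycle length; e = 0 is the new fixed point.
  multiplicity-rec : ∀ n k → n < b → multiplicity (suc n) k ≡
    ∑ᶠ (finPerm n) (λ π → ∑ (upTo b) (λ e → ways e (type π) * 𝟙 (agree? (type π ⊕ suc e) (k ⊕ e))))
  multiplicity-rec n k (s≤s {n = b′} n≤b′) = trans (∑-finPerm n _) (∑-cong (elements (finPerm n)) (λ π → begin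
    𝟙 (agree? (type (zero ∷ π)) k) + ∑ (allFin n) (λ j → 𝟙 (agree? (type (suc j ∷ π)) k))
      ≡⟨ cong₂ _+_ (trans (agree-fixed-point π k) (sym (+-identityʳ _)))
           (trans (∑-cong (allFin n) (λ j → agree-insert j π k))
             (∑-ℓ π b′ n≤b′ (λ e → 𝟙 (agree? (type π ⊕ suc e) (k ⊕ e))))) ⟩
    1 * 𝟙 (agree? (type π ⊕ 1) (k ⊕ 0)) +
      ∑ (upTo b′) (λ i → type π (suc i) * (suc i * 𝟙 (agree? (type π ⊕ suc (suc i)) (k ⊕ suc i))))
      ≡⟨ cong (1 * 𝟙 (agree? (type π ⊕ 1) (k ⊕ 0)) +_) (∑-cong (upTo b′) (λ i → sym (*-assoc (type π (suc i)) (suc i) _))) ⟩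
    1 * 𝟙 (agree? (type π ⊕ 1) (k ⊕ 0)) +
      ∑ (upTo b′) (λ i → ways (suc i) (type π) * 𝟙 (agree? (type π ⊕ suc (suc i)) (k ⊕ suc i)))
      ≡⟨ ∑-upTo-suc b′ (λ e → ways e (type π) * 𝟙 (agree? (type π ⊕ suc e) (k ⊕ e))) ⟨
    ∑ (upTo (suc b′)) (λ e → ways e (type π) * 𝟙 (agree? (type π ⊕ suc e) (k ⊕ e))) ∎))

  -- The permutations that arise by lengthening a cycle of length e contribute
  -- (e + 1) k_{e+1} n! to the product, and these terms add up to weightᶠ k * n !.
  multiplicity-z : ∀ n k → n ≤ b → weightᶠ k ≡ n → multiplicity n k * zᶠ k ≡ n !
  multiplicity-z zero    k _   wk = begin
    (𝟙 (agree? (type []) k) + 0) * zᶠ k ≡⟨ cong₂ (λ a z → (a + 0) * z) (𝟙-yes (agree? (type []) k) (λ i<b → sym (k≡0 i<b)))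
                                            (trans (product-cong-< b (λ i i<b → trans (cong (λ m → m ! * suc i ^ m) (k≡0 i<b)) refl)) (product-upTo-1 b)) ⟩
    1 ∎
    where
    zero-term : ∀ b (f : ℕ → ℕ) → ∑ (upTo b) f ≡ 0 → ∀ i → i < b → f i ≡ 0
    zero-term (suc b) f eq zero    _         = m+n≡0⇒m≡0 (f 0) (trans (sym (∑-upTo-suc b f)) eq)
    zero-term (suc b) f eq (suc i) (s≤s i<b) = zero-term b (f ∘ suc) (m+n≡0⇒n≡0 (f 0) (trans (sym (∑-upTo-suc b f)) eq)) i i<b
    k≡0 : Agree k (λ _ → 0)
    k≡0 {i} i<b = m+n≡0⇒m≡0 (k (suc i)) (zero-term b (λ i → suc i * k (suc i)) wk i i<b)
  multiplicity-z (suc n) k n<b wk = begin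
    multiplicity (suc n) k * zᶠ k
      ≡⟨ cong (_* zᶠ k) (trans (multiplicity-rec n k n<b) (∑-swap (elements (finPerm n)) (upTo b) _)) ⟩
    ∑ (upTo b) (λ e → ∑ᶠ (finPerm n) (λ π → ways e (type π) * 𝟙 (agree? (type π ⊕ suc e) (k ⊕ e)))) * zᶠ k
      ≡⟨ ∑-*ʳ (upTo b) (zᶠ k) ⟨
    ∑ (upTo b) (λ e → ∑ᶠ (finPerm n) (λ π → ways e (type π) * 𝟙 (agree? (type π ⊕ suc e) (k ⊕ e))) * zᶠ k)
      ≡⟨ ∑-upTo-cong b term ⟩
    ∑ (upTo b) (λ e → suc e * k (suc e) * n !)
      ≡⟨ ∑-*ʳ (upTo b) (n !) ⟩
    weightᶠ k * n !
      ≡⟨ cong (_* n !) wk ⟩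
    suc n * n ! ∎
    where
    term : ∀ e → e < b →
      ∑ᶠ (finPerm n) (λ π → ways e (type π) * 𝟙 (agree? (type π ⊕ suc e) (k ⊕ e))) * zᶠ k ≡ suc e * k (suc e) * n !
    term e e<b with k (suc e) in k≡
    -- If `k` has no cycle of length e + 1, lengthening a cycle of length e cannot produce type `k`,
    -- and both sides vanish.
    ... | zero = trans
      (cong (_* zᶠ k) (∑-zero (elements (finPerm n)) (λ π → trans (cong (ways e (type π) *_)
        (𝟙-no (agree? (type π ⊕ suc e) (k ⊕ e)) (λ ag → 1+n≢0 (trans (sym (⊕-≡ (type π) (suc e)))
          (trans (ag e<b) (trans (⊕-≢ k e (suc e) 1+n≢n) k≡)))))) (*-zeroʳ (ways e (type π))))))
      (sym (cong (_* n !) (*-zeroʳ e)))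
    ... | suc m = begin
      ∑ᶠ (finPerm n) (λ π → ways e (type π) * 𝟙 (agree? (type π ⊕ suc e) (k ⊕ e))) * zᶠ k
        ≡⟨ cong₂ _*_ (trans (∑-cong (elements (finPerm n)) summand) (∑-*ʳ (elements (finPerm n)) (ways e (k₀ ⊕ e))))
             (trans (zᶠ-cong k (k₀ ⊕ suc e) k≗) (trans (zᶠ-⊕ k₀ (suc e) e<b) (cong (_* zᶠ k₀) (cong (_* suc e) (trans (sym (k≗ e<b)) k≡))))) ⟩
      multiplicity n (k₀ ⊕ e) * ways e (k₀ ⊕ e) * (suc m * suc e * zᶠ k₀)
        ≡⟨ *-x∙yz≈y∙xz (multiplicity n (k₀ ⊕ e) * ways e (k₀ ⊕ e)) (suc m * suc e) (zᶠ k₀) ⟩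
      suc m * suc e * (multiplicity n (k₀ ⊕ e) * ways e (k₀ ⊕ e) * zᶠ k₀)
        ≡⟨ cong₂ _*_ (*-comm (suc m) (suc e)) (trans (*-assoc (multiplicity n (k₀ ⊕ e)) _ _)
             (cong (multiplicity n (k₀ ⊕ e) *_) (sym (zᶠ-⊕ k₀ e (<⇒≤ e<b))))) ⟩
      suc e * suc m * (multiplicity n (k₀ ⊕ e) * zᶠ (k₀ ⊕ e))
        ≡⟨ cong (suc e * suc m *_) (multiplicity-z n (k₀ ⊕ e) (<⇒≤ n<b) weight≡) ⟩
      suc e * suc m * n ! ∎
      where
      -- `k` with one cycle of length e + 1 removed, which exists as `k (suc e)` is `suc m`. So
      -- `k₀ ⊕ e` is the type before the lengthening, of weight n.
      k₀ : ℕ → ℕ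
      k₀ t = k t ∸ 𝟙 (t ≟ suc e)
      k≗ : Agree k (k₀ ⊕ suc e)
      k≗ {i} _ = restore (suc i ≟ suc e)
        where
        restore : (d : Dec (suc i ≡ suc e)) → k (suc i) ≡ 𝟙 d + (k (suc i) ∸ 𝟙 d)
        restore (yes refl) rewrite k≡ = refl
        restore (no _)     = refl
      weight≡ : weightᶠ (k₀ ⊕ e) ≡ n
      weight≡ = trans (weightᶠ-⊕ k₀ e (<⇒≤ e<b))
        (suc-injective (trans (sym (weightᶠ-⊕ k₀ (suc e) e<b)) (trans (sym (weightᶠ-cong k (k₀ ⊕ suc e) k≗)) wk)))
      summand : ∀ π → ways e (type π) * 𝟙 (agree? (type π ⊕ suc e) (k ⊕ e)) ≡ 𝟙 (agree? (type π) (k₀ ⊕ e)) * ways e (k₀ ⊕ e)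
      summand π = trans (*-comm (ways e (type π)) _) (trans
        (cong (_* ways e (type π)) (𝟙-⇔ to from (agree? (type π ⊕ suc e) (k ⊕ e)) (agree? (type π) (k₀ ⊕ e))))
        (𝟙*-cong (agree? (type π) (k₀ ⊕ e)) (ways-cong e (<⇒≤ e<b))))
        where
        shift : ∀ {i} → i < b → (k ⊕ e) (suc i) ≡ 𝟙 (suc i ≟ suc e) + (k₀ ⊕ e) (suc i)
        shift {i} i<b = trans (cong (𝟙 (suc i ≟ e) +_) (k≗ i<b))
          (+-x∙yz≈y∙xz (𝟙 (suc i ≟ e)) (𝟙 (suc i ≟ suc e)) (k₀ (suc i)))
        to : Agree (type π ⊕ suc e) (k ⊕ e) → Agree (type π) (k₀ ⊕ e)
        to ag {i} i<b = +-cancelˡ-≡ (𝟙 (suc i ≟ suc e)) _ _ (trans (ag i<b) (shift i<b))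
        from : Agree (type π) (k₀ ⊕ e) → Agree (type π ⊕ suc e) (k ⊕ e)
        from ag {i} i<b = trans (cong (𝟙 (suc i ≟ suc e) +_) (ag i<b)) (sym (shift i<b))

typeV : Perm n → Vec ℕ n
typeV π = Vec.tabulate (λ i → type π (suc (toℕ i)))

#-suc-toℕ : (v : Vec ℕ n) (i : Fin n) → v # suc (toℕ i) ≡ lookup v i
#-suc-toℕ (x ∷ v) zero    = refl
#-suc-toℕ (x ∷ v) (suc i) = #-suc-toℕ v i

#-≥ : (v : Vec ℕ n) → ∀ i → n ≤ i → v # suc i ≡ 0
#-≥ []      i       _         = refl
#-≥ (x ∷ v) (suc i) (s≤s n≤i) = #-≥ v i n≤i

typeV-# : (π : Perm n) → ∀ t → typeV π # t ≡ type π t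
typeV-# π zero = sym (type-zero π)
typeV-# {n} π (suc i) with i <? n
... | no i≮n  = trans (#-≥ (typeV π) i (≮⇒≥ i≮n)) (sym (type-> π (suc i) (s≤s (≮⇒≥ i≮n))))
... | yes i<n = begin
  typeV π # suc i                       ≡⟨ cong (λ k → typeV π # suc k) (Fin.toℕ-fromℕ< i<n) ⟨
  typeV π # suc (toℕ (fromℕ< i<n))  ≡⟨ #-suc-toℕ (typeV π) (fromℕ< i<n) ⟩
  lookup (typeV π) (fromℕ< i<n)     ≡⟨ Vec.lookup∘tabulate _ (fromℕ< i<n) ⟩
  type π (suc (toℕ (fromℕ< i<n)))   ≡⟨ cong (type π ∘ suc) (Fin.toℕ-fromℕ< i<n) ⟩
  type π (suc i)                        ∎

#-ext : {u v : Vec ℕ n} → (∀ {i} → i < n → u # suc i ≡ v # suc i) → u ≡ v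
#-ext {u = []}    {[]}    eq = refl
#-ext {u = x ∷ u} {y ∷ v} eq = cong₂ _∷_ (eq z<s) (#-ext (λ i<n → eq (s<s i<n)))

_≟ᵛ_ : DecidableEquality (Vec ℕ n)
_≟ᵛ_ = Vec.≡-dec _≟_

vectors-once : ∀ b l (v : Vec ℕ l) → (∀ i → v # i ≤ b) → ∑ (vectors b l) (λ u → 𝟙 (u ≟ᵛ v)) ≡ 1
vectors-once b zero    []      _ = refl
vectors-once b (suc l) (x ∷ v) v≤b = begin
  ∑ (vectors b (suc l)) (λ u → 𝟙 (u ≟ᵛ (x ∷ v)))
    ≡⟨ ∑-cartesianProductWith _∷_ (upTo (suc b)) (vectors b l) ⟩
  ∑ (upTo (suc b)) (λ y → ∑ (vectors b l) (λ u → 𝟙 ((y ∷ u) ≟ᵛ (x ∷ v))))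
    ≡⟨ ∑-cong (upTo (suc b)) (λ y → trans (∑-cong (vectors b l) (λ u → trans
         (𝟙-⇔ (λ { refl → refl , refl }) (λ { (refl , refl) → refl }) ((y ∷ u) ≟ᵛ (x ∷ v)) ((y ≟ x) ×-dec (u ≟ᵛ v)))
         (𝟙-× (y ≟ x) (u ≟ᵛ v)))) (∑-*ˡ (vectors b l) (𝟙 (y ≟ x)))) ⟩
  ∑ (upTo (suc b)) (λ y → 𝟙 (y ≟ x) * ∑ (vectors b l) (λ u → 𝟙 (u ≟ᵛ v)))
    ≡⟨ ∑-upTo-pick (suc b) x (s≤s (v≤b 1)) (λ _ → ∑ (vectors b l) (λ u → 𝟙 (u ≟ᵛ v))) ⟩
  ∑ (vectors b l) (λ u → 𝟙 (u ≟ᵛ v))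
    ≡⟨ vectors-once b l v (λ { zero → z≤n ; (suc i) → v≤b (suc (suc i)) }) ⟩
  1 ∎

weight-typeV : (π : Perm n) → weight (typeV π) ≡ n
weight-typeV {n} π = trans (sum-applyUpTo (λ i → suc i * typeV π # suc i) n)
  (trans (∑-cong (upTo n) (λ i → cong (suc i *_) (typeV-# π (suc i)))) (type-weight π n ≤-refl))

partitions-once : (π : Perm n) → ∑ (partitions n) (λ j → 𝟙 (j ≟ᵛ typeV π)) ≡ 1
partitions-once {n} π = begin
  ∑ (partitions n) (λ j → 𝟙 (j ≟ᵛ typeV π))
    ≡⟨ ∑-filter (λ j → weight j ≟ n) (vectors n n) ⟩
  ∑ (vectors n n) (λ j → 𝟙 (weight j ≟ n) * 𝟙 (j ≟ᵛ typeV π))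
    ≡⟨ ∑-cong (vectors n n) (λ j → trans (*-comm (𝟙 (weight j ≟ n)) _) (trans
         (𝟙*-cong (j ≟ᵛ typeV π) (λ { refl → 𝟙-yes (weight j ≟ n) (weight-typeV π) })) (*-identityʳ _))) ⟩
  ∑ (vectors n n) (λ j → 𝟙 (j ≟ᵛ typeV π))
    ≡⟨ vectors-once n n (typeV π) (λ i → subst (_≤ n) (sym (typeV-# π i)) (type≤n π i)) ⟩
  1 ∎

ofType : Vec ℕ n → ℕ
ofType {n} j = Multiplicity.multiplicity n n (j #_)

-- The classical number n!/z of permutations of given cycle type, kept free of division.
ofType-z : (j : Vec ℕ n) → weight j ≡ n → ofType j * z j ≡ n !
ofType-z {n} j wj = Multiplicity.multiplicity-z n n (j #_) ≤-refl
  (trans (sym (sum-applyUpTo (λ i → suc i * j # suc i) n)) wj)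

∑-by-type : ∀ n (f : Vec ℕ n → ℕ) → ∑ᶠ (finPerm n) (f ∘ typeV) ≡ ∑ (partitions n) (λ j → ofType j * f j)
∑-by-type n f = begin
  ∑ᶠ (finPerm n) (f ∘ typeV)
    ≡⟨ ∑-cong (elements (finPerm n)) (λ π → ∑-δ-list _≟ᵛ_ (partitions n) (typeV π) (partitions-once π) f) ⟨
  ∑ᶠ (finPerm n) (λ π → ∑ (partitions n) (λ j → 𝟙 (j ≟ᵛ typeV π) * f j))
    ≡⟨ ∑-swap (elements (finPerm n)) (partitions n) _ ⟩
  ∑ (partitions n) (λ j → ∑ᶠ (finPerm n) (λ π → 𝟙 (j ≟ᵛ typeV π) * f j))
    ≡⟨ ∑-cong (partitions n) (λ j → trans (∑-*ʳ (elements (finPerm n)) (f j)) (cong (_* f j)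
         (∑-cong (elements (finPerm n)) (λ π → 𝟙-⇔
           (λ { refl {i} _ → sym (typeV-# π (suc i)) })
           (λ ag → #-ext (λ {i} i<n → trans (sym (ag i<n)) (sym (typeV-# π (suc i)))))
           (j ≟ᵛ typeV π) (Multiplicity.agree? n (type π) (j #_)))))) ⟩
  ∑ (partitions n) (λ j → ofType j * f j) ∎

-- Products over the cycles of a permutation

product-upTo-* : ∀ b (f g : ℕ → ℕ) → product (applyUpTo (λ i → f i * g i) b) ≡ product (applyUpTo f b) * product (applyUpTo g b)
product-upTo-* zero    f g = refl
product-upTo-* (suc b) f g = trans (cong (f 0 * g 0 *_) (product-upTo-* b (f ∘ suc) (g ∘ suc))) (*-interchange (f 0) (g 0) _ _)

module _ (g : ℕ → ℕ) where

  -- Collects equal factors, so that products over unrelated index sets can be compared by their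
  -- exponents at each length.
  product-regroup : ∀ b (xs : List A) (t k : A → ℕ) → (∀ α → 0 < t α) → ∑ xs t ≤ b →
    product (map (λ α → g (t α) ^ k α) xs) ≡ product (applyUpTo (λ i → g (suc i) ^ ∑ xs (λ α → 𝟙 (t α ≟ suc i) * k α)) b)
  product-regroup b []       t k t>0 _  = sym (product-upTo-1 b)
  product-regroup b (α ∷ xs) t k t>0 le = begin
    g (t α) ^ k α * product (map (λ α → g (t α) ^ k α) xs)
      ≡⟨ cong₂ _*_ (single (t α) (t>0 α) (≤-trans (m≤m+n (t α) _) le)) (product-regroup b xs t k t>0 (≤-trans (m≤n+m _ (t α)) le)) ⟩
    product (applyUpTo (λ i → g (suc i) ^ (𝟙 (t α ≟ suc i) * k α)) b) *
      product (applyUpTo (λ i → g (suc i) ^ ∑ xs (λ α → 𝟙 (t α ≟ suc i) * k α)) b)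
      ≡⟨ product-upTo-* b _ _ ⟨
    product (applyUpTo (λ i → g (suc i) ^ (𝟙 (t α ≟ suc i) * k α) * g (suc i) ^ ∑ xs (λ α → 𝟙 (t α ≟ suc i) * k α)) b)
      ≡⟨ product-cong-< b (λ i _ → sym (^-distribˡ-+-* (g (suc i)) (𝟙 (t α ≟ suc i) * k α) _)) ⟩
    product (applyUpTo (λ i → g (suc i) ^ ∑ (α ∷ xs) (λ α → 𝟙 (t α ≟ suc i) * k α)) b) ∎
    where
    single : ∀ s → 0 < s → s ≤ b → g s ^ k α ≡ product (applyUpTo (λ i → g (suc i) ^ (𝟙 (s ≟ suc i) * k α)) b)
    single (suc s) _ s<b = sym (trans
      (product-change b s s<b {g = λ _ → 1} (g (suc s) ^ k α)
        (trans (cong (λ d → g (suc s) ^ (d * k α)) (𝟙-yes (suc s ≟ suc s) refl))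
          (trans (cong (g (suc s) ^_) (*-identityˡ (k α))) (sym (*-identityʳ _))))
        (λ m m≢s → cong (λ d → g (suc m) ^ (d * k α)) (𝟙-no (suc s ≟ suc m) (m≢s ∘ sym ∘ suc-injective))))
      (trans (cong (g (suc s) ^ k α *_) (product-upTo-1 b)) (*-identityʳ _)))

  -- CycleProduct μ V: V is the product of g t over the cycles, of length t, of a
  -- structure in which μ t points lie on cycles of length t.
  record CycleProduct (μ : ℕ → ℕ) (V : ℕ) : Set where
    constructor cycleProduct
    field
      cycles   : List (∃ λ t → 0 < t × ℕ)
      points   : ∀ s → μ s ≡ ∑ cycles (λ (t , _ , k) → 𝟙 (t ≟ s) * (t * k))
      value    : V ≡ product (map (λ (t , _ , k) → g t ^ k) cycles)

  open CycleProduct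

  cycles-single : ∀ t k → 0 < t → CycleProduct (λ s → 𝟙 (t ≟ s) * (t * k)) (g t ^ k)
  cycles-single t k t>0 = cycleProduct ((t , t>0 , k) ∷ []) (λ s → sym (+-identityʳ _)) (sym (*-identityʳ _))

  cycles-none : CycleProduct (λ _ → 0) 1
  cycles-none = cycleProduct [] (λ _ → refl) refl

  cycles-* : ∀ {μ ν V W} → CycleProduct μ V → CycleProduct ν W → CycleProduct (λ s → μ s + ν s) (V * W)
  cycles-* c d = cycleProduct (cycles c ++ cycles d)
    (λ s → trans (cong₂ _+_ (points c s) (points d s)) (sym (∑-++ (cycles c) (cycles d))))
    (trans (cong₂ _*_ (value c) (value d)) (trans (sym (product-++ (map _ (cycles c)) _)) (cong product (sym (List.map-++ _ (cycles c) (cycles d))))))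

  cycles-cong : ∀ {μ ν V} → (∀ s → μ s ≡ ν s) → CycleProduct μ V → CycleProduct ν V
  cycles-cong eq c = cycleProduct (cycles c) (λ s → trans (sym (eq s)) (points c s)) (value c)

  cycles-^ : ∀ e {μ V} → CycleProduct μ V → CycleProduct (λ s → e * μ s) (V ^ e)
  cycles-^ zero    c = cycles-none
  cycles-^ (suc e) c = cycles-* c (cycles-^ e c)

  cycles-∏ : ∀ m {μ : ℕ → ℕ → ℕ} {V : ℕ → ℕ} → (∀ i → CycleProduct (μ i) (V i)) →
    CycleProduct (λ s → ∑ (upTo m) (λ i → μ i s)) (product (applyUpTo V m))
  cycles-∏ zero        c = cycles-none
  cycles-∏ (suc m) {μ} c = cycles-cong (λ s → sym (∑-upTo-suc m (λ i → μ i s))) (cycles-* (c 0) (cycles-∏ m (c ∘ suc)))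

  -- The points on cycles of length s number s times those cycles, so counting points determines the
  -- exponent of `g s`. A description of the point counts therefore suffices; its cycles need not be
  -- matched with those of `π`.
  product-over-cycles : (π : Perm n) → ∀ {μ V} → (∀ s → ∑ (allFin n) (λ v → 𝟙 (ℓ π v ≟ s)) ≡ μ s) → CycleProduct μ V →
    product (List.tabulate (g ∘ len π)) ≡ V
  product-over-cycles {n} π {μ} {V} points′ (cycleProduct cs points value) = begin
    product (List.tabulate (g ∘ len π))
      ≡⟨ cong product (List.map-tabulate id (g ∘ len π)) ⟨
    product (map (g ∘ len π) (allFin (ncyc π)))
      ≡⟨ cong product (List.map-cong (λ c → sym (^-identityʳ (g (len π c)))) (allFin (ncyc π))) ⟩
    product (map (λ c → g (len π c) ^ 1) (allFin (ncyc π)))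
      ≡⟨ product-regroup b (allFin (ncyc π)) (len π) (λ _ → 1) (len>0 π) (subst (_≤ b) (sym ∑len≡n) (m≤m+n n _)) ⟩
    product (applyUpTo (λ i → g (suc i) ^ ∑ (allFin (ncyc π)) (λ c → 𝟙 (len π c ≟ suc i) * 1)) b)
      ≡⟨ product-cong-< b (λ i _ → cong (g (suc i) ^_) (exponent i)) ⟩
    product (applyUpTo (λ i → g (suc i) ^ ∑ cs (λ (t , _ , k) → 𝟙 (t ≟ suc i) * k)) b)
      ≡⟨ product-regroup b cs proj₁ (proj₂ ∘ proj₂) (proj₁ ∘ proj₂) (m≤n+m _ n) ⟨
    product (map (λ (t , _ , k) → g t ^ k) cs)
      ≡⟨ value ⟨
    V ∎
    where
    -- Both uses of `product-regroup` need a bound for the sum of all lengths: it is `n` for the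
    -- cycles of `π` and `∑ cs proj₁` for the described ones.
    b : ℕ
    b = n + ∑ cs proj₁
    ∑len≡n : ∑ (allFin (ncyc π)) (len π) ≡ n
    ∑len≡n = trans (∑-cong (allFin (ncyc π)) (λ c → sym (*-identityʳ (len π c))))
      (trans (sym (∑-by-class π (λ _ → 1))) (trans (∑-1 (allFin n)) (length-allFin n)))
    exponent : ∀ i → ∑ (allFin (ncyc π)) (λ c → 𝟙 (len π c ≟ suc i) * 1) ≡ ∑ cs (λ (t , _ , k) → 𝟙 (t ≟ suc i) * k)
    exponent i = *-cancelˡ-≡ _ _ (suc i) (begin
      suc i * ∑ (allFin (ncyc π)) (λ c → 𝟙 (len π c ≟ suc i) * 1)
        ≡⟨ ∑-*ˡ (allFin (ncyc π)) (suc i) ⟨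
      ∑ (allFin (ncyc π)) (λ c → suc i * (𝟙 (len π c ≟ suc i) * 1))
        ≡⟨ ∑-cong (allFin (ncyc π)) (λ c → trans (cong (suc i *_) (*-identityʳ (𝟙 (len π c ≟ suc i))))
             (trans (*-comm (suc i) (𝟙 (len π c ≟ suc i)))
               (trans (𝟙*-cong (len π c ≟ suc i) sym) (*-comm (𝟙 (len π c ≟ suc i)) (len π c))))) ⟩
      ∑ (allFin (ncyc π)) (λ c → len π c * 𝟙 (len π c ≟ suc i))
        ≡⟨ ∑-by-class π (λ c → 𝟙 (len π c ≟ suc i)) ⟨
      ∑ (allFin n) (λ v → 𝟙 (ℓ π v ≟ suc i))
        ≡⟨ trans (points′ (suc i)) (points (suc i)) ⟩
      ∑ cs (λ (t , _ , k) → 𝟙 (t ≟ suc i) * (t * k))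
        ≡⟨ ∑-cong cs (λ (t , _ , k) → trans (𝟙*-cong (t ≟ suc i) (cong (_* k))) (*-x∙yz≈y∙xz (𝟙 (t ≟ suc i)) (suc i) k)) ⟩
      ∑ cs (λ (t , _ , k) → suc i * (𝟙 (t ≟ suc i) * k))
        ≡⟨ ∑-*ˡ cs (suc i) ⟩
      suc i * ∑ cs (λ (t , _ , k) → 𝟙 (t ≟ suc i) * k) ∎)

-- zero ∷ h is h extended by a fixed point, the zero of the semigroup.
fix≡C : (h : Perm n) → ∀ t → 0 < t → fix (finFin (suc n)) (act (zero ∷ h)) t ≡ C (typeV h) t
fix≡C {n} h t t>0 = begin
  ∑ (allFin (suc n)) (λ v → 𝟙 (iter (act (zero ∷ h)) t v Fin.≟ v))
    ≡⟨ ∑-allFin-suc n (λ v → 𝟙 (iter (act (zero ∷ h)) t v Fin.≟ v)) ⟩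
  𝟙 (iter (act (zero ∷ h)) t zero Fin.≟ zero) + ∑ (allFin n) (λ v → 𝟙 (iter (act (zero ∷ h)) t (suc v) Fin.≟ suc v))
    ≡⟨ cong₂ _+_ (𝟙-yes (iter (act (zero ∷ h)) t zero Fin.≟ zero) (iter-zero t)) (∑-cong (allFin n) (λ v → 𝟙-⇔
         (λ eq → fixed⇒ℓ∣ h v t (Fin.suc-injective (trans (sym (iter-suc t v)) eq)))
         (λ ℓ∣t → trans (iter-suc t v) (cong suc (ℓ∣⇒fixed h v t ℓ∣t)))
         (iter (act (zero ∷ h)) t (suc v) Fin.≟ suc v) (ℓ h v ∣? t))) ⟩
  1 + ∑ (allFin n) (λ v → 𝟙 (ℓ h v ∣? t))
    -- The bound `n + t` is at least `n`, as `∑-ℓ` demands, and at least `t`, so that the sum can be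
    -- cut down to the divisors of `t`.
    ≡⟨ cong (1 +_) (∑-ℓ h (n + t) (m≤m+n n t) (λ d → 𝟙 (d ∣? t))) ⟩
  1 + ∑ (upTo (n + t)) (λ i → type h (suc i) * (suc i * 𝟙 (suc i ∣? t)))
    ≡⟨ cong (1 +_) (∑-cong (upTo (n + t)) (λ i → trans (rearrange (type h (suc i)) (suc i) (𝟙 (suc i ∣? t)))
         (cong (λ k → 𝟙 (suc i ∣? t) * (suc i * k)) (sym (typeV-# h (suc i)))))) ⟩
  1 + ∑ (upTo (n + t)) (λ i → 𝟙 (suc i ∣? t) * (suc i * typeV h # suc i))
    ≡⟨ cong (1 +_) (∑-upTo-extend t (n + t) (λ i t≤i → cong (_* (suc i * typeV h # suc i))
         (𝟙-no (suc i ∣? t) (λ i∣t → <⇒≱ (s≤s t≤i) (∣⇒≤ {{>-nonZero t>0}} i∣t)))) (m≤n+m t n)) ⟩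
  1 + ∑ (upTo t) (λ i → 𝟙 (suc i ∣? t) * (suc i * typeV h # suc i))
    ≡⟨ cong (1 +_) (trans (sym (∑-map suc (upTo t))) (cong (λ l → ∑ l (λ d → 𝟙 (d ∣? t) * (d * typeV h # d))) (List.map-upTo suc t))) ⟩
  1 + ∑ (range 1 t) (λ d → 𝟙 (d ∣? t) * (d * typeV h # d))
    ≡⟨ cong (1 +_) (∑-filter (_∣? t) (range 1 t)) ⟨
  C (typeV h) t ∎
  where
  iter-zero : ∀ s → iter (act (zero ∷ h)) s zero ≡ zero
  iter-zero zero    = refl
  iter-zero (suc s) = cong (act (zero ∷ h)) (iter-zero s)
  iter-suc : ∀ s v → iter (act (zero ∷ h)) s (suc v) ≡ suc (iter (act h) s v)
  iter-suc zero    v = refl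
  iter-suc (suc s) v = cong (act (zero ∷ h)) (iter-suc s v)
  rearrange : ∀ a b c → a * (b * c) ≡ c * (b * a)
  rearrange a b c = trans (cong (a *_) (*-comm b c)) (trans (*-x∙yz≈y∙xz a c b) (cong (c *_) (*-comm a b)))

-- Cycles on pairs

ℓ-unique : (π : Perm n) → ∀ v t → (∀ s → iter (act π) s v ≡ v → t ∣ s) → (∀ s → t ∣ s → iter (act π) s v ≡ v) → ℓ π v ≡ t
ℓ-unique π v t only fixes = ∣-antisym (fixed⇒ℓ∣ π v t (fixes t ∣-refl)) (only (ℓ π v) (ℓ∣⇒fixed π v (ℓ π v) ∣-refl))

lcm>0 : ∀ m n → 0 < m → 0 < n → 0 < lcm m n
lcm>0 m n m>0 n>0 = >-nonZero⁻¹ (lcm m n) {{lcm≢0 m n {{>-nonZero m>0}} {{>-nonZero n>0}}}}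

module _ {x : ℕ} (g : Perm x) where

  private
    infixr 5 _▸_
    _▸_ : ℕ → Fin x → Fin x
    s ▸ v = iter (act g) s v

  -- The flag says whether the factors of X × X are swapped. Pairs are numbered by `combine` so that
  -- the result is again a code and the theory of its cycles applies.
  pairPerm : Bool → Perm (x * x)
  pairMap  : Bool → Fin x × Fin x → Fin x × Fin x

  pairMap false (a , b) = act g a , act g b
  pairMap true  (a , b) = act g b , act g a

  pairMapᶠ : Bool → Fin (x * x) → Fin (x * x)
  pairMapᶠ ε v = let a , b = pairMap ε (remQuot x v) in combine a b

  pairPerm ε = encode (pairMapᶠ ε)

  pairMap-injective : ∀ ε → Injective _≡_ _≡_ (pairMap ε)
  pairMap-injective false eq = cong₂ _,_ (act-injective g (cong proj₁ eq)) (act-injective g (cong proj₂ eq))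
  pairMap-injective true  eq = cong₂ _,_ (act-injective g (cong proj₂ eq)) (act-injective g (cong proj₁ eq))

  act-pairPerm : ∀ ε a b → act (pairPerm ε) (combine a b) ≡
    (let a′ , b′ = pairMap ε (a , b) in combine a′ b′)
  act-pairPerm ε a b = trans (act-encode (pairMapᶠ ε) injective (combine a b))
    (cong (λ ab → let a′ , b′ = pairMap ε ab in combine a′ b′) (Fin.remQuot-combine a b))
    where
    injective : Injective _≡_ _≡_ (pairMapᶠ ε)
    injective {u} {v} eq = trans (sym (Fin.combine-remQuot {x} x u)) (trans
      (cong (λ ab → combine (proj₁ ab) (proj₂ ab)) (pairMap-injective ε
        (let eq₁ , eq₂ = Fin.combine-injective _ _ _ _ eq in cong₂ _,_ eq₁ eq₂)))
      (Fin.combine-remQuot {x} x v))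

  ∑-pairs : (f : Fin (x * x) → ℕ) → ∑ (allFin (x * x)) f ≡ ∑ (allFin x) (λ a → ∑ (allFin x) (λ b → f (combine a b)))
  ∑-pairs f = trans
    (sym (∑-reindex (fin× (finFin x) (finFin x)) (finFin (x * x)) (λ (a , b) → combine a b) (remQuot x)
      (λ (a , b) → Fin.remQuot-combine a b) (Fin.combine-remQuot {x} x) f))
    (∑-fin× (finFin x) (finFin x) (λ (a , b) → f (combine a b)))

  iter-straight : ∀ s a b → iter (act (pairPerm false)) s (combine a b) ≡ combine (s ▸ a) (s ▸ b)
  iter-straight zero    a b = refl
  iter-straight (suc s) a b = trans (cong (act (pairPerm false)) (iter-straight s a b)) (act-pairPerm false _ _)

  ℓ-straight : ∀ a b → ℓ (pairPerm false) (combine a b) ≡ lcm (ℓ g a) (ℓ g b)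
  ℓ-straight a b = ℓ-unique (pairPerm false) (combine a b) (lcm (ℓ g a) (ℓ g b))
    (λ s eq → let eqa , eqb = Fin.combine-injective _ _ _ _ (trans (sym (iter-straight s a b)) eq)
              in lcm-least (fixed⇒ℓ∣ g a s eqa) (fixed⇒ℓ∣ g b s eqb))
    (λ s l∣s → trans (iter-straight s a b) (cong₂ combine
      (ℓ∣⇒fixed g a s (∣-trans (m∣lcm[m,n] (ℓ g a) (ℓ g b)) l∣s))
      (ℓ∣⇒fixed g b s (∣-trans (n∣lcm[m,n] (ℓ g a) (ℓ g b)) l∣s))))

  -- Two swaps cancel, so even iterates move both entries by the same power of `g`. From here on
  -- even and odd iterates are treated separately.
  iter-twisted-even : ∀ s a b → iter (act (pairPerm true)) (s * 2) (combine a b) ≡ combine (s * 2 ▸ a) (s * 2 ▸ b)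
  iter-twisted-even zero    a b = refl
  iter-twisted-even (suc s) a b = trans (cong (act (pairPerm true) ∘ act (pairPerm true)) (iter-twisted-even s a b))
    (trans (cong (act (pairPerm true)) (act-pairPerm true _ _)) (act-pairPerm true _ _))

  iter-twisted-odd : ∀ s a b → iter (act (pairPerm true)) (suc (s * 2)) (combine a b) ≡ combine (suc (s * 2) ▸ b) (suc (s * 2) ▸ a)
  iter-twisted-odd s a b = trans (cong (act (pairPerm true)) (iter-twisted-even s a b)) (act-pairPerm true _ _)

data EvenOrOdd : ℕ → Set where
  even : ∀ q → EvenOrOdd (q * 2)
  odd  : ∀ q → EvenOrOdd (suc (q * 2))

evenOrOdd : ∀ s → EvenOrOdd s
evenOrOdd zero    = even 0
evenOrOdd (suc s) with evenOrOdd s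
... | even q = odd q
... | odd q  = even (suc q)

2∤odd : ∀ q → ¬ 2 ∣ suc (q * 2)
2∤odd q (divides r eq) = even≢odd r q (trans (*-comm 2 r) (trans (sym eq) (cong suc (*-comm q 2))))

module _ {x : ℕ} (g : Perm x) where

  private
    infixr 5 _▸_
    _▸_ : ℕ → Fin x → Fin x
    s ▸ v = iter (act g) s v

    twisted = act (pairPerm g true)

    even-fixed⇒ : ∀ q a b → iter twisted (q * 2) (combine a b) ≡ combine a b → q * 2 ▸ a ≡ a × q * 2 ▸ b ≡ b
    even-fixed⇒ q a b eq = Fin.combine-injective _ _ _ _ (trans (sym (iter-twisted-even g q a b)) eq)

    odd-fixed⇒ : ∀ q a b → iter twisted (suc (q * 2)) (combine a b) ≡ combine a b →
                 suc (q * 2) ▸ b ≡ a × suc (q * 2) ▸ a ≡ b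
    odd-fixed⇒ q a b eq = Fin.combine-injective _ _ _ _ (trans (sym (iter-twisted-odd g q a b)) eq)

    even-fixed : ∀ a b s → 2 ∣ s → ℓ g a ∣ s → ℓ g b ∣ s → iter twisted s (combine a b) ≡ combine a b
    even-fixed a b _ (divides q refl) a∣ b∣ = trans (iter-twisted-even g q a b)
      (cong₂ combine (ℓ∣⇒fixed g a (q * 2) a∣) (ℓ∣⇒fixed g b (q * 2) b∣))

  -- If no odd iterate returns to (a, b), the returning iterates are the even ones that fix both
  -- entries, hence the even common multiples of the two cycle lengths.
  ℓ-twisted : ∀ a b → (∀ q → suc (q * 2) ▸ b ≡ a → suc (q * 2) ▸ a ≢ b) →
              ℓ (pairPerm g true) (combine a b) ≡ lcm 2 (lcm (ℓ g a) (ℓ g b))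
  ℓ-twisted a b not-odd = ℓ-unique (pairPerm g true) (combine a b) _ only λ s l∣s →
    even-fixed a b s (∣-trans (m∣lcm[m,n] 2 l) l∣s)
      (∣-trans (m∣lcm[m,n] (ℓ g a) (ℓ g b)) (∣-trans (n∣lcm[m,n] 2 l) l∣s))
      (∣-trans (n∣lcm[m,n] (ℓ g a) (ℓ g b)) (∣-trans (n∣lcm[m,n] 2 l) l∣s))
    where
    l : ℕ
    l = lcm (ℓ g a) (ℓ g b)
    only : ∀ s → iter twisted s (combine a b) ≡ combine a b → lcm 2 l ∣ s
    only s eq with evenOrOdd s
    ... | even q = let eqa , eqb = even-fixed⇒ q a b eq in
      lcm-least (divides q refl) (lcm-least (fixed⇒ℓ∣ g a (q * 2) eqa) (fixed⇒ℓ∣ g b (q * 2) eqb))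
    ... | odd q = let eqa , eqb = odd-fixed⇒ q a b eq in
      contradiction eqb (not-odd q eqa)

  -- An odd return would carry `b` to `a` along a cycle of `g`.
  ℓ-twisted-≁ : ∀ a b → cl g b ≢ cl g a → ℓ (pairPerm g true) (combine a b) ≡ lcm 2 (lcm (ℓ g a) (ℓ g b))
  ℓ-twisted-≁ a b b≁a = ℓ-twisted a b (λ q eq _ → b≁a (trans (sym (cl-iter g (suc (q * 2)) b)) (cong (cl g) eq)))

  private
    ℓ-iter : ∀ d a → ℓ g (d ▸ a) ≡ ℓ g a
    ℓ-iter d a = cong (len g) (cl-iter g d a)

    -- The two equations say that an odd iterate `s` returns to (a, g^d a). Eliminating `s` leaves
    -- g^(2d) a = a, so within one cycle only d = 0 and d = ℓ/2 can have odd returns.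
    odd-period : ∀ d a s → s ▸ d ▸ a ≡ a → s ▸ a ≡ d ▸ a → ℓ g a ∣ s + d × ℓ g a ∣ d + d
    odd-period d a s eq₁ eq₂ =
      fixed⇒ℓ∣ g a (s + d) (trans (iter-+ (act g) s d a) eq₁) ,
      fixed⇒ℓ∣ g a (d + d) (trans (iter-+ (act g) d d a)
        (trans (cong (d ▸_) (sym eq₂)) (trans (iter-comm (act g) d s a) eq₁)))

    lcm-self : ∀ l → lcm l l ≡ l
    lcm-self l = ∣-antisym (lcm-least ∣-refl ∣-refl) (m∣lcm[m,n] l l)

  ℓ-twisted-diagonal : ∀ a → ℓ (pairPerm g true) (combine a a) ≡ ℓ g a
  ℓ-twisted-diagonal a = ℓ-unique (pairPerm g true) (combine a a) _ only fixes
    where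
    only : ∀ s → iter twisted s (combine a a) ≡ combine a a → ℓ g a ∣ s
    only s eq with evenOrOdd s
    ... | even q = fixed⇒ℓ∣ g a (q * 2) (proj₁ (even-fixed⇒ q a a eq))
    ... | odd q  = fixed⇒ℓ∣ g a (suc (q * 2)) (proj₁ (odd-fixed⇒ q a a eq))
    fixes : ∀ s → ℓ g a ∣ s → iter twisted s (combine a a) ≡ combine a a
    fixes s ℓ∣s with evenOrOdd s
    ... | even q = let eq = ℓ∣⇒fixed g a (q * 2) ℓ∣s in trans (iter-twisted-even g q a a) (cong₂ combine eq eq)
    ... | odd q  = let eq = ℓ∣⇒fixed g a (suc (q * 2)) ℓ∣s in trans (iter-twisted-odd g q a a) (cong₂ combine eq eq)

  ℓ-twisted-generic : ∀ d a → ¬ ℓ g a ∣ d + d → ℓ (pairPerm g true) (combine a (d ▸ a)) ≡ lcm 2 (ℓ g a)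
  ℓ-twisted-generic d a ∤ = trans
    (ℓ-twisted a (d ▸ a) (λ q eq₁ eq₂ → ∤ (proj₂ (odd-period d a (suc (q * 2)) eq₁ eq₂))))
    (cong (lcm 2) (trans (cong (lcm (ℓ g a)) (ℓ-iter d a)) (lcm-self (ℓ g a))))

  -- Here d = ℓ/2 is even. An odd return `s` would make ℓ divide s + d, and with ℓ and d even so
  -- would be s.
  ℓ-twisted-half-even : ∀ q a → ℓ g a ≡ q * 2 + q * 2 → ℓ (pairPerm g true) (combine a (q * 2 ▸ a)) ≡ ℓ g a
  ℓ-twisted-half-even q a ℓ≡ = trans
    (ℓ-twisted a (q * 2 ▸ a) (λ r eq₁ eq₂ → 2∤odd r (∣m+n∣m⇒∣n
      (subst (2 ∣_) (+-comm (suc (r * 2)) (q * 2))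
        (∣-trans 2∣ℓ (proj₁ (odd-period (q * 2) a (suc (r * 2)) eq₁ eq₂)))) (divides q refl))))
    (trans (cong (lcm 2) (trans (cong (lcm (ℓ g a)) (ℓ-iter (q * 2) a)) (lcm-self (ℓ g a))))
      (∣-antisym (lcm-least 2∣ℓ ∣-refl) (n∣lcm[m,n] 2 (ℓ g a))))
    where
    2∣ℓ : 2 ∣ ℓ g a
    2∣ℓ = subst (2 ∣_) (sym ℓ≡) (∣m∣n⇒∣m+n (divides q refl) (divides q refl))

  -- After d steps with d odd, (a, g^d a) has become (g^d g^d a, g^d a), and ℓ = 2d makes this the
  -- same pair: the cycle closes at half the length. This is the origin of C_{a/2} in q_a.
  ℓ-twisted-half-odd : ∀ q a → let d = suc (q * 2) in ℓ g a ≡ d + d → ℓ (pairPerm g true) (combine a (d ▸ a)) ≡ d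
  ℓ-twisted-half-odd q a ℓ≡ = ℓ-unique (pairPerm g true) (combine a (d ▸ a)) d only fixes
    where
    d : ℕ
    d = suc (q * 2)
    d∣ℓ : d ∣ ℓ g a
    d∣ℓ = subst (d ∣_) (sym ℓ≡) (∣m∣n⇒∣m+n ∣-refl ∣-refl)
    ℓ≡2d : ℓ g a ≡ 2 * d
    ℓ≡2d = trans ℓ≡ (cong (d +_) (sym (+-identityʳ d)))
    only : ∀ s → iter twisted s (combine a (d ▸ a)) ≡ combine a (d ▸ a) → d ∣ s
    only s eq with evenOrOdd s
    ... | even r = ∣-trans d∣ℓ (fixed⇒ℓ∣ g a (r * 2) (proj₁ (even-fixed⇒ r a (d ▸ a) eq)))
    ... | odd r  = let eq₁ , eq₂ = odd-fixed⇒ r a (d ▸ a) eq in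
      ∣m+n∣m⇒∣n (subst (d ∣_) (+-comm (suc (r * 2)) d) (∣-trans d∣ℓ (proj₁ (odd-period d a (suc (r * 2)) eq₁ eq₂)))) ∣-refl
    even-multiple : ∀ s → d ∣ s → 2 ∣ s → ℓ g a ∣ s
    even-multiple _ (divides r refl) 2∣rd with evenOrOdd r
    ... | even p = divides p (trans (*-assoc p 2 d) (cong (p *_) (sym ℓ≡2d)))
    ... | odd p  = contradiction (∣m+n∣m⇒∣n (subst (2 ∣_) (+-comm d (p * 2 * d)) 2∣rd) (∣-trans (divides p refl) (m∣m*n d))) (2∤odd q)
    fixes : ∀ s → d ∣ s → iter twisted s (combine a (d ▸ a)) ≡ combine a (d ▸ a)
    fixes s d∣s with evenOrOdd s
    ... | even r = even-fixed a (d ▸ a) (r * 2) (divides r refl) ℓ∣s (subst (_∣ r * 2) (sym (ℓ-iter d a)) ℓ∣s)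
      where
      ℓ∣s : ℓ g a ∣ r * 2
      ℓ∣s = even-multiple (r * 2) d∣s (divides r refl)
    ... | odd r  = trans (iter-twisted-odd g r a (d ▸ a)) (cong₂ combine s▸d▸a≡a
        (trans (cong (s′ ▸_) (sym (ℓ∣⇒fixed g a (d + d) (subst (_∣ d + d) (sym ℓ≡) ∣-refl)))) (trans (cong (s′ ▸_) (iter-+ (act g) d d a))
          (trans (iter-comm (act g) s′ d (d ▸ a)) (cong (d ▸_) s▸d▸a≡a)))))
      where
      s′ : ℕ
      s′ = suc (r * 2)
      s▸d▸a≡a : s′ ▸ d ▸ a ≡ a
      s▸d▸a≡a = trans (sym (iter-+ (act g) s′ d a)) (ℓ∣⇒fixed g a (s′ + d)
        (even-multiple (s′ + d) (∣m∣n⇒∣m+n d∣s ∣-refl) (divides (suc (r + q)) (cong suc (trans (+-suc (r * 2) (q * 2)) (cong suc (sym (*-distribʳ-+ 2 r q))))))))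

∑-upTo-except : ∀ m (τ : ℕ → ℕ) d₀ u v → d₀ < m → τ d₀ ≡ u → (∀ d → d < m → d ≢ d₀ → τ d ≡ v) →
  ∀ s → ∑ (upTo m) (λ d → 𝟙 (τ d ≟ s)) ≡ 𝟙 (u ≟ s) + (m ∸ 1) * 𝟙 (v ≟ s)
∑-upTo-except (suc m) τ d₀ u v d₀<m at off s = +-cancelʳ-≡ (𝟙 (v ≟ s)) _ _ (begin
  ∑ (upTo (suc m)) (λ d → 𝟙 (τ d ≟ s)) + 𝟙 (v ≟ s)
    ≡⟨ cong (∑ (upTo (suc m)) (λ d → 𝟙 (τ d ≟ s)) +_) (∑-upTo-pick (suc m) d₀ d₀<m (λ _ → 𝟙 (v ≟ s))) ⟨
  ∑ (upTo (suc m)) (λ d → 𝟙 (τ d ≟ s)) + ∑ (upTo (suc m)) (λ d → 𝟙 (d ≟ d₀) * 𝟙 (v ≟ s))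
    ≡⟨ ∑-+ {f = λ d → 𝟙 (τ d ≟ s)} {g = λ d → 𝟙 (d ≟ d₀) * 𝟙 (v ≟ s)} (upTo (suc m)) ⟨
  ∑ (upTo (suc m)) (λ d → 𝟙 (τ d ≟ s) + 𝟙 (d ≟ d₀) * 𝟙 (v ≟ s))
    ≡⟨ ∑-upTo-cong (suc m) exchange ⟩
  ∑ (upTo (suc m)) (λ d → 𝟙 (d ≟ d₀) * 𝟙 (u ≟ s) + 𝟙 (v ≟ s))
    ≡⟨ ∑-+ {f = λ d → 𝟙 (d ≟ d₀) * 𝟙 (u ≟ s)} {g = λ _ → 𝟙 (v ≟ s)} (upTo (suc m)) ⟩
  ∑ (upTo (suc m)) (λ d → 𝟙 (d ≟ d₀) * 𝟙 (u ≟ s)) + ∑ (upTo (suc m)) (λ _ → 𝟙 (v ≟ s))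
    ≡⟨ cong₂ _+_ (∑-upTo-pick (suc m) d₀ d₀<m (λ _ → 𝟙 (u ≟ s)))
         (trans (∑-const (upTo (suc m)) (𝟙 (v ≟ s))) (cong (_* 𝟙 (v ≟ s)) (List.length-upTo (suc m)))) ⟩
  𝟙 (u ≟ s) + (𝟙 (v ≟ s) + m * 𝟙 (v ≟ s))
    ≡⟨ cong (𝟙 (u ≟ s) +_) (+-comm (𝟙 (v ≟ s)) _) ⟩
  𝟙 (u ≟ s) + (m * 𝟙 (v ≟ s) + 𝟙 (v ≟ s))
    ≡⟨ +-assoc (𝟙 (u ≟ s)) _ _ ⟨
  𝟙 (u ≟ s) + m * 𝟙 (v ≟ s) + 𝟙 (v ≟ s) ∎)
  where
  exchange : ∀ d → d < suc m → 𝟙 (τ d ≟ s) + 𝟙 (d ≟ d₀) * 𝟙 (v ≟ s) ≡ 𝟙 (d ≟ d₀) * 𝟙 (u ≟ s) + 𝟙 (v ≟ s)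
  exchange d d<m = by-cases (d ≟ d₀)
    where
    by-cases : (e : Dec (d ≡ d₀)) → 𝟙 (τ d ≟ s) + 𝟙 e * 𝟙 (v ≟ s) ≡ 𝟙 e * 𝟙 (u ≟ s) + 𝟙 (v ≟ s)
    by-cases (yes refl) = cong₂ _+_ (trans (cong (λ t → 𝟙 (t ≟ s)) at) (sym (*-identityˡ _))) (*-identityˡ _)
    by-cases (no d≢d₀)  = trans (+-identityʳ _) (cong (λ t → 𝟙 (t ≟ s)) (off d d<m d≢d₀))

if-yes : {P : Set} (p? : Dec P) {a b : A} → P → (if does p? then a else b) ≡ a
if-yes (yes _) p = refl
if-yes (no ¬p) p = contradiction p ¬p

if-no : {P : Set} (p? : Dec P) {a b : A} → ¬ P → (if does p? then a else b) ≡ b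
if-no (yes p) ¬p = contradiction p ¬p
if-no (no _)  ¬p = refl

-- The length of the cycle of (a , act g ^ d a) under the twisted action, where
-- a lies on a cycle of g of length l.
twistedLength : ℕ → ℕ → ℕ
twistedLength l zero      = l
twistedLength l d@(suc _) =
  if does (l ∣? (d + d)) then (if does (2 ∣? d) then l else d) else lcm 2 l

-- 0 < 2d < 2l leaves l as the only multiple of l that 2d can be.
∣double⇒≡ : ∀ l d → 0 < d → d < l → l ∣ d + d → l ≡ d + d
∣double⇒≡ l d d>0 d<l (divides zero eq)          = contradiction (m+n≡0⇒m≡0 d eq) (>⇒≢ d>0)
∣double⇒≡ l d d>0 d<l (divides (suc zero) eq)    = sym (trans eq (+-identityʳ l))
∣double⇒≡ l d d>0 d<l (divides (suc (suc q)) eq) = contradiction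
  (≤-trans (+-monoʳ-≤ l (m≤m+n l (q * l))) (≤-reflexive (sym eq))) (<⇒≱ (+-mono-< d<l d<l))

ℓ-twisted-∼ : ∀ {x} (g : Perm x) a d → d < ℓ g a →
  ℓ (pairPerm g true) (combine a (iter (act g) d a)) ≡ twistedLength (ℓ g a) d
ℓ-twisted-∼ g a zero      d<ℓ = ℓ-twisted-diagonal g a
ℓ-twisted-∼ g a d@(suc e) d<ℓ with ℓ g a ∣? (d + d)
... | no ∤    = ℓ-twisted-generic g d a ∤
... | yes ℓ∣   = half d (∣double⇒≡ (ℓ g a) d z<s d<ℓ ℓ∣)
  where
  half : ∀ d → ℓ g a ≡ d + d →
    ℓ (pairPerm g true) (combine a (iter (act g) d a)) ≡ (if does (2 ∣? d) then ℓ g a else d)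
  half d ℓ≡ with evenOrOdd d
  ... | even q = trans (ℓ-twisted-half-even g q a ℓ≡) (sym (if-yes (2 ∣? (q * 2)) (divides q refl)))
  ... | odd q  = trans (ℓ-twisted-half-odd g q a ℓ≡) (sym (if-no (2 ∣? suc (q * 2)) (2∤odd q)))

-- For `a` on a cycle of length `l`, the number of `b` on that cycle for which (a, b) has a twisted
-- cycle of length `s`; it is the same for each of the `l` choices of `a`.
twistedCount : ℕ → ℕ → ℕ
twistedCount l s = ∑ (upTo l) (λ d → 𝟙 (twistedLength l d ≟ s))

twistedLength-≢half : ∀ l d → 0 < d → d < l → l ≢ d + d → twistedLength l d ≡ lcm 2 l
twistedLength-≢half l d@(suc e) d>0 d<l l≢ = if-no (l ∣? (d + d)) (l≢ ∘ ∣double⇒≡ l d d>0 d<l)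

lcm-2-even : ∀ l → 2 ∣ l → lcm 2 l ≡ l
lcm-2-even l 2∣l = ∣-antisym (lcm-least 2∣l ∣-refl) (n∣lcm[m,n] 2 l)

lcm-2-odd : ∀ m → lcm 2 (suc (m * 2)) ≡ 2 * suc (m * 2)
lcm-2-odd m = ∣-antisym (lcm-least {2} {l} {2 * l} (m∣m*n {2} l) (n∣m*n 2 {l})) 2l∣
  where
  l : ℕ
  l = suc (m * 2)
  2l∣ : 2 * l ∣ lcm 2 l
  2l∣ with n∣lcm[m,n] 2 l
  ... | divides q eq with evenOrOdd q
  ...   | even p = divides p (trans eq (*-assoc p 2 l))
  ...   | odd p  = contradiction (∣m+n∣m⇒∣n
      (subst (2 ∣_) (trans eq (+-comm l (p * 2 * l))) (m∣lcm[m,n] 2 l)) (∣-trans (divides p refl) (m∣m*n l))) (2∤odd m)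

module _ (j : Vec ℕ n) where

  -- d = 0 gives l points, on one cycle of length l. The other l - 1 = 2m values of d have length
  -- lcm(2, l) = 2l, and their 2ml points form m cycles.
  cycles-qFactor-odd : ∀ m → let l = suc (m * 2) in
    CycleProduct (C j) (λ s → l * twistedCount l s) (C j l * C j (2 * l) ^ ((l ∸ 1) ℕ./ 2))
  cycles-qFactor-odd m = subst₂ (λ v e → CycleProduct (C j) (λ s → l * twistedCount l s) (v * C j (2 * l) ^ e))
    (^-identityʳ (C j l)) (sym (m*n/n≡m m 2))
    (cycles-cong (C j) count (cycles-* (C j) (cycles-single (C j) l 1 z<s) (cycles-single (C j) (2 * l) m z<s)))
    where
    l : ℕ
    l = suc (m * 2)
    double≢ : ∀ d → l ≢ d + d
    double≢ d eq = even≢odd d m (trans (cong (d +_) (+-identityʳ d)) (trans (sym eq) (cong suc (*-comm m 2))))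
    arith : ∀ a b m → a * (suc (m * 2) * 1) + b * (2 * suc (m * 2) * m) ≡ suc (m * 2) * (a + m * 2 * b)
    arith = solve-∀
    count : ∀ s → 𝟙 (l ≟ s) * (l * 1) + 𝟙 (2 * l ≟ s) * (2 * l * m) ≡ l * twistedCount l s
    count s = trans (arith (𝟙 (l ≟ s)) (𝟙 (2 * l ≟ s)) m) (cong (l *_) (sym
      (∑-upTo-except l (twistedLength l) 0 l (2 * l) z<s refl
        (λ d d<l d≢0 → trans (twistedLength-≢half l d (n≢0⇒n>0 d≢0) d<l (double≢ d)) (lcm-2-odd m)) s)))

  -- lcm(2, l) is l, and the exceptional d = l/2 is even and gives l as well; so all l² points lie
  -- on cycles of length l.
  cycles-qFactor-0mod4 : ∀ q → let l = q * 4 in 0 < l → CycleProduct (C j) (λ s → l * twistedCount l s) (C j l ^ l)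
  cycles-qFactor-0mod4 q@(suc _) l>0 = cycles-cong (C j) count (cycles-single (C j) l l z<s)
    where
    l : ℕ
    l = q * 4
    4q≡ : l ≡ q * 2 + q * 2
    4q≡ = arith q
      where
      arith : ∀ q → q * 4 ≡ q * 2 + q * 2
      arith = solve-∀
    2∣l : 2 ∣ l
    2∣l = subst (2 ∣_) (sym 4q≡) (∣m∣n⇒∣m+n (divides q refl) (divides q refl))
    length≡l : ∀ d → d < l → twistedLength l d ≡ l
    length≡l zero      d<l = refl
    length≡l d@(suc e) d<l = by-cases (l ∣? (d + d))
      where
      2∣d : l ≡ d + d → 2 ∣ d
      2∣d l≡ = divides q (*-cancelˡ-≡ d (q * 2) 2 (trans (cong (d +_) (+-identityʳ d))
        (trans (sym l≡) (trans 4q≡ (cong (q * 2 +_) (sym (+-identityʳ (q * 2))))))))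
      by-cases : (l∣? : Dec (l ∣ d + d)) → (if does l∣? then (if does (2 ∣? d) then l else d) else lcm 2 l) ≡ l
      by-cases (yes l∣) = if-yes (2 ∣? d) (2∣d (∣double⇒≡ l d z<s d<l l∣))
      by-cases (no _)   = lcm-2-even l 2∣l
    count : ∀ s → 𝟙 (l ≟ s) * (l * l) ≡ l * twistedCount l s
    count s = begin
      𝟙 (l ≟ s) * (l * l)                ≡⟨ *-comm (𝟙 (l ≟ s)) (l * l) ⟩
      l * l * 𝟙 (l ≟ s)                  ≡⟨ *-assoc l l (𝟙 (l ≟ s)) ⟩
      l * (l * 𝟙 (l ≟ s))                ≡⟨ cong (λ k → l * (k * 𝟙 (l ≟ s))) (List.length-upTo l) ⟨
      l * (length (upTo l) * 𝟙 (l ≟ s))  ≡⟨ cong (l *_) (∑-const (upTo l) (𝟙 (l ≟ s))) ⟨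
      l * ∑ (upTo l) (λ _ → 𝟙 (l ≟ s)) ≡⟨ cong (l *_) (∑-upTo-cong l (λ d d<l → cong (λ t → 𝟙 (t ≟ s)) (sym (length≡l d d<l)))) ⟩
      l * twistedCount l s               ∎

  -- d = l/2 is odd and gives l points on cycles of length l/2, that is two cycles. The other l - 1
  -- values of d give one cycle of length l each.
  cycles-qFactor-2mod4 : ∀ q → let l = 2 + q * 4 in
    CycleProduct (C j) (λ s → l * twistedCount l s) (C j (l ℕ./ 2) ^ 2 * C j l ^ (l ∸ 1))
  cycles-qFactor-2mod4 q = subst (λ d → CycleProduct (C j) (λ s → l * twistedCount l s) (C j d ^ 2 * C j l ^ (l ∸ 1)))
    (sym (trans (cong (ℕ._/ 2) l≡d*2) (m*n/n≡m d 2)))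
    (cycles-cong (C j) count (cycles-* (C j) (cycles-single (C j) d 2 z<s) (cycles-single (C j) l (l ∸ 1) z<s)))
    where
    l d : ℕ
    l = 2 + q * 4
    d = suc (q * 2)
    l≡d*2 : l ≡ d * 2
    l≡d*2 = arith q
      where
      arith : ∀ q → 2 + q * 4 ≡ suc (q * 2) * 2
      arith = solve-∀
    l≡d+d : l ≡ d + d
    l≡d+d = trans l≡d*2 (trans (*-comm d 2) (cong (d +_) (+-identityʳ d)))
    at : twistedLength l d ≡ d
    at = trans (if-yes (l ∣? (d + d)) (subst (_∣ d + d) (sym l≡d+d) ∣-refl)) (if-no (2 ∣? d) (2∤odd q))
    off : ∀ e → e < l → e ≢ d → twistedLength l e ≡ l
    off zero      e<l e≢d = refl
    off e@(suc _) e<l e≢d = trans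
      (twistedLength-≢half l e z<s e<l (λ l≡ → e≢d (*-cancelˡ-≡ e d 2
        (trans (cong (e +_) (+-identityʳ e)) (trans (sym l≡) (trans l≡d*2 (*-comm d 2)))))))
      (lcm-2-even l (divides d l≡d*2))
    arith : ∀ a b q → a * (suc (q * 2) * 2) + b * ((2 + q * 4) * (1 + q * 4)) ≡ (2 + q * 4) * (a + (1 + q * 4) * b)
    arith = solve-∀
    count : ∀ s → 𝟙 (d ≟ s) * (d * 2) + 𝟙 (l ≟ s) * (l * (l ∸ 1)) ≡ l * twistedCount l s
    count s = trans (arith (𝟙 (d ≟ s)) (𝟙 (l ≟ s)) q) (cong (l *_) (sym
      (∑-upTo-except l (twistedLength l) d d l (subst (d <_) (sym l≡d+d) (m<m+n d z<s)) at off s)))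

  cycles-qFactor : ∀ l → 0 < l → CycleProduct (C j) (λ s → l * twistedCount l s) (qFactor j l)
  cycles-qFactor l l>0 with l % 4 | m≡m%n+[m/n]*n l 4 | m%n<n l 4
  ... | 0 | eq | _ = subst (λ l → CycleProduct (C j) (λ s → l * twistedCount l s) (C j l ^ l)) (sym eq)
        (cycles-qFactor-0mod4 (l ℕ./ 4) (subst (0 <_) eq l>0))
  ... | 1 | eq | _ = subst (λ l → CycleProduct (C j) (λ s → l * twistedCount l s) (C j l * C j (2 * l) ^ ((l ∸ 1) ℕ./ 2)))
        (trans (arith (l ℕ./ 4)) (sym eq)) (cycles-qFactor-odd (l ℕ./ 4 * 2))
    where
    arith : ∀ q → suc (q * 2 * 2) ≡ 1 + q * 4
    arith = solve-∀
  ... | 2 | eq | _ = subst (λ l → CycleProduct (C j) (λ s → l * twistedCount l s) (C j (l ℕ./ 2) ^ 2 * C j l ^ (l ∸ 1))) (sym eq)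
        (cycles-qFactor-2mod4 (l ℕ./ 4))
  ... | 3 | eq | _ = subst (λ l → CycleProduct (C j) (λ s → l * twistedCount l s) (C j l * C j (2 * l) ^ ((l ∸ 1) ℕ./ 2)))
        (trans (arith (l ℕ./ 4)) (sym eq)) (cycles-qFactor-odd (suc (l ℕ./ 4 * 2)))
    where
    arith : ∀ q → suc (suc (q * 2) * 2) ≡ 3 + q * 4
    arith = solve-∀
  ... | suc (suc (suc (suc _))) | _ | s≤s (s≤s (s≤s (s≤s ())))

  -- lcm(a, b) divides a b and 2 divides e, so `l` divides `a * b * e` and the division in `pPow` is
  -- exact.
  cycles-pPow : ∀ a b e .{{_ : NonZero a}} .{{_ : NonZero b}} → 2 ∣ e →
    CycleProduct (C j) (λ s → 𝟙 (lcm 2 (lcm a b) ≟ s) * (a * b * e)) (pPow j a b e)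
  cycles-pPow a b e 2∣e = cycles-cong (C j) (λ s → cong (𝟙 (l ≟ s) *_) (m*[n/m]≡n l∣abe))
    (cycles-single (C j) l ((a * b * e) ℕ./ l) (>-nonZero⁻¹ l))
    where
    l : ℕ
    l = lcm 2 (lcm a b)
    instance
      l≢0 : NonZero l
      l≢0 = lcm≢0 2 (lcm a b) {{_}} {{lcm≢0 a b}}
    l∣abe : l ∣ a * b * e
    l∣abe = lcm-least {2} {lcm a b} (∣n⇒∣m*n (a * b) 2∣e) (∣m⇒∣m*n {lcm a b} {a * b} e (lcm-least {a} {b} (m∣m*n b) (n∣m*n a)))

2∣k²∸k : ∀ k → 2 ∣ k ^ 2 ∸ k
2∣k²∸k zero    = 2 ∣0
2∣k²∸k (suc k) = subst (2 ∣_) (sym (trans (cong (_∸ suc k) (arith k)) (m+n∸m≡n (suc k) (k * suc k)))) (2∣k*suck k)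
  where
  arith : ∀ k → suc k ^ 2 ≡ suc k + k * suc k
  arith k = cong (suc k *_) (*-identityʳ (suc k))
  2∣k*suck : ∀ k → 2 ∣ k * suc k
  2∣k*suck k with evenOrOdd k
  ... | even q = ∣m⇒∣m*n (suc (q * 2)) (divides q refl)
  ... | odd q  = ∣n⇒∣m*n (suc (q * 2)) (divides (suc q) refl)

k²≡k+[k²∸k] : ∀ k → k * k ≡ k + (k ^ 2 ∸ k)
k²≡k+[k²∸k] k = trans (cong (k *_) (sym (*-identityʳ k))) (sym (m+[n∸m]≡n (k≤k² k)))
  where
  k≤k² : ∀ k → k ≤ k ^ 2
  k≤k² zero    = z≤n
  k≤k² (suc k) = m≤m*n (suc k) (suc k ^ 1) {{m^n≢0 (suc k) 1}}

∑-upTo-last : ∀ m (f : ℕ → ℕ) → ∑ (upTo (suc m)) f ≡ ∑ (upTo m) f + f m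
∑-upTo-last m f = trans (sym (sum-applyUpTo f (suc m))) (trans (∑-applyUpTo-suc f m) (cong (_+ f m) (sum-applyUpTo f m)))

-- Terms off the diagonal come in equal pairs, which is the source of the exponent 2 k_a k_b for b <
-- a.
∑-symmetric : ∀ m (f : ℕ → ℕ → ℕ) → (∀ i i′ → f i i′ ≡ f i′ i) →
  ∑ (upTo m) (λ i → ∑ (upTo m) (f i)) ≡ ∑ (upTo m) (λ i → f i i + ∑ (upTo i) (λ i′ → 2 * f i i′))
∑-symmetric zero    f f-sym = refl
∑-symmetric (suc m) f f-sym = begin
  ∑ (upTo (suc m)) (λ i → ∑ (upTo (suc m)) (f i))
    ≡⟨ ∑-upTo-last m (λ i → ∑ (upTo (suc m)) (f i)) ⟩
  ∑ (upTo m) (λ i → ∑ (upTo (suc m)) (f i)) + ∑ (upTo (suc m)) (f m)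
    ≡⟨ cong₂ _+_ (trans (∑-cong (upTo m) (λ i → ∑-upTo-last m (f i))) (∑-+ (upTo m))) (∑-upTo-last m (f m)) ⟩
  ∑ (upTo m) (λ i → ∑ (upTo m) (f i)) + ∑ (upTo m) (λ i → f i m) + (∑ (upTo m) (f m) + f m m)
    ≡⟨ cong₂ (λ a b → a + b + (∑ (upTo m) (f m) + f m m)) (∑-symmetric m f f-sym) (∑-cong (upTo m) (λ i → f-sym i m)) ⟩
  rest + ∑ (upTo m) (f m) + (∑ (upTo m) (f m) + f m m)
    ≡⟨ arith rest (∑ (upTo m) (f m)) (f m m) ⟩
  rest + (f m m + 2 * ∑ (upTo m) (f m))
    ≡⟨ cong (λ a → rest + (f m m + a)) (∑-*ˡ (upTo m) 2) ⟨
  rest + (f m m + ∑ (upTo m) (λ i′ → 2 * f m i′))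
    ≡⟨ ∑-upTo-last m (λ i → f i i + ∑ (upTo i) (λ i′ → 2 * f i i′)) ⟨
  ∑ (upTo (suc m)) (λ i → f i i + ∑ (upTo i) (λ i′ → 2 * f i i′)) ∎
  where
  rest : ℕ
  rest = ∑ (upTo m) (λ i → f i i + ∑ (upTo i) (λ i′ → 2 * f i i′))
  arith : ∀ a b c → a + b + (b + c) ≡ a + (c + 2 * b)
  arith = solve-∀

-- This and `lFactor` repeat the summands of `N` and `L` with `x` for p - q, so that `L` unfolds to
-- them by definition.
nFactor : ∀ {y} x → Vec ℕ y → Vec ℕ x → ℕ
nFactor x j k = ∏ x λ a → ∏ x λ b → C j (lcm a b) ^ (k # a * k # b * gcd a b)

lFactor : ∀ {y} x → Vec ℕ y → Vec ℕ x → ℕ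
lFactor x j k = ∏ x λ a →
  qFactor j a ^ (k # a) * pPow j a a ((k # a) ^ 2 ∸ k # a)
    * ∏ (a ∸ 1) (λ b → pPow j a b (2 * k # a * k # b))

module _ {x y : ℕ} (g : Perm x) (j : Vec ℕ y) where

  private
    k : Vec ℕ x
    k = typeV g

    ∑∑-ℓ : (φ : ℕ → ℕ → ℕ) → ∑ (allFin x) (λ a → ∑ (allFin x) (λ b → φ (ℓ g a) (ℓ g b))) ≡
      ∑ (upTo x) (λ i → ∑ (upTo x) (λ i′ → suc i * suc i′ * (k # suc i * k # suc i′) * φ (suc i) (suc i′)))
    ∑∑-ℓ φ = begin
      ∑ (allFin x) (λ a → ∑ (allFin x) (λ b → φ (ℓ g a) (ℓ g b)))
        ≡⟨ ∑-cong (allFin x) (λ a → ∑-ℓ g x ≤-refl (φ (ℓ g a))) ⟩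
      ∑ (allFin x) (λ a → ∑ (upTo x) (λ i′ → type g (suc i′) * (suc i′ * φ (ℓ g a) (suc i′))))
        ≡⟨ ∑-ℓ g x ≤-refl (λ l → ∑ (upTo x) (λ i′ → type g (suc i′) * (suc i′ * φ l (suc i′)))) ⟩
      ∑ (upTo x) (λ i → type g (suc i) * (suc i * ∑ (upTo x) (λ i′ → type g (suc i′) * (suc i′ * φ (suc i) (suc i′)))))
        ≡⟨ ∑-cong (upTo x) (λ i → begin
             type g (suc i) * (suc i * ∑ (upTo x) (λ i′ → type g (suc i′) * (suc i′ * φ (suc i) (suc i′))))
               ≡⟨ *-assoc (type g (suc i)) (suc i) _ ⟨
             type g (suc i) * suc i * ∑ (upTo x) (λ i′ → type g (suc i′) * (suc i′ * φ (suc i) (suc i′)))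
               ≡⟨ ∑-*ˡ (upTo x) (type g (suc i) * suc i) ⟨
             ∑ (upTo x) (λ i′ → type g (suc i) * suc i * (type g (suc i′) * (suc i′ * φ (suc i) (suc i′))))
               ≡⟨ ∑-cong (upTo x) (λ i′ → trans (arith (type g (suc i)) (suc i) (type g (suc i′)) (suc i′) (φ (suc i) (suc i′)))
                    (cong₂ (λ t t′ → suc i * suc i′ * (t * t′) * φ (suc i) (suc i′)) (sym (typeV-# g (suc i))) (sym (typeV-# g (suc i′))))) ⟩
             ∑ (upTo x) (λ i′ → suc i * suc i′ * (k # suc i * k # suc i′) * φ (suc i) (suc i′)) ∎) ⟩
      ∑ (upTo x) (λ i → ∑ (upTo x) (λ i′ → suc i * suc i′ * (k # suc i * k # suc i′) * φ (suc i) (suc i′))) ∎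
      where
      arith : ∀ t a t′ b p → t * a * (t′ * (b * p)) ≡ a * b * (t * t′) * p
      arith = solve-∀

  -- A cycle of length a and one of length b have a b pairs, all on cycles of length lcm(a, b),
  -- hence on gcd(a, b) cycles.
  straight-product : product (List.tabulate (C j ∘ len (pairPerm g false))) ≡ nFactor x j k
  straight-product = product-over-cycles (C j) (pairPerm g false) points
    (cycles-∏ (C j) x (λ i → cycles-∏ (C j) x (λ i′ → cycles-single (C j) (lcm (suc i) (suc i′))
      (k # suc i * k # suc i′ * gcd (suc i) (suc i′)) (lcm>0 (suc i) (suc i′) z<s z<s))))
    where
    points : ∀ s → ∑ (allFin (x * x)) (λ v → 𝟙 (ℓ (pairPerm g false) v ≟ s)) ≡
      ∑ (upTo x) (λ i → ∑ (upTo x) (λ i′ → 𝟙 (lcm (suc i) (suc i′) ≟ s) *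
        (lcm (suc i) (suc i′) * (k # suc i * k # suc i′ * gcd (suc i) (suc i′)))))
    points s = begin
      ∑ (allFin (x * x)) (λ v → 𝟙 (ℓ (pairPerm g false) v ≟ s))
        ≡⟨ ∑-pairs g (λ v → 𝟙 (ℓ (pairPerm g false) v ≟ s)) ⟩
      ∑ (allFin x) (λ a → ∑ (allFin x) (λ b → 𝟙 (ℓ (pairPerm g false) (combine a b) ≟ s)))
        ≡⟨ ∑-cong (allFin x) (λ a → ∑-cong (allFin x) (λ b → cong (λ l → 𝟙 (l ≟ s)) (ℓ-straight g a b))) ⟩
      ∑ (allFin x) (λ a → ∑ (allFin x) (λ b → 𝟙 (lcm (ℓ g a) (ℓ g b) ≟ s)))
        ≡⟨ ∑∑-ℓ (λ a b → 𝟙 (lcm a b ≟ s)) ⟩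
      ∑ (upTo x) (λ i → ∑ (upTo x) (λ i′ → suc i * suc i′ * (k # suc i * k # suc i′) * 𝟙 (lcm (suc i) (suc i′) ≟ s)))
        ≡⟨ ∑-cong (upTo x) (λ i → ∑-cong (upTo x) (λ i′ → trans
             (cong (λ m → m * (k # suc i * k # suc i′) * 𝟙 (lcm (suc i) (suc i′) ≟ s)) (sym (gcd*lcm (suc i) (suc i′))))
             (arith (gcd (suc i) (suc i′)) (lcm (suc i) (suc i′)) (k # suc i * k # suc i′) (𝟙 (lcm (suc i) (suc i′) ≟ s))))) ⟩
      _ ∎
      where
      arith : ∀ d l t p → d * l * t * p ≡ p * (l * (t * d))
      arith = solve-∀

  -- Pairs on one cycle of `g` give the powers of `qFactor`, pairs on two different cycles of equal
  -- length the exponent k² - k, and pairs on cycles of different lengths the factors for b < a,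
  -- doubled for the two orders.
  twisted-product : product (List.tabulate (C j ∘ len (pairPerm g true))) ≡ lFactor x j k
  twisted-product = product-over-cycles (C j) (pairPerm g true) points
    (cycles-∏ (C j) x (λ i → cycles-* (C j) (cycles-* (C j)
      (cycles-^ (C j) (k # suc i) (cycles-qFactor j (suc i) z<s))
      (cycles-pPow j (suc i) (suc i) _ (2∣k²∸k (k # suc i))))
      (cycles-∏ (C j) i (λ i′ → cycles-pPow j (suc i) (suc i′) _ (∣m⇒∣m*n (k # suc i′) (m∣m*n (k # suc i)))))))
    where
    module _ (s : ℕ) where
      ψ : ℕ → ℕ → ℕ
      ψ a b = 𝟙 (lcm 2 (lcm a b) ≟ s)
      F : Fin x → Fin x → ℕ
      F a b = 𝟙 (ℓ (pairPerm g true) (combine a b) ≟ s)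
      S : ℕ → ℕ → ℕ
      S i i′ = suc i * suc i′ * (k # suc i * k # suc i′) * ψ (suc i) (suc i′)
      same : ℕ → ℕ
      same i = k # suc i * (suc i * twistedCount (suc i) s)
      equalLength : ℕ → ℕ
      equalLength i = ψ (suc i) (suc i) * (suc i * suc i * ((k # suc i) ^ 2 ∸ k # suc i))
      shorter : ℕ → ℕ
      shorter i = ∑ (upTo i) (λ i′ → ψ (suc i) (suc i′) * (suc i * suc i′ * (2 * k # suc i * k # suc i′)))
      distinct : ℕ → ℕ
      distinct i = equalLength i + shorter i

      S-sym : ∀ i i′ → S i i′ ≡ S i′ i
      S-sym i i′ = cong₂ _*_ (cong₂ _*_ (*-comm (suc i) (suc i′)) (*-comm (k # suc i) (k # suc i′)))
        (cong (λ l → 𝟙 (lcm 2 l ≟ s)) (lcm-comm (suc i) (suc i′)))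

      ∑-by-cycle : (φ : ℕ → ℕ) → ∑ (allFin x) (φ ∘ ℓ g) ≡ ∑ (upTo x) (λ i → k # suc i * (suc i * φ (suc i)))
      ∑-by-cycle φ = trans (∑-ℓ g x ≤-refl φ) (∑-cong (upTo x) (λ i → cong (_* (suc i * φ (suc i))) (sym (typeV-# g (suc i)))))

      same-class : ∑ (allFin x) (λ a → ∑ (allFin x) (λ b → 𝟙 (cl g b Fin.≟ cl g a) * F a b)) ≡ ∑ (upTo x) same
      same-class = trans
        (∑-cong (allFin x) (λ a → trans (∑-orbit g a (F a)) (∑-upTo-cong (ℓ g a) (λ d d<ℓ → cong (λ l → 𝟙 (l ≟ s)) (ℓ-twisted-∼ g a d d<ℓ)))))
        (∑-by-cycle (λ l → twistedCount l s))

      -- The length formula for distinct cycles, evaluated where it need not be the true length, on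
      -- pairs from one cycle; this is the excess to be cancelled in `distinct-classes`.
      diagonal : ∑ (allFin x) (λ a → ∑ (allFin x) (λ b → 𝟙 (cl g b Fin.≟ cl g a) * ψ (ℓ g a) (ℓ g b))) ≡
                 ∑ (upTo x) (λ i → k # suc i * (suc i * (suc i * ψ (suc i) (suc i))))
      diagonal = trans (∑-cong (allFin x) (λ a → begin
          ∑ (allFin x) (λ b → 𝟙 (cl g b Fin.≟ cl g a) * ψ (ℓ g a) (ℓ g b))
            ≡⟨ ∑-cong (allFin x) (λ b → 𝟙*-cong (cl g b Fin.≟ cl g a) (λ eq → cong (ψ (ℓ g a) ∘ len g) eq)) ⟩
          ∑ (allFin x) (λ b → 𝟙 (cl g b Fin.≟ cl g a) * ψ (ℓ g a) (ℓ g a))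
            ≡⟨ ∑-orbit g a (λ _ → ψ (ℓ g a) (ℓ g a)) ⟩
          ∑ (upTo (ℓ g a)) (λ _ → ψ (ℓ g a) (ℓ g a))
            ≡⟨ trans (∑-const (upTo (ℓ g a)) _) (cong (_* ψ (ℓ g a) (ℓ g a)) (List.length-upTo (ℓ g a))) ⟩
          ℓ g a * ψ (ℓ g a) (ℓ g a) ∎))
        (∑-by-cycle (λ l → l * ψ l l))

      -- The condition of lying on distinct cycles cannot be read off from lengths. Adding
      -- `diagonal` to both sides removes it, and then `ψ` is summed over all pairs by length.
      distinct-classes : ∑ (allFin x) (λ a → ∑ (allFin x) (λ b → 𝟙 (¬? (cl g b Fin.≟ cl g a)) * F a b)) ≡ ∑ (upTo x) distinct
      distinct-classes = +-cancelʳ-≡ (∑ (upTo x) (λ i → k # suc i * (suc i * (suc i * ψ (suc i) (suc i))))) _ _ (begin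
        ∑ (allFin x) (λ a → ∑ (allFin x) (λ b → 𝟙 (¬? (cl g b Fin.≟ cl g a)) * F a b)) + _
          ≡⟨ cong₂ _+_ (∑-cong (allFin x) (λ a → ∑-cong (allFin x) (λ b → 𝟙*-cong (¬? (cl g b Fin.≟ cl g a))
               (λ b≁a → cong (λ l → 𝟙 (l ≟ s)) (ℓ-twisted-≁ g a b b≁a))))) (sym diagonal) ⟩
        ∑ (allFin x) (λ a → ∑ (allFin x) (λ b → 𝟙 (¬? (cl g b Fin.≟ cl g a)) * ψ (ℓ g a) (ℓ g b))) +
          ∑ (allFin x) (λ a → ∑ (allFin x) (λ b → 𝟙 (cl g b Fin.≟ cl g a) * ψ (ℓ g a) (ℓ g b)))
          ≡⟨ trans (sym (∑-+ (allFin x))) (∑-cong (allFin x) (λ a → trans (sym (∑-+ (allFin x))) (∑-cong (allFin x) (λ b →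
               recombine (cl g b Fin.≟ cl g a) (ψ (ℓ g a) (ℓ g b)))))) ⟩
        ∑ (allFin x) (λ a → ∑ (allFin x) (λ b → ψ (ℓ g a) (ℓ g b)))
          ≡⟨ ∑∑-ℓ ψ ⟩
        ∑ (upTo x) (λ i → ∑ (upTo x) (S i))
          ≡⟨ ∑-symmetric x S S-sym ⟩
        ∑ (upTo x) (λ i → S i i + ∑ (upTo i) (λ i′ → 2 * S i i′))
          ≡⟨ ∑-cong (upTo x) (λ i → begin
               S i i + ∑ (upTo i) (λ i′ → 2 * S i i′)
                 ≡⟨ cong₂ _+_ (trans (cong (λ m → suc i * suc i * m * ψ (suc i) (suc i)) (k²≡k+[k²∸k] (k # suc i)))
                      (arith₁ (suc i) (k # suc i) _ (ψ (suc i) (suc i))))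
                    (∑-cong (upTo i) (λ i′ → arith₂ (suc i) (suc i′) (k # suc i) (k # suc i′) (ψ (suc i) (suc i′)))) ⟩
               ψ (suc i) (suc i) * (suc i * suc i * ((k # suc i) ^ 2 ∸ k # suc i)) + k # suc i * (suc i * (suc i * ψ (suc i) (suc i))) +
                 ∑ (upTo i) (λ i′ → ψ (suc i) (suc i′) * (suc i * suc i′ * (2 * k # suc i * k # suc i′)))
                 ≡⟨ arith₃ (equalLength i) (k # suc i * (suc i * (suc i * ψ (suc i) (suc i)))) (shorter i) ⟩
               distinct i + k # suc i * (suc i * (suc i * ψ (suc i) (suc i))) ∎) ⟩
        ∑ (upTo x) (λ i → distinct i + k # suc i * (suc i * (suc i * ψ (suc i) (suc i))))
          ≡⟨ ∑-+ (upTo x) ⟩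
        ∑ (upTo x) distinct + _ ∎)
        where
        recombine : ∀ {P : Set} (p? : Dec P) m → 𝟙 (¬? p?) * m + 𝟙 p? * m ≡ m
        recombine (yes _) m = +-identityʳ m
        recombine (no _)  m = trans (+-identityʳ _) (+-identityʳ m)
        arith₁ : ∀ a t e p → a * a * (t + e) * p ≡ p * (a * a * e) + t * (a * (a * p))
        arith₁ = solve-∀
        arith₂ : ∀ a b t t′ p → 2 * (a * b * (t * t′) * p) ≡ p * (a * b * (2 * t * t′))
        arith₂ = solve-∀
        arith₃ : ∀ a b c → a + b + c ≡ a + c + b
        arith₃ = solve-∀

    points : ∀ s → ∑ (allFin (x * x)) (λ v → 𝟙 (ℓ (pairPerm g true) v ≟ s)) ≡
      ∑ (upTo x) (λ i → same s i + ψ s (suc i) (suc i) * (suc i * suc i * ((k # suc i) ^ 2 ∸ k # suc i)) +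
        ∑ (upTo i) (λ i′ → ψ s (suc i) (suc i′) * (suc i * suc i′ * (2 * k # suc i * k # suc i′))))
    points s = begin
      ∑ (allFin (x * x)) (λ v → 𝟙 (ℓ (pairPerm g true) v ≟ s))
        ≡⟨ ∑-pairs g (λ v → 𝟙 (ℓ (pairPerm g true) v ≟ s)) ⟩
      ∑ (allFin x) (λ a → ∑ (allFin x) (F s a))
        ≡⟨ ∑-cong (allFin x) (λ a → trans (∑-cong (allFin x) (λ b → split (cl g b Fin.≟ cl g a) (F s a b))) (∑-+ (allFin x))) ⟩
      ∑ (allFin x) (λ a → ∑ (allFin x) (λ b → 𝟙 (cl g b Fin.≟ cl g a) * F s a b) +
                          ∑ (allFin x) (λ b → 𝟙 (¬? (cl g b Fin.≟ cl g a)) * F s a b))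
        ≡⟨ ∑-+ (allFin x) ⟩
      _ ≡⟨ cong₂ _+_ (same-class s) (distinct-classes s) ⟩
      ∑ (upTo x) (same s) + ∑ (upTo x) (distinct s)
        ≡⟨ ∑-+ (upTo x) ⟨
      ∑ (upTo x) (λ i → same s i + distinct s i)
        ≡⟨ ∑-cong (upTo x) (λ i → sym (+-assoc (same s i) (equalLength s i) (shorter s i))) ⟩
      _ ∎
      where
      split : ∀ {P : Set} (p? : Dec P) m → m ≡ 𝟙 p? * m + 𝟙 (¬? p?) * m
      split (yes _) m = sym (trans (+-identityʳ _) (+-identityʳ m))
      split (no _)  m = sym (+-identityʳ m)

-- Burnside's lemma

sum≡1⇒∈ : ∀ (_≟_ : DecidableEquality A) xs x → ∑ xs (λ a → 𝟙 (a ≟ x)) ≡ 1 → x ∈ xs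
sum≡1⇒∈ _≟_ (a ∷ xs) x eq with a ≟ x
... | yes refl = here refl
... | no _     = there (sum≡1⇒∈ _≟_ xs x eq)

any-element? : (F : Finite A) {P : A → Set} → (∀ a → Dec (P a)) → Dec (∃ P)
any-element? F P? = map′ (λ p → let a , _ , pa = find p in a , pa)
  (λ (a , pa) → lose (sum≡1⇒∈ (_≟ᶠ_ F) (elements F) a (once F a)) pa) (any? P? (elements F))

module Transversal {_∼_ : A → A → Set} (∼-equiv : IsEquivalence _∼_) (_∼?_ : ∀ a b → Dec (a ∼ b)) where

  private
    module ∼ = IsEquivalence ∼-equiv

  transversal : List A → List A
  transversal []       = []
  transversal (x ∷ xs) = x ∷ filter (λ y → ¬? (y ∼? x)) (transversal xs)

  transversal-once : ∀ xs {a} → a ∈ xs → ∑ (transversal xs) (λ r → 𝟙 (r ∼? a)) ≡ 1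
  transversal-once (x ∷ xs) {a} a∈ = trans
    (cong (𝟙 (x ∼? a) +_) (∑-filter (λ y → ¬? (y ∼? x)) (transversal xs))) (by-cases (x ∼? a) a∈)
    where
    by-cases : (d : Dec (x ∼ a)) → a ∈ (x ∷ xs) → 𝟙 d + ∑ (transversal xs) (λ r → 𝟙 (¬? (r ∼? x)) * 𝟙 (r ∼? a)) ≡ 1
    by-cases (yes x∼a) _ = cong suc (∑-zero (transversal xs) (λ r →
      trans (𝟙*-cong (¬? (r ∼? x)) (λ r≁x → 𝟙-no (r ∼? a) (λ r∼a → r≁x (∼.trans r∼a (∼.sym x∼a))))) (*-zeroʳ (𝟙 (¬? (r ∼? x))))))
    by-cases (no x≁a) (here refl) = contradiction ∼.refl x≁a
    by-cases (no x≁a) (there a∈xs) = trans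
      (∑-cong (transversal xs) (λ r → trans (*-comm (𝟙 (¬? (r ∼? x))) _)
        (trans (𝟙*-cong (r ∼? a) (λ r∼a → 𝟙-yes (¬? (r ∼? x)) (λ r∼x → x≁a (∼.trans (∼.sym r∼x) r∼a)))) (*-identityʳ _))))
      (transversal-once xs a∈xs)

-- In place of the full group axioms stand the facts used in Burnside's argument: `∙-inv` and
-- `inv-∙` make right translations bijective, and the other laws make `_∼_` an equivalence.
record Action {G Ω : Set} (FG : Finite G) (FΩ : Finite Ω) : Set where
  infixr 7 _·_
  infixl 8 _∙_
  field
    _·_   : G → Ω → Ω
    _∙_   : G → G → G
    ε     : G
    inv   : G → G
    ε-·   : ∀ ω → ε · ω ≡ ω
    ∙-·   : ∀ g h ω → (g ∙ h) · ω ≡ g · h · ω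
    inv-· : ∀ g ω → inv g · g · ω ≡ ω
    ∙-inv : ∀ g h → (g ∙ h) ∙ inv h ≡ g
    inv-∙ : ∀ g h → (g ∙ inv h) ∙ h ≡ g

  _∼_ : Ω → Ω → Set
  ω ∼ ω′ = ∃ λ g → g · ω ≡ ω′

  ∼-isEquivalence : IsEquivalence _∼_
  ∼-isEquivalence = record
    { refl  = λ {ω} → ε , ε-· ω
    ; sym   = λ { {ω} (g , refl) → inv g , inv-· g ω }
    ; trans = λ { {ω} (g , refl) (h , refl) → h ∙ g , ∙-· h g ω }
    }

  _∼?_ : ∀ ω ω′ → Dec (ω ∼ ω′)
  ω ∼? ω′ = any-element? FG (λ g → _≟ᶠ_ FΩ (g · ω) ω′)

  open Transversal ∼-isEquivalence _∼?_ public

  -- One representative of each orbit, so that `length orbits` is the number of orbits.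
  orbits : List Ω
  orbits = transversal (elements FΩ)

  orbits-once : ∀ ω → ∑ orbits (λ r → 𝟙 (r ∼? ω)) ≡ 1
  orbits-once ω = transversal-once (elements FΩ) (sum≡1⇒∈ (_≟ᶠ_ FΩ) (elements FΩ) ω (once FΩ ω))

  -- After the exchange of sums, the stabiliser of ω is charged to the representative r of its orbit
  -- and has as many elements as take r to ω. Each group element takes r to exactly one ω, so every
  -- representative collects the order of the group.
  burnside : length orbits * ∣ FG ∣ᶠ ≡ ∑ᶠ FG (λ g → ∑ᶠ FΩ (λ ω → 𝟙 (_≟ᶠ_ FΩ (g · ω) ω)))
  burnside = sym (begin
    ∑ᶠ FG (λ g → ∑ᶠ FΩ (λ ω → 𝟙 (g · ω ≟Ω ω)))
      ≡⟨ ∑-swap (elements FG) (elements FΩ) _ ⟩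
    ∑ᶠ FΩ (λ ω → hits ω ω)
      ≡⟨ ∑-cong (elements FΩ) (λ ω → trans (∑-*ʳ orbits (hits ω ω))
           (trans (cong (_* hits ω ω) (orbits-once ω)) (*-identityˡ (hits ω ω)))) ⟨
    ∑ᶠ FΩ (λ ω → ∑ orbits (λ r → 𝟙 (r ∼? ω) * hits ω ω))
      ≡⟨ ∑-cong (elements FΩ) (λ ω → ∑-cong orbits (λ r → hits-eq r ω (r ∼? ω))) ⟩
    ∑ᶠ FΩ (λ ω → ∑ orbits (λ r → hits r ω))
      ≡⟨ ∑-swap (elements FΩ) orbits _ ⟩
    ∑ orbits (λ r → ∑ᶠ FΩ (hits r))
      ≡⟨ ∑-cong orbits (λ r → trans (∑-swap (elements FΩ) (elements FG) _)
           (∑-cong (elements FG) (λ g → trans (∑-cong (elements FΩ) (λ ω → 𝟙-⇔ sym sym (g · r ≟Ω ω) (ω ≟Ω g · r))) (once FΩ (g · r))))) ⟩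
    ∑ orbits (λ r → ∑ᶠ FG (λ _ → 1))
      ≡⟨ trans (∑-const orbits _) (cong (length orbits *_) (∑-1 (elements FG))) ⟩
    length orbits * ∣ FG ∣ᶠ ∎)
    where
    infix 4 _≟Ω_
    _≟Ω_ = _≟ᶠ_ FΩ
    hits : Ω → Ω → ℕ
    hits ω ω′ = ∑ᶠ FG (λ g → 𝟙 (g · ω ≟Ω ω′))
    -- If g₀ · r = ω, then translation by g₀ identifies the stabiliser of ω with
    -- the set of all g that take r to ω.
    hits-eq : ∀ r ω (d : Dec (r ∼ ω)) → 𝟙 d * hits ω ω ≡ hits r ω
    hits-eq r ω (no r≁ω) = sym (∑-zero (elements FG) (λ g → 𝟙-no (g · r ≟Ω ω) (λ eq → r≁ω (g , eq))))
    hits-eq r ω (yes (g₀ , refl)) = trans (*-identityˡ (hits ω ω)) (begin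
      ∑ᶠ FG (λ g → 𝟙 (g · ω ≟Ω ω))
        ≡⟨ ∑-cong (elements FG) (λ g → cong (λ ω′ → 𝟙 (ω′ ≟Ω ω)) (sym (∙-· g g₀ r))) ⟩
      ∑ᶠ FG (λ g → 𝟙 ((g ∙ g₀) · r ≟Ω ω))
        ≡⟨ ∑-reindex FG FG (_∙ g₀) (_∙ inv g₀) (λ g → ∙-inv g g₀) (λ g → inv-∙ g g₀) (λ g → 𝟙 (g · r ≟Ω ω)) ⟩
      hits r ω ∎)

-- The action of the symmetries on tables

-- The product of two elements of an x-element set X, as a table with values in
-- {0} ∪ Y for a y-element set Y.
Table : ℕ → ℕ → Set
Table x y = Vec (Fin (suc y)) (x * x)

finTable : ∀ x y → Finite (Table x y)
finTable x y = finVec (finFin (suc y)) (x * x)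

Symmetry : ℕ → ℕ → Set
Symmetry x y = Perm y × Perm x × Bool

finSymmetry : ∀ x y → Finite (Symmetry x y)
finSymmetry x y = fin× (finPerm y) (fin× (finPerm x) finBool)

module _ {x y : ℕ} where

  -- The graph of `transform` without inverses. For ω′ = ω it is the intertwining condition counted
  -- by `∑-commuting`; `zero ∷ h` keeps the zero in place.
  Moves : Symmetry x y → Table x y → Table x y → Set
  Moves (h , g , ε) ω ω′ = ∀ v → lookup ω′ (act (pairPerm g ε) v) ≡ act (zero ∷ h) (lookup ω v)

  transform : Symmetry x y → Table x y → Table x y
  transform (h , g , ε) ω = Vec.tabulate (λ v → act (zero ∷ h) (lookup ω (act⁻ (pairPerm g ε) v)))

  transform⇒moves : ∀ s ω ω′ → transform s ω ≡ ω′ → Moves s ω ω′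
  transform⇒moves (h , g , ε) ω ω′ refl v = trans (Vec.lookup∘tabulate _ (act (pairPerm g ε) v))
    (cong (act (zero ∷ h) ∘ lookup ω) (act⁻-act (pairPerm g ε) v))

  moves⇒transform : ∀ s ω ω′ → Moves s ω ω′ → transform s ω ≡ ω′
  moves⇒transform (h , g , ε) ω ω′ mv = trans
    (Vec.tabulate-cong (λ v → trans (sym (mv (act⁻ (pairPerm g ε) v))) (cong (lookup ω′) (act-act⁻ (pairPerm g ε) v))))
    (Vec.tabulate∘lookup ω′)

  compose : Symmetry x y → Symmetry x y → Symmetry x y
  compose (h , g , ε) (h′ , g′ , ε′) = h ⊙ h′ , g ⊙ g′ , ε xor ε′

  invert : Symmetry x y → Symmetry x y
  invert (h , g , ε) = inverse h , inverse g , ε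

  identity : Symmetry x y
  identity = encode id , encode id , false

  -- The swap commutes with applying one permutation to both entries, so the flags add modulo 2.
  pairMap-compose : ∀ (g g′ : Perm x) ε ε′ ab → pairMap (g ⊙ g′) (ε xor ε′) ab ≡ pairMap g ε (pairMap g′ ε′ ab)
  pairMap-compose g g′ false false (a , b) = cong₂ _,_ (act-⊙ g g′ a) (act-⊙ g g′ b)
  pairMap-compose g g′ false true  (a , b) = cong₂ _,_ (act-⊙ g g′ b) (act-⊙ g g′ a)
  pairMap-compose g g′ true  false (a , b) = cong₂ _,_ (act-⊙ g g′ b) (act-⊙ g g′ a)
  pairMap-compose g g′ true  true  (a , b) = cong₂ _,_ (act-⊙ g g′ a) (act-⊙ g g′ b)

  pairMap-inverse : ∀ (g : Perm x) ε ab → pairMap (inverse g) ε (pairMap g ε ab) ≡ ab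
  pairMap-inverse g false (a , b) = cong₂ _,_ (trans (act-inverse g _) (act⁻-act g a)) (trans (act-inverse g _) (act⁻-act g b))
  pairMap-inverse g true  (a , b) = cong₂ _,_ (trans (act-inverse g _) (act⁻-act g a)) (trans (act-inverse g _) (act⁻-act g b))

  act-pairPerm′ : ∀ (g : Perm x) ε v → act (pairPerm g ε) v ≡ uncurry′ combine (pairMap g ε (remQuot x v))
  act-pairPerm′ g ε v = trans (cong (act (pairPerm g ε)) (sym (Fin.combine-remQuot {x} x v)))
    (act-pairPerm g ε (proj₁ (remQuot {x} x v)) (proj₂ (remQuot {x} x v)))

  act-zero∷⊙ : (h h′ : Perm y) → act (zero ∷ (h ⊙ h′)) ≗ act (zero ∷ h) ∘ act (zero ∷ h′)
  act-zero∷⊙ h h′ zero    = refl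
  act-zero∷⊙ h h′ (suc v) = cong suc (act-⊙ h h′ v)

  act-zero∷inverse : (h : Perm y) → act (zero ∷ inverse h) ∘ act (zero ∷ h) ≗ id
  act-zero∷inverse h zero    = refl
  act-zero∷inverse h (suc v) = cong suc (trans (act-inverse h _) (act⁻-act h v))

  act-zero∷id : act (zero ∷ encode {y} id) ≗ id
  act-zero∷id zero    = refl
  act-zero∷id (suc v) = cong suc (act-encode id id v)

  moves-identity : ∀ ω → Moves identity ω ω
  moves-identity ω v = trans (cong (lookup ω) (trans (act-pairPerm′ (encode id) false v)
    (trans (cong₂ combine (act-encode id id (proj₁ (remQuot {x} x v))) (act-encode id id (proj₂ (remQuot {x} x v)))) (Fin.combine-remQuot {x} x v)))) (sym (act-zero∷id (lookup ω v)))

  moves-compose : ∀ s t ω ω′ ω″ → Moves t ω ω′ → Moves s ω′ ω″ → Moves (compose s t) ω ω″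
  moves-compose (h , g , ε) (h′ , g′ , ε′) ω ω′ ω″ mt ms v = begin
    lookup ω″ (act (pairPerm (g ⊙ g′) (ε xor ε′)) v)
      ≡⟨ cong (lookup ω″) (trans (act-pairPerm′ (g ⊙ g′) (ε xor ε′) v) (trans
           (cong (uncurry′ combine) (pairMap-compose g g′ ε ε′ (remQuot {x} x v)))
           (trans (sym (act-pairPerm g ε _ _)) (cong (act (pairPerm g ε)) (sym (act-pairPerm′ g′ ε′ v)))))) ⟩
    lookup ω″ (act (pairPerm g ε) (act (pairPerm g′ ε′) v)) ≡⟨ ms _ ⟩
    act (zero ∷ h) (lookup ω′ (act (pairPerm g′ ε′) v))     ≡⟨ cong (act (zero ∷ h)) (mt v) ⟩
    act (zero ∷ h) (act (zero ∷ h′) (lookup ω v))           ≡⟨ act-zero∷⊙ h h′ (lookup ω v) ⟨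
    act (zero ∷ (h ⊙ h′)) (lookup ω v)                      ∎

  moves-invert : ∀ s ω ω′ → Moves s ω ω′ → Moves (invert s) ω′ ω
  moves-invert (h , g , ε) ω ω′ mv v = begin
    lookup ω u                                      ≡⟨ act-zero∷inverse h (lookup ω u) ⟨
    act (zero ∷ inverse h) (act (zero ∷ h) (lookup ω u)) ≡⟨ cong (act (zero ∷ inverse h)) (mv u) ⟨
    act (zero ∷ inverse h) (lookup ω′ (act (pairPerm g ε) u)) ≡⟨ cong (act (zero ∷ inverse h) ∘ lookup ω′) back ⟩
    act (zero ∷ inverse h) (lookup ω′ v)            ∎
    where
    u : Fin (x * x)
    u = act (pairPerm (inverse g) ε) v
    fwd : act (pairPerm (inverse g) ε) (act (pairPerm g ε) (act⁻ (pairPerm g ε) v)) ≡ act⁻ (pairPerm g ε) v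
    fwd = trans (cong (act (pairPerm (inverse g) ε)) (act-pairPerm′ g ε w)) (trans (act-pairPerm (inverse g) ε _ _)
      (trans (cong (uncurry′ combine) (pairMap-inverse g ε (remQuot {x} x w))) (Fin.combine-remQuot {x} x w)))
      where
      w : Fin (x * x)
      w = act⁻ (pairPerm g ε) v
    back : act (pairPerm g ε) u ≡ v
    back = trans (cong (act (pairPerm g ε)) (trans (cong (act (pairPerm (inverse g) ε)) (sym (act-act⁻ (pairPerm g ε) v))) fwd))
      (act-act⁻ (pairPerm g ε) v)

xor-cancel : ∀ a b → (a xor b) xor b ≡ a
xor-cancel true  true  = refl
xor-cancel true  false = refl
xor-cancel false true  = refl
xor-cancel false false = refl

tableAction : ∀ x y → Action (finSymmetry x y) (finTable x y)
tableAction x y = record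
  { _·_   = transform
  ; _∙_   = compose
  ; ε     = identity
  ; inv   = invert
  ; ε-·   = λ ω → moves⇒transform (identity {x} {y}) ω ω (moves-identity {x} {y} ω)
  ; ∙-·   = λ s t ω → moves⇒transform (compose s t) ω (transform s (transform t ω))
              (moves-compose s t ω (transform t ω) (transform s (transform t ω))
                (transform⇒moves t ω (transform t ω) refl) (transform⇒moves s (transform t ω) (transform s (transform t ω)) refl))
  ; inv-· = λ s ω → moves⇒transform (invert s) (transform s ω) ω
              (moves-invert s ω (transform s ω) (transform⇒moves s ω (transform s ω) refl))
  ; ∙-inv = λ (h , g , ε) (h′ , g′ , ε′) → cong₂ _,_ (⊙-inverse h h′) (cong₂ _,_ (⊙-inverse g g′) (xor-cancel ε ε′))
  ; inv-∙ = λ (h , g , ε) (h′ , g′ , ε′) → cong₂ _,_ (⊙-inverse′ h h′) (cong₂ _,_ (⊙-inverse′ g g′) (xor-cancel ε ε′))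
  }

module _ (x y : ℕ) where

  open Action (tableAction x y)

  ∑-fixed-tables : ∀ (h : Perm y) (g : Perm x) ε →
    ∑ᶠ (finTable x y) (λ ω → 𝟙 (_≟ᶠ_ (finTable x y) (transform (h , g , ε) ω) ω)) ≡
    product (List.tabulate (C (typeV h) ∘ len (pairPerm g ε)))
  ∑-fixed-tables h g ε = trans
    (∑-cong (elements (finTable x y)) (λ ω → 𝟙-⇔ (transform⇒moves (h , g , ε) ω ω) (moves⇒transform (h , g , ε) ω ω)
      (_≟ᶠ_ (finTable x y) (transform (h , g , ε) ω) ω)
      (Fin.all? λ v → lookup ω (act (pairPerm g ε) v) Fin.≟ act (zero ∷ h) (lookup ω v))))
    (trans (∑-commuting (finFin (suc y)) (act (zero ∷ h)) (pairPerm g ε))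
      (∏ᶜ-cong (ncyc (pairPerm g ε)) (λ c → fix≡C h (len (pairPerm g ε) c) (len>0 (pairPerm g ε) c))))

  orbit-count : length orbits * (y ! * (x ! * 2)) ≡
    ∑ᶠ (finPerm y) (λ h → ∑ᶠ (finPerm x) (λ g → nFactor x (typeV h) (typeV g) + lFactor x (typeV h) (typeV g)))
  orbit-count = begin
    length orbits * (y ! * (x ! * 2))
      ≡⟨ cong (length orbits *_) card ⟨
    length orbits * ∣ finSymmetry x y ∣ᶠ
      ≡⟨ burnside ⟩
    ∑ᶠ (finSymmetry x y) fixed
      ≡⟨ ∑-fin× (finPerm y) (fin× (finPerm x) finBool) fixed ⟩
    ∑ᶠ (finPerm y) (λ h → ∑ᶠ (fin× (finPerm x) finBool) (λ gε → fixed (h , gε)))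
      ≡⟨ ∑-cong (elements (finPerm y)) (λ h → trans (∑-fin× (finPerm x) finBool (λ gε → fixed (h , gε)))
           (∑-cong (elements (finPerm x)) (λ g → trans (cong₂ _+_
             (trans (∑-fixed-tables h g true) (twisted-product g (typeV h)))
             (trans (+-identityʳ _) (trans (∑-fixed-tables h g false) (straight-product g (typeV h)))))
             (+-comm (lFactor x (typeV h) (typeV g)) (nFactor x (typeV h) (typeV g)))))) ⟩
    ∑ᶠ (finPerm y) (λ h → ∑ᶠ (finPerm x) (λ g → nFactor x (typeV h) (typeV g) + lFactor x (typeV h) (typeV g))) ∎
    where
    fixed : Symmetry x y → ℕ
    fixed s = ∑ᶠ (finTable x y) (λ ω → 𝟙 (_≟ᶠ_ (finTable x y) (transform s ω) ω))
    card : ∣ finSymmetry x y ∣ᶠ ≡ y ! * (x ! * 2)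
    card = begin
      ∣ finSymmetry x y ∣ᶠ ≡⟨ ∑-1 (elements (finSymmetry x y)) ⟨
      ∑ᶠ (finSymmetry x y) (λ _ → 1) ≡⟨ ∑-fin× (finPerm y) (fin× (finPerm x) finBool) (λ _ → 1) ⟩
      ∑ᶠ (finPerm y) (λ _ → ∑ᶠ (fin× (finPerm x) finBool) (λ _ → 1))
        ≡⟨ ∑-cong (elements (finPerm y)) (λ _ → trans (∑-fin× (finPerm x) finBool (λ _ → 1))
             (trans (∑-const (elements (finPerm x)) 2) (cong (_* 2) (∣finPerm∣ x)))) ⟩
      ∑ᶠ (finPerm y) (λ _ → x ! * 2) ≡⟨ trans (∑-const (elements (finPerm y)) (x ! * 2)) (cong (_* (x ! * 2)) (∣finPerm∣ y)) ⟩
      y ! * (x ! * 2) ∎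

-- Tables and their orbits

module Tables (x : ℕ) where

  private variable
    y : ℕ

  -- Zero is exempt: it is a product in any case, since every product with a factor outside X is
  -- zero.
  Surj : Table x y → Set
  Surj {y = y} ω = ∀ (v : Fin y) → ∃ λ i → lookup ω i ≡ suc v

  surj? : (ω : Table x y) → Dec (Surj ω)
  surj? ω = Fin.all? λ v → Fin.any? λ i → lookup ω i Fin.≟ suc v

  orbits : ∀ y → List (Table x y)
  orbits y = Action.orbits (tableAction x y)

  surjOrbits : ∀ y → List (Table x y)
  surjOrbits y = filter surj? (orbits y)

  infix 4 _∼_
  _∼_ : Table x y → Table x y → Set
  _∼_ {y} = Action._∼_ (tableAction x y)

  ∼? : ∀ y (ω ω′ : Table x y) → Dec (ω ∼ ω′)
  ∼? y = Action._∼?_ (tableAction x y)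

  ∼-refl : (ω : Table x y) → ω ∼ ω
  ∼-refl {y} ω = IsEquivalence.refl (Action.∼-isEquivalence (tableAction x y)) {ω}

  ∼-sym : (ω ω′ : Table x y) → ω ∼ ω′ → ω′ ∼ ω
  ∼-sym {y} ω ω′ = IsEquivalence.sym (Action.∼-isEquivalence (tableAction x y)) {ω} {ω′}

  ∼-trans : (ω ω′ ω″ : Table x y) → ω ∼ ω′ → ω′ ∼ ω″ → ω ∼ ω″
  ∼-trans {y} ω ω′ ω″ = IsEquivalence.trans (Action.∼-isEquivalence (tableAction x y)) {ω} {ω′} {ω″}

  ∼⇒moves : {ω ω′ : Table x y} → ω ∼ ω′ → ∃ λ s → Moves s ω ω′
  ∼⇒moves {ω = ω} {ω′} (s , eq) = s , transform⇒moves s ω ω′ eq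

  moves⇒∼ : {ω ω′ : Table x y} (s : Symmetry x y) → Moves s ω ω′ → ω ∼ ω′
  moves⇒∼ {ω = ω} {ω′} s mv = s , moves⇒transform s ω ω′ mv

  surj-∼ : {ω ω′ : Table x y} → ω ∼ ω′ → Surj ω → Surj ω′
  surj-∼ {y} {ω} {ω′} ω∼ω′ surj v with ∼⇒moves {ω = ω} {ω′} ω∼ω′
  ... | (h , g , ε) , mv with surj (act⁻ h v)
  ...   | i , eq = act (pairPerm g ε) i , trans (mv i) (trans (cong (act (zero ∷ h)) eq) (cong suc (act-act⁻ h v)))

  -- The label left free is the first non-zero one, where `zero ∷ h` extends a permutation `h` of
  -- the other labels.
  widen : Fin (suc y) → Fin (suc (suc y))
  widen zero    = zero
  widen (suc v) = suc (suc v)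

  narrow : Fin (suc (suc y)) → Fin (suc y)
  narrow zero          = zero
  narrow (suc zero)    = zero
  narrow (suc (suc v)) = suc v

  widen-narrow : ∀ (u : Fin (suc (suc y))) → u ≢ suc zero → widen (narrow u) ≡ u
  widen-narrow zero          u≢1 = refl
  widen-narrow (suc zero)    u≢1 = contradiction refl u≢1
  widen-narrow (suc (suc v)) u≢1 = refl

  widen≢1 : ∀ (u : Fin (suc y)) → widen u ≢ suc zero
  widen≢1 zero    ()
  widen≢1 (suc u) ()

  widen-injective : ∀ {u v : Fin (suc y)} → widen u ≡ widen v → u ≡ v
  widen-injective {u = zero}  {zero}  eq   = refl
  widen-injective {u = suc u} {suc v} refl = refl

  embed : Table x y → Table x (suc y)
  embed = Vec.map widen

  embed-¬surj : (ω : Table x y) → ¬ Surj (embed ω)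
  embed-¬surj ω surj = let i , eq = surj zero in widen≢1 _ (trans (sym (Vec.lookup-map i widen ω)) eq)

  embed-∼ : {ω ω′ : Table x y} → ω ∼ ω′ → embed ω ∼ embed ω′
  embed-∼ {y} {ω} {ω′} ω∼ω′ with ∼⇒moves {ω = ω} {ω′} ω∼ω′
  ... | (h , g , ε) , mv = moves⇒∼ {ω = embed ω} {embed ω′} (zero ∷ h , g , ε) λ v → begin
    lookup (embed ω′) (act (pairPerm g ε) v)  ≡⟨ Vec.lookup-map (act (pairPerm g ε) v) widen ω′ ⟩
    widen (lookup ω′ (act (pairPerm g ε) v))  ≡⟨ cong widen (mv v) ⟩
    widen (act (zero ∷ h) (lookup ω v))       ≡⟨ act-widen (lookup ω v) ⟩
    act (zero ∷ zero ∷ h) (widen (lookup ω v)) ≡⟨ cong (act (zero ∷ zero ∷ h)) (Vec.lookup-map v widen ω) ⟨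
    act (zero ∷ zero ∷ h) (lookup (embed ω) v) ∎
    where
    act-widen : ∀ u → widen (act (zero ∷ h) u) ≡ act (zero ∷ zero ∷ h) (widen u)
    act-widen zero    = refl
    act-widen (suc u) = refl

  -- Contracting the cycle of the unused label does not affect used labels.
  embed-∼⁻ : {ω ω′ : Table x y} → embed ω ∼ embed ω′ → ω ∼ ω′
  embed-∼⁻ {y} {ω} {ω′} eω∼eω′ with ∼⇒moves {ω = embed ω} {embed ω′} eω∼eω′
  ... | (j ∷ h , g , ε) , mv = moves⇒∼ {ω = ω} {ω′} (h , g , ε) λ v → widen-injective (begin
    widen (lookup ω′ (act (pairPerm g ε) v))  ≡⟨ Vec.lookup-map (act (pairPerm g ε) v) widen ω′ ⟨
    lookup (embed ω′) (act (pairPerm g ε) v)  ≡⟨ mv v ⟩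
    act (zero ∷ j ∷ h) (lookup (embed ω) v) ≡⟨ cong (act (zero ∷ j ∷ h)) (Vec.lookup-map v widen ω) ⟩
    act (zero ∷ j ∷ h) (widen (lookup ω v)) ≡⟨ act-widen (lookup ω v) (λ eq → widen≢1 _ (trans (sym (Vec.lookup-map (act (pairPerm g ε) v) widen ω′))
                                                   (trans (mv v) (trans (cong (act (zero ∷ j ∷ h)) (Vec.lookup-map v widen ω)) eq)))) ⟩
    widen (act (zero ∷ h) (lookup ω v))       ∎)
    where
    insertBefore-≢0 : ∀ {n} (j : Fin (suc n)) v → insertBefore j v ≢ zero → insertBefore j v ≡ suc v
    insertBefore-≢0 zero    v _   = refl
    insertBefore-≢0 (suc j) v ≢0 with v Fin.≟ j
    ... | yes _ = contradiction refl ≢0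
    ... | no _  = refl
    act-widen : ∀ u → act (zero ∷ j ∷ h) (widen u) ≢ suc zero → act (zero ∷ j ∷ h) (widen u) ≡ widen (act (zero ∷ h) u)
    act-widen zero    _  = refl
    act-widen (suc u) ≢1 = cong suc (insertBefore-≢0 j (act h u) (≢1 ∘ cong suc))

  transposition : Fin n → Fin n → Perm n
  transposition u v = encode (transpose u v)

  act-transposition : (u v : Fin n) → act (transposition u v) ≗ transpose u v
  act-transposition u v = act-encode (transpose u v)
    (λ {a} {b} eq → trans (sym (transpose-inverse v u)) (trans (cong (transpose v u) eq) (transpose-inverse v u)))

  ¬surj⇒embed : (ω : Table x (suc y)) → ¬ Surj ω → ∃ λ ω₀ → ω ∼ embed ω₀
  ¬surj⇒embed {y} ω ¬surj with Fin.¬∀⟶∃¬ (suc y) (λ v → ∃ λ i → lookup ω i ≡ suc v) (λ v → Fin.any? λ i → lookup ω i Fin.≟ suc v) ¬surj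
  ... | v , unused = Vec.map narrow ω′ , s , (begin
    ω′                              ≡⟨ Vec.tabulate∘lookup ω′ ⟨
    Vec.tabulate (lookup ω′) ≡⟨ Vec.tabulate-cong (λ i → trans (cong widen (Vec.lookup-map i narrow ω′)) (widen-narrow _ (unused′ i))) ⟨
    Vec.tabulate (λ i → widen (lookup (Vec.map narrow ω′) i)) ≡⟨ Vec.tabulate-cong (λ i → Vec.lookup-map i widen (Vec.map narrow ω′)) ⟨
    Vec.tabulate (lookup (embed (Vec.map narrow ω′))) ≡⟨ Vec.tabulate∘lookup (embed (Vec.map narrow ω′)) ⟩
    embed (Vec.map narrow ω′)       ∎)
    where
    h : Perm (suc y)
    h = transposition v zero
    s : Symmetry x (suc y)
    s = h , encode id , false
    ω′ : Table x (suc y)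
    ω′ = transform s ω
    act-h : ∀ u → act (zero ∷ h) u ≡ suc zero → u ≡ suc v
    act-h (suc u) eq = cong suc (act-injective h (trans (Fin.suc-injective eq) (sym (trans (act-transposition v zero v) (transpose-i v)))))
      where
      transpose-i : ∀ v → transpose v zero v ≡ zero
      transpose-i v with v Fin.≟ v
      ... | yes _ = refl
      ... | no v≢ = contradiction refl v≢
    unused′ : ∀ i → lookup ω′ i ≢ suc zero
    unused′ i eq = unused (_ , act-h _ (trans (sym (Vec.lookup∘tabulate _ i)) eq))

  -- Pairs of representatives with `r ∼ embed r₀` are counted twice. Each `r₀` has exactly one
  -- partner; each `r` has exactly one if it misses a label and none otherwise.
  surjOrbits-count : ∀ y → length (surjOrbits (suc y)) + length (orbits y) ≡ length (orbits (suc y))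
  surjOrbits-count y = begin
    length (surjOrbits (suc y)) + length (orbits y)
      ≡⟨ cong₂ _+_ (trans (sym (∑-1 (surjOrbits (suc y)))) (trans (∑-filter surj? os) (∑-cong os (λ r → *-identityʳ _)))) ¬surj-count ⟩
    ∑ os (λ r → 𝟙 (surj? r)) + ∑ os (λ r → 𝟙 (¬? (surj? r)))
      ≡⟨ ∑-+ os ⟨
    ∑ os (λ r → 𝟙 (surj? r) + 𝟙 (¬? (surj? r)))
      ≡⟨ ∑-cong os (λ r → 𝟙+𝟙¬ (surj? r)) ⟩
    ∑ os (λ _ → 1)
      ≡⟨ ∑-1 os ⟩
    length os ∎
    where
    os : List (Table x (suc y))
    os = orbits (suc y)
    row : ∀ r → (d : Dec (Surj r)) → ∑ (orbits y) (λ r₀ → 𝟙 (∼? (suc y) r (embed r₀))) ≡ 𝟙 (¬? d)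
    row r (yes surj) = ∑-zero (orbits y) (λ r₀ → 𝟙-no (∼? (suc y) r (embed r₀)) (λ r∼ → embed-¬surj r₀ (surj-∼ {ω = r} {embed r₀} r∼ surj)))
    row r (no ¬surj) with ¬surj⇒embed r ¬surj
    ... | ω₀ , r∼ = trans
      (∑-cong (orbits y) (λ r₀ → 𝟙-⇔
        (λ r∼e → embed-∼⁻ {ω = r₀} {ω₀} (∼-trans (embed r₀) r (embed ω₀) (∼-sym r (embed r₀) r∼e) r∼))
        (λ r₀∼ → ∼-trans r (embed ω₀) (embed r₀) r∼ (embed-∼ {ω = ω₀} {r₀} (∼-sym r₀ ω₀ r₀∼)))
        (∼? (suc y) r (embed r₀)) (∼? y r₀ ω₀)))
      (Action.orbits-once (tableAction x y) ω₀)
    ¬surj-count : length (orbits y) ≡ ∑ os (λ r → 𝟙 (¬? (surj? r)))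
    ¬surj-count = begin
      length (orbits y)                                     ≡⟨ ∑-1 (orbits y) ⟨
      ∑ (orbits y) (λ _ → 1) ≡⟨ ∑-cong (orbits y) (λ r₀ → Action.orbits-once (tableAction x (suc y)) (embed r₀)) ⟨
      ∑ (orbits y) (λ r₀ → ∑ os (λ r → 𝟙 (∼? (suc y) r (embed r₀)))) ≡⟨ ∑-swap (orbits y) os _ ⟩
      ∑ os (λ r → ∑ (orbits y) (λ r₀ → 𝟙 (∼? (suc y) r (embed r₀)))) ≡⟨ ∑-cong os (λ r → row r (surj? r)) ⟩
      ∑ os (λ r → 𝟙 (¬? (surj? r)))                           ∎

  surjOrbits-once : (ω : Table x y) → Surj ω → ∑ (surjOrbits y) (λ r → 𝟙 (∼? y r ω)) ≡ 1
  surjOrbits-once {y} ω surj = begin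
    ∑ (surjOrbits y) (λ r → 𝟙 (∼? y r ω))
      ≡⟨ ∑-filter surj? (orbits y) ⟩
    ∑ (orbits y) (λ r → 𝟙 (surj? r) * 𝟙 (∼? y r ω))
      ≡⟨ ∑-cong (orbits y) (λ r → trans (*-comm (𝟙 (surj? r)) _) (trans
           (𝟙*-cong (∼? y r ω) (λ r∼ω → 𝟙-yes (surj? r) (surj-∼ {ω = ω} {r} (∼-sym r ω r∼ω) surj))) (*-identityʳ _))) ⟩
    ∑ (orbits y) (λ r → 𝟙 (∼? y r ω))
      ≡⟨ Action.orbits-once (tableAction x y) ω ⟩
    1 ∎

-- Rational sums

open import Data.Integer.Base as ℤ using (+_)
import Data.Integer.Properties as ℤ
import Data.Rational.Base as ℚ
open import Data.Rational.Base using (ℚ; 0ℚ; ½; _/_; _-_)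
import Data.Rational.Properties as ℚ
open import Data.Rational.Solver using (module +-*-Solver)
import Data.Rational.Unnormalised.Base as ℚᵘ
import Data.Rational.Unnormalised.Properties as ℚᵘ

-- Outside this block, `⟦_⟧` and `1/` are known only through the laws proved here.
opaque
  ⟦_⟧ : ℕ → ℚ
  ⟦ n ⟧ = + n ℚ./ 1

  ⟦⟧-def : ∀ n → + n ℚ./ 1 ≡ ⟦ n ⟧
  ⟦⟧-def n = refl

  1/ : ∀ d .{{_ : NonZero d}} → ℚ
  1/ d = + 1 ℚ./ d

  1/-def : ∀ d .{{_ : NonZero d}} → + 1 ℚ./ d ≡ 1/ d
  1/-def d = refl

  toℚᵘ-⟦⟧ : ∀ n → ℚ.toℚᵘ ⟦ n ⟧ ℚᵘ.≃ ℚᵘ.mkℚᵘ (+ n) 0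
  toℚᵘ-⟦⟧ n = ℚ.toℚᵘ-fromℚᵘ (ℚᵘ.mkℚᵘ (+ n) 0)

  ⟦⟧-+ : ∀ m n → ⟦ m + n ⟧ ≡ ⟦ m ⟧ ℚ.+ ⟦ n ⟧
  ⟦⟧-+ m n = ℚ.toℚᵘ-injective (ℚᵘ.≃-trans (toℚᵘ-⟦⟧ (m + n)) (ℚᵘ.≃-trans
    (ℚᵘ.*≡* (cong (ℤ._* + 1) (sym (cong₂ ℤ._+_ (ℤ.*-identityʳ (+ m)) (ℤ.*-identityʳ (+ n))))))
    (ℚᵘ.≃-sym (ℚᵘ.≃-trans (ℚ.toℚᵘ-homo-+ ⟦ m ⟧ ⟦ n ⟧) (ℚᵘ.+-cong (toℚᵘ-⟦⟧ m) (toℚᵘ-⟦⟧ n))))))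

  ⟦⟧-* : ∀ m n → ⟦ m * n ⟧ ≡ ⟦ m ⟧ ℚ.* ⟦ n ⟧
  ⟦⟧-* m n = ℚ.toℚᵘ-injective (ℚᵘ.≃-trans (toℚᵘ-⟦⟧ (m * n)) (ℚᵘ.≃-trans
    (ℚᵘ.*≡* (cong (ℤ._* + 1) (ℤ.pos-* m n)))
    (ℚᵘ.≃-sym (ℚᵘ.≃-trans (ℚ.toℚᵘ-homo-* ⟦ m ⟧ ⟦ n ⟧) (ℚᵘ.*-cong (toℚᵘ-⟦⟧ m) (toℚᵘ-⟦⟧ n))))))

  ⟦0⟧≡0 : 0ℚ ≡ ⟦ 0 ⟧
  ⟦0⟧≡0 = refl

  ½*2≡1 : ½ ℚ.* ⟦ 2 ⟧ ≡ ℚ.1ℚ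
  ½*2≡1 = refl

  1/-* : ∀ d .{{_ : NonZero d}} → (1/ d) ℚ.* ⟦ d ⟧ ≡ ℚ.1ℚ
  1/-* (suc d) = ℚ.toℚᵘ-injective (ℚᵘ.≃-trans (ℚ.toℚᵘ-homo-* (+ 1 ℚ./ suc d) ⟦ suc d ⟧)
    (ℚᵘ.≃-trans (ℚᵘ.*-cong (ℚ.toℚᵘ-fromℚᵘ (ℚᵘ.mkℚᵘ (+ 1) d)) (toℚᵘ-⟦⟧ (suc d)))
      (ℚᵘ.*≡* (trans (ℤ.*-identityʳ (+ 1 ℤ.* + suc d)) (cong (λ m → + 1 ℤ.* + m) (sym (*-identityʳ (suc d))))))))

⟦⟧-cancel : ∀ d .{{_ : NonZero d}} {p q} → ⟦ d ⟧ ℚ.* p ≡ ⟦ d ⟧ ℚ.* q → p ≡ q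
⟦⟧-cancel d {p} {q} eq = begin
  p                                 ≡⟨ undo p ⟨
  (1/ d) ℚ.* (⟦ d ⟧ ℚ.* p)     ≡⟨ cong ((1/ d) ℚ.*_) eq ⟩
  (1/ d) ℚ.* (⟦ d ⟧ ℚ.* q)     ≡⟨ undo q ⟩
  q                                 ∎
  where
  undo : ∀ p → (1/ d) ℚ.* (⟦ d ⟧ ℚ.* p) ≡ p
  undo p = trans (sym (ℚ.*-assoc (1/ d) ⟦ d ⟧ p)) (trans (cong (ℚ._* p) (1/-* d)) (ℚ.*-identityˡ p))

Σℚ-cong-∈ : (xs : List A) {f g : A → ℚ} → (∀ x → x ∈ xs → f x ≡ g x) → Σℚ xs f ≡ Σℚ xs g
Σℚ-cong-∈ []       eq = refl
Σℚ-cong-∈ (x ∷ xs) eq = cong₂ ℚ._+_ (eq x (here refl)) (Σℚ-cong-∈ xs (λ y → eq y ∘ there))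

Σℚ-*ˡ : (xs : List A) → ∀ p (f : A → ℚ) → p ℚ.* Σℚ xs f ≡ Σℚ xs (λ x → p ℚ.* f x)
Σℚ-*ˡ []       p f = ℚ.*-zeroʳ p
Σℚ-*ˡ (x ∷ xs) p f = trans (ℚ.*-distribˡ-+ p (f x) (Σℚ xs f)) (cong (p ℚ.* f x ℚ.+_) (Σℚ-*ˡ xs p f))

Σℚ-⟦⟧ : (xs : List A) (f : A → ℕ) → Σℚ xs (λ x → ⟦ f x ⟧) ≡ ⟦ ∑ xs f ⟧
Σℚ-⟦⟧ []       f = ⟦0⟧≡0
Σℚ-⟦⟧ (x ∷ xs) f = trans (cong (⟦ f x ⟧ ℚ.+_) (Σℚ-⟦⟧ xs f)) (sym (⟦⟧-+ (f x) (∑ xs f)))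

-- Multiplied by y! x!, the weight 1 / (z j * z k) becomes the number of pairs of
-- permutations of types j and k.
weightedSum-perms : ∀ p q f → let y = q ∸ 1 ; x = p ∸ q in
  ⟦ y ! * x ! ⟧ ℚ.* weightedSum p q f ≡ ⟦ ∑ᶠ (finPerm y) (λ h → ∑ᶠ (finPerm x) (λ g → f (typeV h) (typeV g))) ⟧
weightedSum-perms p q f = begin
  ⟦ y ! * x ! ⟧ ℚ.* weightedSum p q f
    ≡⟨ cong (⟦ y ! * x ! ⟧ ℚ.*_) (Σℚ-cong-∈ (partitions y) (λ j _ → Σℚ-cong-∈ (partitions x) (λ k _ →
         cong₂ ℚ._*_ (1/-def (z j * z k) {{zz≢0 j k}}) (⟦⟧-def (f j k))))) ⟩
  ⟦ y ! * x ! ⟧ ℚ.* Σℚ (partitions y) (λ j → Σℚ (partitions x) (λ k → w j k ℚ.* ⟦ f j k ⟧))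
    ≡⟨ Σℚ-*ˡ (partitions y) ⟦ y ! * x ! ⟧ (λ j → Σℚ (partitions x) (λ k → w j k ℚ.* ⟦ f j k ⟧)) ⟩
  Σℚ (partitions y) (λ j → ⟦ y ! * x ! ⟧ ℚ.* Σℚ (partitions x) (λ k → w j k ℚ.* ⟦ f j k ⟧))
    ≡⟨ Σℚ-cong-∈ (partitions y) (λ j j∈ → begin
         ⟦ y ! * x ! ⟧ ℚ.* Σℚ (partitions x) (λ k → w j k ℚ.* ⟦ f j k ⟧)
           ≡⟨ Σℚ-*ˡ (partitions x) ⟦ y ! * x ! ⟧ (λ k → w j k ℚ.* ⟦ f j k ⟧) ⟩
         Σℚ (partitions x) (λ k → ⟦ y ! * x ! ⟧ ℚ.* (w j k ℚ.* ⟦ f j k ⟧))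
           ≡⟨ Σℚ-cong-∈ (partitions x) (λ k k∈ → term j k (weight≡ y j∈) (weight≡ x k∈)) ⟩
         Σℚ (partitions x) (λ k → ⟦ ofType j * (ofType k * f j k) ⟧)
           ≡⟨ Σℚ-⟦⟧ (partitions x) (λ k → ofType j * (ofType k * f j k)) ⟩
         ⟦ ∑ (partitions x) (λ k → ofType j * (ofType k * f j k)) ⟧
           ≡⟨ cong ⟦_⟧ (∑-*ˡ (partitions x) (ofType j)) ⟩
         ⟦ ofType j * ∑ (partitions x) (λ k → ofType k * f j k) ⟧ ∎) ⟩
  Σℚ (partitions y) (λ j → ⟦ ofType j * ∑ (partitions x) (λ k → ofType k * f j k) ⟧)
    ≡⟨ Σℚ-⟦⟧ (partitions y) (λ j → ofType j * ∑ (partitions x) (λ k → ofType k * f j k)) ⟩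
  ⟦ ∑ (partitions y) (λ j → ofType j * ∑ (partitions x) (λ k → ofType k * f j k)) ⟧
    ≡⟨ cong ⟦_⟧ (∑-by-type y (λ j → ∑ (partitions x) (λ k → ofType k * f j k))) ⟨
  ⟦ ∑ᶠ (finPerm y) (λ h → ∑ (partitions x) (λ k → ofType k * f (typeV h) k)) ⟧
    ≡⟨ cong ⟦_⟧ (∑-cong (elements (finPerm y)) (λ h → ∑-by-type x (f (typeV h)))) ⟨
  ⟦ ∑ᶠ (finPerm y) (λ h → ∑ᶠ (finPerm x) (λ g → f (typeV h) (typeV g))) ⟧ ∎
  where
  y x : ℕ
  y = q ∸ 1
  x = p ∸ q
  zz≢0 : ∀ (j : Vec ℕ y) (k : Vec ℕ x) → NonZero (z j * z k)
  zz≢0 j k = m*n≢0 (z j) (z k) {{z≢0 j}} {{z≢0 k}}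
  w : Vec ℕ y → Vec ℕ x → ℚ
  w j k = 1/ (z j * z k) {{zz≢0 j k}}
  weight≡ : ∀ n {j : Vec ℕ n} → j ∈ partitions n → weight j ≡ n
  weight≡ n j∈ = proj₂ (∈-filter⁻ (λ j → weight j ≟ n) {xs = vectors n n} j∈)
  term : ∀ j k → weight j ≡ y → weight k ≡ x →
         ⟦ y ! * x ! ⟧ ℚ.* (w j k ℚ.* ⟦ f j k ⟧) ≡ ⟦ ofType j * (ofType k * f j k) ⟧
  term j k wj wk = begin
    ⟦ y ! * x ! ⟧ ℚ.* (w j k ℚ.* ⟦ f j k ⟧)
      ≡⟨ ℚ.*-assoc ⟦ y ! * x ! ⟧ (w j k) ⟦ f j k ⟧ ⟨
    ⟦ y ! * x ! ⟧ ℚ.* w j k ℚ.* ⟦ f j k ⟧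
      ≡⟨ cong (λ m → ⟦ m ⟧ ℚ.* w j k ℚ.* ⟦ f j k ⟧) (trans (cong₂ _*_ (sym (ofType-z j wj)) (sym (ofType-z k wk)))
           (arith (ofType j) (z j) (ofType k) (z k))) ⟩
    ⟦ ofType j * ofType k * (z j * z k) ⟧ ℚ.* w j k ℚ.* ⟦ f j k ⟧
      ≡⟨ cong (ℚ._* ⟦ f j k ⟧) (begin
           ⟦ ofType j * ofType k * (z j * z k) ⟧ ℚ.* w j k ≡⟨ cong (ℚ._* w j k) (⟦⟧-* (ofType j * ofType k) (z j * z k)) ⟩
           ⟦ ofType j * ofType k ⟧ ℚ.* ⟦ z j * z k ⟧ ℚ.* w j k ≡⟨ ℚ.*-assoc ⟦ ofType j * ofType k ⟧ ⟦ z j * z k ⟧ (w j k) ⟩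
           ⟦ ofType j * ofType k ⟧ ℚ.* (⟦ z j * z k ⟧ ℚ.* w j k) ≡⟨ cong (⟦ ofType j * ofType k ⟧ ℚ.*_) (trans (ℚ.*-comm ⟦ z j * z k ⟧ (w j k))
                                                                      (1/-* (z j * z k) {{zz≢0 j k}})) ⟩
           ⟦ ofType j * ofType k ⟧ ℚ.* ℚ.1ℚ ≡⟨ ℚ.*-identityʳ ⟦ ofType j * ofType k ⟧ ⟩
           ⟦ ofType j * ofType k ⟧                                  ∎) ⟩
    ⟦ ofType j * ofType k ⟧ ℚ.* ⟦ f j k ⟧
      ≡⟨ ⟦⟧-* (ofType j * ofType k) (f j k) ⟨
    ⟦ ofType j * ofType k * f j k ⟧
      ≡⟨ cong ⟦_⟧ (*-assoc (ofType j) (ofType k) (f j k)) ⟩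
    ⟦ ofType j * (ofType k * f j k) ⟧ ∎
    where
    arith : ∀ a b c d → a * b * (c * d) ≡ a * c * (b * d)
    arith = solve-∀

-- Multiplied by y! x!, the two weighted sums become Burnside's sums for the two values of the flag.
-- The group has order 2 y! x!, and the remaining 2 is absorbed by the ½ in `L`.
L≡orbits : ∀ p q → L p q ≡ ⟦ length (Tables.orbits (p ∸ q) (q ∸ 1)) ⟧
L≡orbits p q = ⟦⟧-cancel D {{m*n≢0 (y !) (x !) {{y !≢0}} {{x !≢0}}}} (begin
  ⟦ D ⟧ ℚ.* L p q
    ≡⟨⟩
  ⟦ D ⟧ ℚ.* (½ ℚ.* N′ ℚ.+ ½ ℚ.* L′)
    ≡⟨ cong (⟦ D ⟧ ℚ.*_) (ℚ.*-distribˡ-+ ½ N′ L′) ⟨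
  ⟦ D ⟧ ℚ.* (½ ℚ.* (N′ ℚ.+ L′))
    ≡⟨ x∙yz≈y∙xz ⟦ D ⟧ ½ (N′ ℚ.+ L′) ⟩
  ½ ℚ.* (⟦ D ⟧ ℚ.* (N′ ℚ.+ L′))
    ≡⟨ cong (½ ℚ.*_) (begin
         ⟦ D ⟧ ℚ.* (N′ ℚ.+ L′)           ≡⟨ ℚ.*-distribˡ-+ ⟦ D ⟧ N′ L′ ⟩
         ⟦ D ⟧ ℚ.* N′ ℚ.+ ⟦ D ⟧ ℚ.* L′ ≡⟨ cong₂ ℚ._+_ (weightedSum-perms p q (nFactor x)) (weightedSum-perms p q (lFactor x)) ⟩
         ⟦ ∑ᶠ (finPerm y) (λ h → ∑ᶠ (finPerm x) (λ g → nFactor x (typeV h) (typeV g))) ⟧ ℚ.+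
           ⟦ ∑ᶠ (finPerm y) (λ h → ∑ᶠ (finPerm x) (λ g → lFactor x (typeV h) (typeV g))) ⟧
                                         ≡⟨ ⟦⟧-+ _ _ ⟨
         ⟦ ∑ᶠ (finPerm y) (λ h → ∑ᶠ (finPerm x) (λ g → nFactor x (typeV h) (typeV g))) +
           ∑ᶠ (finPerm y) (λ h → ∑ᶠ (finPerm x) (λ g → lFactor x (typeV h) (typeV g))) ⟧
                                         ≡⟨ cong ⟦_⟧ (trans (sym (∑-+ (elements (finPerm y))))
                                              (∑-cong (elements (finPerm y)) (λ h → sym (∑-+ (elements (finPerm x)))))) ⟩
         ⟦ ∑ᶠ (finPerm y) (λ h → ∑ᶠ (finPerm x) (λ g → nFactor x (typeV h) (typeV g) + lFactor x (typeV h) (typeV g))) ⟧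
                                         ≡⟨ cong ⟦_⟧ (orbit-count x y) ⟨
         ⟦ o * (y ! * (x ! * 2)) ⟧       ≡⟨ cong ⟦_⟧ (arith o (y !) (x !)) ⟩
         ⟦ 2 * (D * o) ⟧                 ≡⟨ trans (⟦⟧-* 2 (D * o)) (cong (⟦ 2 ⟧ ℚ.*_) (⟦⟧-* D o)) ⟩
         ⟦ 2 ⟧ ℚ.* (⟦ D ⟧ ℚ.* ⟦ o ⟧)     ∎) ⟩
  ½ ℚ.* (⟦ 2 ⟧ ℚ.* (⟦ D ⟧ ℚ.* ⟦ o ⟧))
    ≡⟨ trans (sym (ℚ.*-assoc ½ ⟦ 2 ⟧ (⟦ D ⟧ ℚ.* ⟦ o ⟧))) (trans (cong (ℚ._* (⟦ D ⟧ ℚ.* ⟦ o ⟧)) ½*2≡1) (ℚ.*-identityˡ (⟦ D ⟧ ℚ.* ⟦ o ⟧))) ⟩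
  ⟦ D ⟧ ℚ.* ⟦ o ⟧ ∎)
  where
  open CommutativeSemigroupProperties (CommutativeMonoid.commutativeSemigroup ℚ.*-1-commutativeMonoid) using (x∙yz≈y∙xz)
  y x D o : ℕ
  y = q ∸ 1
  x = p ∸ q
  D = y ! * x !
  o = length (Tables.orbits x y)
  N′ L′ : ℚ
  N′ = N p q
  L′ = weightedSum p q (lFactor x)
  arith : ∀ a b c → a * (b * (c * 2)) ≡ 2 * (b * c * a)
  arith = solve-∀

-- Lowering n and m together keeps x = n - m, also with truncated subtraction, and lowers the number
-- of labels by one; so `surjOrbits-count` applies.
L-L≡surjOrbits : ∀ n i → L n (2 + i) ℚ.- L (n ∸ 1) (1 + i) ≡ ⟦ length (Tables.surjOrbits (n ∸ (2 + i)) (1 + i)) ⟧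
L-L≡surjOrbits n i = begin
  L n (2 + i) ℚ.- L (n ∸ 1) (1 + i)
    ≡⟨ cong₂ ℚ._-_ (L≡orbits n (2 + i)) (trans (L≡orbits (n ∸ 1) (1 + i))
         (cong (λ x → ⟦ length (Tables.orbits x i) ⟧) (∸-+-assoc n 1 (suc i)))) ⟩
  ⟦ length (Tables.orbits x (suc i)) ⟧ ℚ.- o
    ≡⟨ cong (λ m → ⟦ m ⟧ ℚ.- o) (Tables.surjOrbits-count x i) ⟨
  ⟦ length (Tables.surjOrbits x (suc i)) + length (Tables.orbits x i) ⟧ ℚ.- o
    ≡⟨ cong (ℚ._- o) (⟦⟧-+ s (length (Tables.orbits x i))) ⟩
  ⟦ s ⟧ ℚ.+ o ℚ.- o
    ≡⟨ trans (ℚ.+-assoc ⟦ s ⟧ o (ℚ.- o)) (trans (cong (⟦ s ⟧ ℚ.+_) (ℚ.+-inverseʳ o)) (ℚ.+-identityʳ ⟦ s ⟧)) ⟩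
  ⟦ s ⟧ ∎
  where
  x s : ℕ
  x = n ∸ (2 + i)
  s = length (Tables.surjOrbits x (suc i))
  o : ℚ
  o = ⟦ length (Tables.orbits x i) ⟧

-- Semigroups and tables

module _ {x y : ℕ} (ω : Table x y) where

  infixl 7 _·_
  _·_ : Fin x ⊎ Fin (suc y) → Fin x ⊎ Fin (suc y) → Fin x ⊎ Fin (suc y)
  inj₁ a · inj₁ b = inj₂ (lookup ω (combine a b))
  inj₁ _ · inj₂ _ = inj₂ zero
  inj₂ _ · _      = inj₂ zero

  ·-inj₂ : ∀ u v → u · inj₂ v ≡ inj₂ zero
  ·-inj₂ (inj₁ _) v = refl
  ·-inj₂ (inj₂ _) v = refl

  product-inj₂ : ∀ u v → ∃ λ w → u · v ≡ inj₂ w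
  product-inj₂ (inj₁ a) (inj₁ b) = _ , refl
  product-inj₂ (inj₁ _) (inj₂ _) = _ , refl
  product-inj₂ (inj₂ _) _        = _ , refl

  ·-·≡0 : ∀ t u v → t · (u · v) ≡ inj₂ zero
  ·-·≡0 t u v with product-inj₂ u v
  ... | w , eq = trans (cong (t ·_) eq) (·-inj₂ t w)

  product± : Bool → Fin x ⊎ Fin (suc y) → Fin x ⊎ Fin (suc y) → Fin x ⊎ Fin (suc y)
  product± false u v = u · v
  product± true  u v = v · u

  product±-inj₂ : ∀ ε u v → ∃ λ w → product± ε u v ≡ inj₂ w
  product±-inj₂ false u v = product-inj₂ u v
  product±-inj₂ true  u v = product-inj₂ v u

  product±-zero : ∀ ε v → product± ε (inj₂ v) (inj₂ v) ≡ inj₂ zero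
  product±-zero false v = refl
  product±-zero true  v = refl

  ·-assoc : ∀ t u v → (t · u) · v ≡ t · (u · v)
  ·-assoc t u v with product-inj₂ t u
  ... | w , eq = trans (cong (_· v) eq) (sym (·-·≡0 t u v))

  tableSemigroup : Semigroup 0ℓ 0ℓ
  tableSemigroup = record
    { Carrier = Fin x ⊎ Fin (suc y)
    ; _≈_     = _≡_
    ; _∙_     = _·_
    ; isSemigroup = record
      { isMagma = record { isEquivalence = isEquivalence ; ∙-cong = cong₂ _·_ }
      ; assoc   = ·-assoc
      }
    }

module _ {x : ℕ} where

  open Tables x

  surj⇒product : ∀ {y} (ω : Table x y) → Surj ω → ∀ v → ∃ λ a → ∃ λ b → _·_ {x} {y} ω a b ≡ inj₂ v
  surj⇒product ω surj zero    = inj₂ zero , inj₂ zero , refl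
  surj⇒product ω surj (suc v) with surj v
  ... | i , eq = inj₁ (proj₁ (remQuot {x} x i)) , inj₁ (proj₂ (remQuot {x} x i)) ,
    cong inj₂ (trans (cong (lookup ω) (Fin.combine-remQuot {x} x i)) eq)

  -- There is at least one label because |S²| > 1 demands a non-zero product; with the zero, S² has
  -- `suc (suc y)` elements.
  nilpotentSemigroup : ∀ {y n} (ω : Table x (suc y)) → Surj ω → x + suc (suc y) ≡ n → NilpotentSemigroup n
  nilpotentSemigroup {y} ω surj x+y≡n = record
    { semigroup = tableSemigroup {x} {suc y} ω
    ; order     = order x+y≡n
    ; nilpotent = cube , suc (suc y) , square , s≤s (s≤s z≤n)
    }
    where
    order : ∀ {n} → x + suc (suc y) ≡ n → ∣ setoid (Fin x ⊎ Fin (suc (suc y))) ∣≡ n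
    order refl = record
      { to        = splitAt x
      ; cong      = cong (splitAt x)
      ; bijective = (λ {i} {j} eq → trans (sym (Fin.join-splitAt x _ i)) (trans (cong (join x _) eq) (Fin.join-splitAt x _ j)))
                  , (λ u → join x _ u , λ { refl → Fin.splitAt-join x _ u })
      }
    cube : ∣ tableSemigroup {x} {suc y} ω ^1+ 2 ∣≡ 1
    cube = record
      { to        = λ _ → inj₂ zero , inj₂ zero ∷ inj₂ zero ∷ inj₂ zero ∷ [] , refl
      ; cong      = λ _ → refl
      ; bijective = (λ { {zero} {zero} _ → refl })
                  , (λ { (e , (t ∷ u ∷ v ∷ []) , eq) → zero , λ _ → trans (sym (·-·≡0 {x} {suc y} ω t u v)) eq })
      }
    square : ∣ tableSemigroup {x} {suc y} ω ^1+ 1 ∣≡ suc (suc y)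
    square = record
      { to        = λ v → let a , b , eq = surj⇒product ω surj v in inj₂ v , a ∷ b ∷ [] , eq
      ; cong      = cong inj₂
      ; bijective = inj₂-injective
                  , (λ { (e , (u ∷ v ∷ []) , eq) → let w , eq′ = product-inj₂ {x} {suc y} ω u v in
                         w , λ { refl → trans (sym eq′) eq } })
      }

-- An isomorphism (ε = false) or anti-isomorphism (ε = true) of table semigroups.
record TableIso (ε : Bool) {x y x′ y′ : ℕ} (ω : Table x y) (ω′ : Table x′ y′) : Set where
  field
    f         : Fin x ⊎ Fin (suc y) → Fin x′ ⊎ Fin (suc y′)
    injective : ∀ {u v} → f u ≡ f v → u ≡ v
    f⁻        : Fin x′ ⊎ Fin (suc y′) → Fin x ⊎ Fin (suc y)
    f-f⁻      : ∀ u → f (f⁻ u) ≡ u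
    homo      : ∀ u v → f (_·_ ω u v) ≡ product± ω′ ε (f u) (f v)

  homo-inj₂ : ∀ u v → ∃ λ w → f (_·_ ω u v) ≡ inj₂ w
  homo-inj₂ u v = let w , eq = product±-inj₂ ω′ ε (f u) (f v) in w , trans (homo u v) eq

  f-zero : f (inj₂ zero) ≡ inj₂ zero
  f-zero = let w , eq = homo-inj₂ (inj₂ zero) (inj₂ zero) in
    trans (homo (inj₂ zero) (inj₂ zero)) (trans (cong (λ u → product± ω′ ε u u) eq) (product±-zero ω′ ε w))

  f⁻-f : ∀ u → f⁻ (f u) ≡ u
  f⁻-f u = injective (f-f⁻ (f u))

TableIso-sym : ∀ {ε x y x′ y′} {ω : Table x y} {ω′ : Table x′ y′} → TableIso ε {x} {y} {x′} {y′} ω ω′ → TableIso ε {x′} {y′} {x} {y} ω′ ω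
TableIso-sym {ε} {x} {y} {x′} {y′} {ω} {ω′} F = record
  { f         = f⁻
  ; injective = λ {u} {v} eq → trans (sym (f-f⁻ u)) (trans (cong f eq) (f-f⁻ v))
  ; f⁻        = f
  ; f-f⁻      = f⁻-f
  ; homo      = λ u v → injective (trans (f-f⁻ _) (homo′ ε homo u v))
  }
  where
  open TableIso F
  homo′ : ∀ ε → (∀ u v → f (_·_ ω u v) ≡ product± ω′ ε (f u) (f v)) →
          ∀ u v → _·_ ω′ u v ≡ f (product± ω ε (f⁻ u) (f⁻ v))
  homo′ true  homo u v = sym (trans (homo (f⁻ v) (f⁻ u)) (cong₂ (_·_ ω′) (f-f⁻ u) (f-f⁻ v)))
  homo′ false homo u v = sym (trans (homo (f⁻ u) (f⁻ v)) (cong₂ (_·_ ω′) (f-f⁻ u) (f-f⁻ v)))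

-- In a surjective table every element of `inj₂` is a product, and products go to products.
TableIso-inj₂ : ∀ {ε x y x′ y′} {ω : Table x y} {ω′ : Table x′ y′} (F : TableIso ε {x} {y} {x′} {y′} ω ω′) →
  Tables.Surj x ω → ∀ v → ∃ λ w → TableIso.f F (inj₂ v) ≡ inj₂ w
TableIso-inj₂ {x = x} {ω = ω} F surj v with surj⇒product {x} ω surj v
... | a , b , eq = let w , eq′ = TableIso.homo-inj₂ F a b in w , trans (cong (TableIso.f F) (sym eq)) eq′

-- Were the image in `inj₂`, the inverse would bring it back to `inj₂`.
TableIso-inj₁ : ∀ {ε x y x′ y′} {ω : Table x y} {ω′ : Table x′ y′} (F : TableIso ε {x} {y} {x′} {y′} ω ω′) →
  Tables.Surj x′ ω′ → ∀ a → ∃ λ b → TableIso.f F (inj₁ a) ≡ inj₁ b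
TableIso-inj₁ {ε} {x} {y} {x′} {y′} {ω} {ω′} F surj′ a with TableIso.f F (inj₁ a) in eq
... | inj₁ b = b , refl
... | inj₂ w with TableIso-inj₂ (TableIso-sym {ω = ω} {ω′ = ω′} F) surj′ w
...   | v , eq′ with trans (sym (TableIso.f⁻-f F (inj₁ a))) (trans (cong (TableIso.f⁻ F) eq) eq′)
...     | ()

-- Non-products are mapped injectively to non-products; together with the inverse this makes `x` an
-- invariant.
TableIso⇒≤ : ∀ {ε x y x′ y′} {ω : Table x y} {ω′ : Table x′ y′} → TableIso ε {x} {y} {x′} {y′} ω ω′ → Tables.Surj x′ ω′ → x ≤ x′
TableIso⇒≤ {x = x} {x′ = x′} {ω = ω} {ω′} F surj′ = Fin.injective⇒≤ {f = proj₁ ∘ inj} (λ {a} {b} eq → inj₁-injective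
  (TableIso.injective F (trans (proj₂ (inj a)) (trans (cong inj₁ eq) (sym (proj₂ (inj b)))))))
  where
  inj : ∀ a → ∃ λ b → TableIso.f F (inj₁ a) ≡ inj₁ b
  inj = TableIso-inj₁ {ω = ω} {ω′} F surj′

-- The map restricts to a permutation of X and, fixing zero, to one of the labels; with its kind as
-- the flag these form a symmetry.
TableIso⇒∼ : ∀ {ε x y} {ω ω′ : Table x y} → TableIso ε {x} {y} {x} {y} ω ω′ → Tables.Surj x ω → Tables.Surj x ω′ → Tables._∼_ x ω ω′
TableIso⇒∼ {ε} {x} {y} {ω} {ω′} F surj surj′ = Tables.moves⇒∼ x {ω = ω} {ω′} (encode h , encode g , ε) λ v →
  trans (cong (lookup ω′) (act-pairPerm′ {x} {y} (encode g) ε v)) (trans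
    (moves (proj₁ (remQuot {x} x v)) (proj₂ (remQuot {x} x v)))
    (cong (act (zero ∷ encode h) ∘ lookup ω) (Fin.combine-remQuot {x} x v)))
  where
  open TableIso F
  f₁ : ∀ a → ∃ λ b → f (inj₁ a) ≡ inj₁ b
  f₁ = TableIso-inj₁ {ω = ω} {ω′} F surj′
  f₂ : ∀ v → ∃ λ w → f (inj₂ v) ≡ inj₂ w
  f₂ = TableIso-inj₂ {ω = ω} {ω′} F surj
  g : Fin x → Fin x
  g a = proj₁ (f₁ a)
  g-injective : ∀ {a b} → g a ≡ g b → a ≡ b
  g-injective {a} {b} eq = inj₁-injective (injective (trans (proj₂ (f₁ a)) (trans (cong inj₁ eq) (sym (proj₂ (f₁ b))))))
  f₂-suc : ∀ v → ∃ λ w → f (inj₂ (suc v)) ≡ inj₂ (suc w)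
  f₂-suc v with f₂ (suc v)
  ... | suc w , eq = w , eq
  ... | zero  , eq with injective (trans eq (sym f-zero))
  ...   | ()
  h : Fin y → Fin y
  h v = proj₁ (f₂-suc v)
  h-injective : ∀ {a b} → h a ≡ h b → a ≡ b
  h-injective {a} {b} eq = Fin.suc-injective (inj₂-injective
    (injective (trans (proj₂ (f₂-suc a)) (trans (cong (inj₂ ∘ suc) eq) (sym (proj₂ (f₂-suc b)))))))
  f-inj₂ : ∀ v → f (inj₂ v) ≡ inj₂ (act (zero ∷ encode h) v)
  f-inj₂ zero    = f-zero
  f-inj₂ (suc v) = trans (proj₂ (f₂-suc v)) (cong (inj₂ ∘ suc) (sym (act-encode h h-injective v)))
  f-inj₁ : ∀ a → f (inj₁ a) ≡ inj₁ (act (encode g) a)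
  f-inj₁ a = trans (proj₂ (f₁ a)) (cong inj₁ (sym (act-encode g g-injective a)))
  moves : ∀ a b → lookup ω′ (uncurry′ combine (pairMap (encode g) ε (a , b))) ≡
                  act (zero ∷ encode h) (lookup ω (combine a b))
  moves a b = inj₂-injective (sym (begin
    inj₂ (act (zero ∷ encode h) (lookup ω (combine a b)))  ≡⟨ f-inj₂ (lookup ω (combine a b)) ⟨
    f (inj₂ (lookup ω (combine a b)))                      ≡⟨ homo (inj₁ a) (inj₁ b) ⟩
    product± ω′ ε (f (inj₁ a)) (f (inj₁ b)) ≡⟨ cong₂ (product± ω′ ε) (f-inj₁ a) (f-inj₁ b) ⟩
    product± ω′ ε (inj₁ (act (encode g) a)) (inj₁ (act (encode g) b))
      ≡⟨ product±-inj₁ ε ⟩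
    inj₂ (lookup ω′ (uncurry′ combine (pairMap (encode g) ε (a , b)))) ∎))
    where
    product±-inj₁ : ∀ ε → product± ω′ ε (inj₁ (act (encode g) a)) (inj₁ (act (encode g) b)) ≡
                          inj₂ (lookup ω′ (uncurry′ combine (pairMap (encode g) ε (a , b))))
    product±-inj₁ true  = refl
    product±-inj₁ false = refl

≅±⇒TableIso : ∀ {x y x′ y′} (ω : Table x y) (ω′ : Table x′ y′) →
  tableSemigroup {x} {y} ω ≅± tableSemigroup {x′} {y′} ω′ → ∃ λ ε → TableIso ε {x} {y} {x′} {y′} ω ω′
≅±⇒TableIso ω ω′ (inj₁ (f , iso)) = false , record
  { f = f ; injective = injective ; f⁻ = λ u → proj₁ (surjective u) ; f-f⁻ = λ u → proj₂ (surjective u) refl ; homo = homo }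
  where open MagmaMorphisms.IsMagmaIsomorphism iso
≅±⇒TableIso ω ω′ (inj₂ (f , iso)) = true , record
  { f = f ; injective = injective ; f⁻ = λ u → proj₁ (surjective u) ; f-f⁻ = λ u → proj₂ (surjective u) refl ; homo = λ u v → homo v u }
  where open MagmaMorphisms.IsMagmaIsomorphism iso

∼⇒≅± : ∀ {x y} (ω ω′ : Table x y) → Tables._∼_ x ω ω′ → tableSemigroup {x} {y} ω ≅± tableSemigroup {x} {y} ω′
∼⇒≅± {x} {y} ω ω′ ω∼ω′ with Tables.∼⇒moves x {ω = ω} {ω′} ω∼ω′
... | (h , g , ε) , mv = by-cases ε (λ a b → trans (cong (lookup ω′) (sym (act-pairPerm g ε a b))) (mv (combine a b)))
  where
  f : Fin x ⊎ Fin (suc y) → Fin x ⊎ Fin (suc y)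
  f = Sum.map (act g) (act (zero ∷ h))
  f-injective : ∀ {u v} → f u ≡ f v → u ≡ v
  f-injective {inj₁ a} {inj₁ b} eq = cong inj₁ (act-injective g (inj₁-injective eq))
  f-injective {inj₂ a} {inj₂ b} eq = cong inj₂ (act-injective (zero ∷ h) (inj₂-injective eq))
  f-surjective : ∀ u → ∃ λ v → ∀ {w} → w ≡ v → f w ≡ u
  f-surjective (inj₁ a) = inj₁ (act⁻ g a) , λ { refl → cong inj₁ (act-act⁻ g a) }
  f-surjective (inj₂ a) = inj₂ (act⁻ (zero ∷ h) a) , λ { refl → cong inj₂ (act-act⁻ (zero ∷ h) a) }
  by-cases : ∀ ε → (∀ a b → lookup ω′ (uncurry′ combine (pairMap g ε (a , b))) ≡ act (zero ∷ h) (lookup ω (combine a b))) →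
             tableSemigroup {x} {y} ω ≅± tableSemigroup {x} {y} ω′
  by-cases false mv = inj₁ (f , record
    { isMagmaMonomorphism = record
      { isMagmaHomomorphism = record
        { isRelHomomorphism = record { cong = cong f }
        ; homo = λ { (inj₁ a) (inj₁ b) → cong inj₂ (sym (mv a b)) ; (inj₁ a) (inj₂ b) → refl ; (inj₂ a) b → refl } }
      ; injective = f-injective }
    ; surjective = f-surjective })
  by-cases true mv = inj₂ (f , record
    { isMagmaMonomorphism = record
      { isMagmaHomomorphism = record
        { isRelHomomorphism = record { cong = cong f }
        ; homo = λ { (inj₁ a) (inj₁ b) → cong inj₂ (sym (mv b a)) ; (inj₁ a) (inj₂ b) → refl
                   ; (inj₂ a) (inj₁ b) → refl ; (inj₂ a) (inj₂ b) → refl } }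
      ; injective = f-injective }
    ; surjective = f-surjective })

-- Every nilpotent semigroup of degree 3 comes from a table

record Partition {n : ℕ} (P : Fin n → Set) (rest chosen : ℕ) : Set where
  field
    total   : rest + chosen ≡ n
    to      : Fin rest ⊎ Fin chosen → Fin n
    from    : Fin n → Fin rest ⊎ Fin chosen
    from-to : ∀ u → from (to u) ≡ u
    to-from : ∀ i → to (from i) ≡ i
    to-∉    : ∀ a → ¬ P (to (inj₁ a))
    to-∈    : ∀ v → P (to (inj₂ v))

partition : {P : Fin n → Set} → (∀ i → Dec (P i)) → ∃ λ rest → ∃ λ chosen → Partition P rest chosen
partition {zero}  P? = 0 , 0 , record
  { total = refl ; to = λ { (inj₁ ()) ; (inj₂ ()) } ; from = λ ()
  ; from-to = λ { (inj₁ ()) ; (inj₂ ()) } ; to-from = λ () ; to-∉ = λ () ; to-∈ = λ () }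
partition {suc n} {P} P? with P? zero | partition {n} {P ∘ suc} (P? ∘ suc)
... | yes p0 | rest , chosen , Q = rest , suc chosen , record
  { total = trans (+-suc rest chosen) (cong suc total)
  ; to = to′ ; from = from′ ; from-to = from-to′ ; to-from = to-from′ ; to-∉ = to-∉
  ; to-∈ = λ { zero → p0 ; (suc v) → to-∈ v } }
  where
  open Partition Q
  to′ : Fin rest ⊎ Fin (suc chosen) → Fin (suc n)
  to′ (inj₁ a)       = suc (to (inj₁ a))
  to′ (inj₂ zero)    = zero
  to′ (inj₂ (suc v)) = suc (to (inj₂ v))
  from′ : Fin (suc n) → Fin rest ⊎ Fin (suc chosen)
  from′ zero    = inj₂ zero
  from′ (suc i) = Sum.map₂ suc (from i)
  from-to′ : ∀ u → from′ (to′ u) ≡ u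
  from-to′ (inj₁ a)       = cong (Sum.map₂ suc) (from-to (inj₁ a))
  from-to′ (inj₂ zero)    = refl
  from-to′ (inj₂ (suc v)) = cong (Sum.map₂ suc) (from-to (inj₂ v))
  to′-map : ∀ u → to′ (Sum.map₂ suc u) ≡ suc (to u)
  to′-map (inj₁ a) = refl
  to′-map (inj₂ v) = refl
  to-from′ : ∀ i → to′ (from′ i) ≡ i
  to-from′ zero    = refl
  to-from′ (suc i) = trans (to′-map (from i)) (cong suc (to-from i))
... | no ¬p0 | rest , chosen , Q = suc rest , chosen , record
  { total = cong suc total
  ; to = to′ ; from = from′ ; from-to = from-to′ ; to-from = to-from′
  ; to-∉ = λ { zero → ¬p0 ; (suc a) → to-∉ a } ; to-∈ = to-∈ }
  where
  open Partition Q
  to′ : Fin (suc rest) ⊎ Fin chosen → Fin (suc n)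
  to′ (inj₁ zero)    = zero
  to′ (inj₁ (suc a)) = suc (to (inj₁ a))
  to′ (inj₂ v)       = suc (to (inj₂ v))
  from′ : Fin (suc n) → Fin (suc rest) ⊎ Fin chosen
  from′ zero    = inj₁ zero
  from′ (suc i) = Sum.map₁ suc (from i)
  from-to′ : ∀ u → from′ (to′ u) ≡ u
  from-to′ (inj₁ zero)    = refl
  from-to′ (inj₁ (suc a)) = cong (Sum.map₁ suc) (from-to (inj₁ a))
  from-to′ (inj₂ v)       = cong (Sum.map₁ suc) (from-to (inj₂ v))
  to′-map : ∀ u → to′ (Sum.map₁ suc u) ≡ suc (to u)
  to′-map (inj₁ a) = refl
  to′-map (inj₂ v) = refl
  to-from′ : ∀ i → to′ (from′ i) ≡ i
  to-from′ zero    = refl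
  to-from′ (suc i) = trans (to′-map (from i)) (cong suc (to-from i))

-- The multiplication is transported from the given setoid to `Fin n`, where equality is
-- propositional and being a product is decidable.
module Classification {n : ℕ} (S : NilpotentSemigroup n) where

  open NilpotentSemigroup S
  private
    module S = Semigroup semigroup
    module O = Bijection order
    module S³ = Bijection (proj₁ nilpotent)
    module S² = Bijection (proj₁ (proj₂ (proj₂ nilpotent)))

  private
    element : Fin n → S.Carrier
    element = O.to

    index : S.Carrier → Fin n
    index s = proj₁ (O.surjective s)

    element-index : ∀ s → element (index s) S.≈ s
    element-index s = proj₂ (O.surjective s) refl

    index-cong : ∀ {s t} → s S.≈ t → index s ≡ index t
    index-cong {s} {t} s≈t = O.injective (S.trans (element-index s) (S.trans s≈t (S.sym (element-index t))))

    infixl 7 _◇_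
    _◇_ : Fin n → Fin n → Fin n
    i ◇ k = index (element i S.∙ element k)

    index-∙ : ∀ s t → index (s S.∙ t) ≡ index s ◇ index t
    index-∙ s t = index-cong (S.∙-cong (S.sym (element-index s)) (S.sym (element-index t)))

    ζ : S.Carrier
    ζ = proj₁ (S³.to zero)

    triple≈ζ : ∀ r s t → r S.∙ (s S.∙ t) S.≈ ζ
    triple≈ζ r s t with S³.surjective (r S.∙ (s S.∙ t) , r ∷ s ∷ t ∷ [] , S.refl)
    ... | zero , eq = S.sym (eq refl)

    o : Fin n
    o = index ζ

    i◇[j◇k]≡o : ∀ i j k → i ◇ (j ◇ k) ≡ o
    i◇[j◇k]≡o i j k = index-cong (S.trans (S.∙-cong S.refl (element-index _)) (triple≈ζ (element i) (element j) (element k)))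

    [i◇j]◇k≡o : ∀ i j k → i ◇ j ◇ k ≡ o
    [i◇j]◇k≡o i j k = index-cong (S.trans (S.∙-cong (element-index _) S.refl)
      (S.trans (S.assoc (element i) (element j) (element k)) (triple≈ζ (element i) (element j) (element k))))

    IsProduct : Fin n → Set
    IsProduct i = ∃ λ j → ∃ λ k → j ◇ k ≡ i

    o-isProduct : IsProduct o
    o-isProduct = o , o ◇ o , i◇[j◇k]≡o o o o

    S²-product : ∀ v → IsProduct (index (proj₁ (S².to v)))
    S²-product v with S².to v
    ... | e , (s ∷ t ∷ []) , eq = index s , index t , trans (sym (index-∙ s t)) (index-cong eq)

    -- S² has two different elements, and at most one of them is the zero.
    nonzero-product : ∃ λ i → IsProduct i × i ≢ o
    nonzero-product = choose (fromℕ< {0} (<-trans z<s 1<k)) (fromℕ< {1} 1<k)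
        (λ eq → 0≢1+n (trans (sym (Fin.toℕ-fromℕ< (<-trans z<s 1<k))) (trans (cong toℕ eq) (Fin.toℕ-fromℕ< 1<k))))
      where
      1<k = proj₂ (proj₂ (proj₂ nilpotent))
      choose : ∀ u v → u ≢ v → ∃ λ i → IsProduct i × i ≢ o
      choose u v u≢v with index (proj₁ (S².to u)) Fin.≟ o
      ... | no ≢o = _ , S²-product u , ≢o
      ... | yes ≡o = _ , S²-product v , λ ≡o′ → u≢v (S².injective
        (S.trans (S.sym (element-index _)) (S.trans (S.reflexive (cong element (trans ≡o (sym ≡o′)))) (element-index _))))

  Classified : Set
  Classified = ∃ λ x → ∃ λ y → x + suc (suc y) ≡ n × ∃ λ (ω : Table x (suc y)) →
    Tables.Surj x ω × (tableSemigroup {x} {suc y} ω ≅ semigroup)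

  private
    module Labels {rest chosen : ℕ} (Q : Partition IsProduct rest chosen) where

      open Partition Q public

      from-product : ∀ i → IsProduct i → ∃ λ v → from i ≡ inj₂ v
      from-product i prod with from i in eq
      ... | inj₂ v = v , refl
      ... | inj₁ a = contradiction (subst IsProduct (trans (sym (to-from i)) (cong to eq)) prod) (to-∉ a)

      from-nonproduct : ∀ i → ¬ IsProduct i → ∃ λ a → from i ≡ inj₁ a
      from-nonproduct i ¬prod with from i in eq
      ... | inj₁ a = a , refl
      ... | inj₂ v = contradiction (subst IsProduct (trans (cong to (sym eq)) (to-from i)) (to-∈ v)) ¬prod

    classify-by : ∀ rest chosen → Partition IsProduct rest chosen → Classified
    -- The products include `o` and, by `nonzero-product`, a second element, which rules out fewer
    -- than two of them.
    classify-by rest zero Q with Labels.from-product Q o o-isProduct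
    ... | () , _
    classify-by rest (suc zero) Q with nonzero-product
    ... | i , prod , i≢o with Labels.from-product Q i prod | Labels.from-product Q o o-isProduct
    ...   | zero , eq | zero , eq′ = contradiction (trans (sym (to-from i)) (trans (cong to (trans eq (sym eq′))) (to-from o))) i≢o
      where open Labels Q
    classify-by x (suc (suc y)) Q = x , y , total , ω , surj , iso
      where
      open Labels Q
      o′ : Fin (suc (suc y))
      o′ = proj₁ (from-product o o-isProduct)
      -- The partition numbers the products in the order of `Fin n`, whereas a table reserves label
      -- 0 for the zero; the label of `o` is therefore exchanged with 0.
      relabel : Fin (suc (suc y)) → Fin (suc (suc y))
      relabel = transpose zero o′
      relabel⁻ : Fin (suc (suc y)) → Fin (suc (suc y))
      relabel⁻ = transpose o′ zero
      into : Fin x ⊎ Fin (suc (suc y)) → Fin n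
      into = to ∘ Sum.map₂ relabel
      out : Fin n → Fin x ⊎ Fin (suc (suc y))
      out = Sum.map₂ relabel⁻ ∘ from
      into-out : ∀ i → into (out i) ≡ i
      into-out i = trans (cong to (map-map (from i))) (to-from i)
        where
        map-map : ∀ u → Sum.map₂ relabel (Sum.map₂ relabel⁻ u) ≡ u
        map-map (inj₁ a) = refl
        map-map (inj₂ v) = cong inj₂ (transpose-inverse zero o′)
      out-into : ∀ u → out (into u) ≡ u
      out-into u = trans (cong (Sum.map₂ relabel⁻) (from-to (Sum.map₂ relabel u))) (map-map u)
        where
        map-map : ∀ u → Sum.map₂ relabel⁻ (Sum.map₂ relabel u) ≡ u
        map-map (inj₁ a) = refl
        map-map (inj₂ v) = cong inj₂ (transpose-inverse o′ zero)
      into-injective : ∀ {u v} → into u ≡ into v → u ≡ v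
      into-injective {u} {v} eq = trans (sym (out-into u)) (trans (cong out eq) (out-into v))
      into-zero : into (inj₂ zero) ≡ o
      into-zero = trans (cong to (sym (proj₂ (from-product o o-isProduct)))) (to-from o)
      into-inj₂ : ∀ v → IsProduct (into (inj₂ v))
      into-inj₂ v = to-∈ (relabel v)
      out-product : ∀ i → IsProduct i → ∃ λ v → into (inj₂ v) ≡ i
      out-product i prod = let v , eq = from-product i prod in
        relabel⁻ v , trans (cong into (cong (Sum.map₂ relabel⁻) (sym eq))) (into-out i)
      out-nonproduct : ∀ i → ¬ IsProduct i → ∃ λ a → into (inj₁ a) ≡ i
      out-nonproduct i ¬prod = let a , eq = from-nonproduct i ¬prod in
        a , trans (cong into (cong (Sum.map₂ relabel⁻) (sym eq))) (into-out i)
      entry : Fin x × Fin x → Fin (suc (suc y))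
      entry (a , b) = proj₁ (out-product (into (inj₁ a) ◇ into (inj₁ b)) (_ , _ , refl))
      into-entry : ∀ a b → into (inj₂ (entry (a , b))) ≡ into (inj₁ a) ◇ into (inj₁ b)
      into-entry a b = proj₂ (out-product (into (inj₁ a) ◇ into (inj₁ b)) (_ , _ , refl))
      ω : Table x (suc y)
      ω = Vec.tabulate (entry ∘ remQuot {x} x)
      lookup-ω : ∀ a b → lookup ω (combine a b) ≡ entry (a , b)
      lookup-ω a b = trans (Vec.lookup∘tabulate _ (combine a b)) (cong entry (Fin.remQuot-combine a b))
      surj : Tables.Surj x ω
      surj v with into-inj₂ (suc v)
      ... | i , j , i◇j≡ = combine a b , trans (lookup-ω a b) (inj₂-injective (into-injective
          (trans (into-entry a b) (trans (cong₂ _◇_ (proj₂ (out-nonproduct i ¬i)) (proj₂ (out-nonproduct j ¬j))) i◇j≡))))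
        where
        ≢o : into (inj₂ (suc v)) ≢ o
        ≢o eq with into-injective {inj₂ (suc v)} {inj₂ zero} (trans eq (sym into-zero))
        ... | ()
        -- A factor of a non-zero product is not itself a product, since threefold products are
        -- zero. So both factors belong to X and the label occurs in the table.
        ¬i : ¬ IsProduct i
        ¬i (k , l , refl) = ≢o (trans (sym i◇j≡) ([i◇j]◇k≡o k l j))
        ¬j : ¬ IsProduct j
        ¬j (k , l , refl) = ≢o (trans (sym i◇j≡) (i◇[j◇k]≡o i k l))
        a b : Fin x
        a = proj₁ (out-nonproduct i ¬i)
        b = proj₁ (out-nonproduct j ¬j)
      into-homo : ∀ u v → into (_·_ {x} {suc y} ω u v) ≡ into u ◇ into v
      into-homo (inj₁ a) (inj₁ b) = trans (cong (into ∘ inj₂) (lookup-ω a b)) (into-entry a b)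
      into-homo (inj₁ a) (inj₂ w) = let k , l , eq = into-inj₂ w in
        trans into-zero (trans (sym (i◇[j◇k]≡o (into (inj₁ a)) k l)) (cong (into (inj₁ a) ◇_) eq))
      into-homo (inj₂ w) v = let k , l , eq = into-inj₂ w in
        trans into-zero (trans (sym ([i◇j]◇k≡o k l (into v))) (cong (_◇ into v) eq))
      iso : tableSemigroup {x} {suc y} ω ≅ semigroup
      iso = element ∘ into , record
        { isMagmaMonomorphism = record
          { isMagmaHomomorphism = record
            { isRelHomomorphism = record { cong = λ eq → S.reflexive (cong (element ∘ into) eq) }
            ; homo = λ u v → S.trans (S.reflexive (cong element (into-homo u v))) (element-index _) }
          ; injective = λ eq → into-injective (O.injective eq) }
        ; surjective = λ s → out (index s) , λ { refl → S.trans (S.reflexive (cong element (into-out (index s)))) (element-index s) } }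

  classify : Classified
  classify = let x , y , Q = partition {P = IsProduct} (λ i → Fin.any? λ j → Fin.any? λ k → (j ◇ k) Fin.≟ i) in classify-by x y Q

-- The upper limit of the sum

-- The rearranged bound reads (x + 1/2)² ≥ n - 3/4 with x = n - m, that is m - 1 ≤ x².
surj⇒≤bound : ∀ x y (ω : Table x y) → Tables.Surj x ω → suc y ≤bound (x + suc y)
surj⇒≤bound x y ω surj = subst (λ q → √ p ≤ q) (sym t≡) (0≤t , p≤t²)
  where
  open import Data.Rational.Solver using (module +-*-Solver)
  open +-*-Solver using (solve; con; _:+_; _:-_; _:*_; _:=_)
  p : ℚ
  p = (+ (x + suc y) ℚ./ 1) ℚ.- (+ 3 ℚ./ 4)
  -- Choosing for each label an entry that carries it embeds the labels into X × X.
  y≤x² : y ≤ x * x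
  y≤x² = Fin.injective⇒≤ {f = proj₁ ∘ surj} (λ {u} {v} eq → Fin.suc-injective
    (trans (sym (proj₂ (surj u))) (trans (cong (lookup ω) eq) (proj₂ (surj v)))))
  X Y : ℚ
  X = ⟦ x ⟧
  Y = ⟦ y ⟧
  n≡ : + (x + suc y) ℚ./ 1 ≡ X ℚ.+ (ℚ.1ℚ ℚ.+ Y)
  n≡ = trans (⟦⟧-def (x + suc y)) (trans (⟦⟧-+ x (suc y)) (cong (X ℚ.+_) (trans (⟦⟧-+ 1 y) (cong (ℚ._+ Y) (sym (⟦⟧-def 1))))))
  m≡ : + suc y ℚ./ 1 ≡ ℚ.1ℚ ℚ.+ Y
  m≡ = trans (⟦⟧-def (suc y)) (trans (⟦⟧-+ 1 y) (cong (ℚ._+ Y) (sym (⟦⟧-def 1))))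
  t≡ : (+ (x + suc y) ℚ./ 1) ℚ.+ ½ ℚ.- (+ suc y ℚ./ 1) ≡ X ℚ.+ ½
  t≡ = trans (cong₂ (λ a b → a ℚ.+ ½ ℚ.- b) n≡ m≡)
    (solve 3 (λ X Y h → X :+ (con ℚ.1ℚ :+ Y) :+ h :- (con ℚ.1ℚ :+ Y) := X :+ h) refl X Y ½)
  0≤⟦⟧ : ∀ m → 0ℚ ℚ.≤ ⟦ m ⟧
  0≤⟦⟧ m = subst (0ℚ ℚ.≤_) (⟦⟧-def m) (ℚ.nonNegative⁻¹ (+ m ℚ./ 1) {{ℚ.normalize-nonNeg m 1}})
  0≤t : 0ℚ ℚ.≤ X ℚ.+ ½
  0≤t = ℚ.+-mono-≤ (0≤⟦⟧ x) (ℚ.nonNegative⁻¹ ½)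
  p≤t² : p ℚ.≤ (X ℚ.+ ½) ℚ.* (X ℚ.+ ½)
  -- Here p = X + 1/4 + Y and (X + ½)² = X + 1/4 + X².
  p≤t² = subst₂ ℚ._≤_ p≡ t²≡ (ℚ.+-monoʳ-≤ (X ℚ.+ (+ 1 ℚ./ 4)) Y≤X²)
    where
    Y≤X² : Y ℚ.≤ X ℚ.* X
    Y≤X² = subst (Y ℚ.≤_) (trans (sym (⟦⟧-+ y (x * x ∸ y))) (trans (cong ⟦_⟧ (m+[n∸m]≡n y≤x²)) (⟦⟧-* x x)))
      (subst (ℚ._≤ Y ℚ.+ ⟦ x * x ∸ y ⟧) (ℚ.+-identityʳ Y) (ℚ.+-monoʳ-≤ Y (0≤⟦⟧ (x * x ∸ y))))
    p≡ : X ℚ.+ (+ 1 ℚ./ 4) ℚ.+ Y ≡ p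
    p≡ = trans (solve 2 (λ X Y → X :+ con (+ 1 ℚ./ 4) :+ Y := X :+ (con ℚ.1ℚ :+ Y) :- con (+ 3 ℚ./ 4)) refl X Y)
      (cong (ℚ._- (+ 3 ℚ./ 4)) (sym n≡))
    t²≡ : X ℚ.+ (+ 1 ℚ./ 4) ℚ.+ X ℚ.* X ≡ (X ℚ.+ ½) ℚ.* (X ℚ.+ ½)
    t²≡ = solve 1 (λ X → X :+ con (+ 1 ℚ./ 4) :+ X :* X := (X :+ con ½) :* (X :+ con ½)) refl X

≤bound⇒≤upperLimit : ∀ m n → m ≤ n → m ≤bound n → m ≤ upperLimit n
≤bound⇒≤upperLimit m n m≤n bound = All.lookup (xs≤max 0 (filter (_≤bound? n) (upTo (suc n))))
  (∈-filter⁺ (_≤bound? n) (∈-upTo⁺ (s≤s m≤n)) bound)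

upperLimit≤ : ∀ n → upperLimit n ≤ n
upperLimit≤ n = max≤v⁺ z≤n (All.tabulate (λ m∈ → s≤s⁻¹ (∈-upTo⁻ (proj₁ (∈-filter⁻ (_≤bound? n) {xs = upTo (suc n)} m∈)))))

-- Enumerating the classes of semigroups

lookup-once⇒≡ : {P : A → Set} (P? : ∀ a → Dec (P a)) (xs : List A) → ∑ xs (𝟙 ∘ P?) ≡ 1 →
  ∀ i k → P (List.lookup xs i) → P (List.lookup xs k) → i ≡ k
lookup-once⇒≡ P? (a ∷ xs) once zero    zero    pi pk = refl
lookup-once⇒≡ P? (a ∷ xs) once zero    (suc k) pi pk with P? a
... | yes _ = contradiction (suc-injective once) (none P? xs k pk)
  where
  none : {P : A → Set} (P? : ∀ a → Dec (P a)) (xs : List A) → ∀ k → P (List.lookup xs k) → ∑ xs (𝟙 ∘ P?) ≢ 0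
  none P? (a ∷ xs) zero    pk eq rewrite 𝟙-yes (P? a) pk = 1+n≢0 eq
  none P? (a ∷ xs) (suc k) pk eq = none P? xs k pk (m+n≡0⇒n≡0 (𝟙 (P? a)) eq)
... | no ¬pa = contradiction pi ¬pa
lookup-once⇒≡ P? (a ∷ xs) once (suc i) zero    pi pk = sym (lookup-once⇒≡ P? (a ∷ xs) once zero (suc i) pk pi)
lookup-once⇒≡ P? (a ∷ xs) once (suc i) (suc k) pi pk with P? a
... | no _  = cong suc (lookup-once⇒≡ P? xs once i k pi pk)
... | yes pa = contradiction (lookup-once⇒≡ P? (a ∷ xs) (trans (cong (_+ ∑ xs (𝟙 ∘ P?)) (𝟙-yes (P? a) pa)) once) zero (suc i) pa pi) (λ ())

once⇒lookup : {P : A → Set} (P? : ∀ a → Dec (P a)) (xs : List A) → ∑ xs (𝟙 ∘ P?) ≡ 1 → ∃ λ i → P (List.lookup xs i)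
once⇒lookup P? (a ∷ xs) once with P? a
... | yes pa = zero , pa
... | no _   = let i , pi = once⇒lookup P? xs once in suc i , pi

pair : ∀ k (c : Fin k → ℕ) → Σ (Fin k) (Fin ∘ c) → Fin (sum (List.tabulate c))
pair (suc k) c (zero  , u) = u ↑ˡ _
pair (suc k) c (suc i , u) = c zero ↑ʳ pair k (c ∘ suc) (i , u)

unpair : ∀ k (c : Fin k → ℕ) → Fin (sum (List.tabulate c)) → Σ (Fin k) (Fin ∘ c)
unpair (suc k) c w with splitAt (c zero) w
... | inj₁ u = zero , u
... | inj₂ w = let i , u = unpair k (c ∘ suc) w in suc i , u

pair-unpair : ∀ k (c : Fin k → ℕ) w → pair k c (unpair k c w) ≡ w
pair-unpair (suc k) c w with splitAt (c zero) w in eq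
... | inj₁ u  = Fin.splitAt⁻¹-↑ˡ eq
... | inj₂ w′ = trans (cong (c zero ↑ʳ_) (pair-unpair k (c ∘ suc) w′)) (Fin.splitAt⁻¹-↑ʳ eq)

unpair-pair : ∀ k (c : Fin k → ℕ) iu → unpair k c (pair k c iu) ≡ iu
unpair-pair (suc k) c (zero  , u) rewrite Fin.splitAt-↑ˡ (c zero) u (sum (List.tabulate (c ∘ suc))) = refl
unpair-pair (suc k) c (suc i , u) rewrite Fin.splitAt-↑ʳ (c zero) (sum (List.tabulate (c ∘ suc))) (pair k (c ∘ suc) (i , u))
  | unpair-pair k (c ∘ suc) (i , u) = refl

Σℚ-applyUpTo : ∀ (h : ℕ → ℕ) k (f : ℕ → ℚ) (s : ℕ → ℕ) → (∀ i → f (h i) ≡ ⟦ s i ⟧) →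
  Σℚ (applyUpTo h k) f ≡ ⟦ sum (List.tabulate {n = k} (s ∘ toℕ)) ⟧
Σℚ-applyUpTo h zero    f s eq = ⟦0⟧≡0
Σℚ-applyUpTo h (suc k) f s eq = trans (cong₂ ℚ._+_ (eq 0) (Σℚ-applyUpTo (h ∘ suc) k f (s ∘ suc) (eq ∘ suc)))
  (sym (⟦⟧-+ (s 0) (sum (List.tabulate {n = k} (s ∘ suc ∘ toℕ)))))

module Count (n : ℕ) where

  -- The number of terms of the sum. The term m = 2 + i belongs to tables with 1 + i labels and x =
  -- n - m.
  k : ℕ
  k = upperLimit n ∸ 1

  reps : ∀ i → List (Table (n ∸ (2 + i)) (suc i))
  reps i = Tables.surjOrbits (n ∸ (2 + i)) (suc i)

  c : Fin k → ℕ
  c i = length (reps (toℕ i))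

  rep : ∀ i → Fin (length (reps i)) → Table (n ∸ (2 + i)) (suc i)
  rep i u = List.lookup (reps i) u

  rep-surj : ∀ i u → Tables.Surj (n ∸ (2 + i)) (rep i u)
  rep-surj i u = proj₂ (∈-filter⁻ (Tables.surj? (n ∸ (2 + i))) {xs = Tables.orbits (n ∸ (2 + i)) (suc i)} (∈-lookup {xs = reps i} u))

  -- 2 + i ≤ a(n) ≤ n, so the truncated subtraction is the true difference.
  order-eq : (i : Fin k) → n ∸ (2 + toℕ i) + suc (suc (toℕ i)) ≡ n
  order-eq i = m∸n+n≡m (≤-trans (m<n∸o⇒ (Fin.toℕ<n i)) (upperLimit≤ n))
    where
    m<n∸o⇒ : ∀ {m n} → m < n ∸ 1 → 2 + m ≤ n
    m<n∸o⇒ {n = suc n} m<n = s≤s m<n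

  semigroupOf : Σ (Fin k) (Fin ∘ c) → NilpotentSemigroup n
  semigroupOf (i , u) = nilpotentSemigroup {n ∸ (2 + toℕ i)} (rep (toℕ i) u) (rep-surj (toℕ i) u) (order-eq i)

  open NilpotentSemigroup using (semigroup)

  -- Equal numbers of non-products force the same index i; after that both tables lie in one orbit,
  -- which has a single representative in the list.
  semigroupOf-injective : ∀ iu iv → semigroup (semigroupOf iu) ≅± semigroup (semigroupOf iv) → iu ≡ iv
  semigroupOf-injective (i , u) (i′ , v) S≅T = same i≡i′ u v S≅T
    where
    iso : ∃ λ ε → TableIso ε {n ∸ (2 + toℕ i)} {suc (toℕ i)} {n ∸ (2 + toℕ i′)} {suc (toℕ i′)} (rep (toℕ i) u) (rep (toℕ i′) v)
    iso = ≅±⇒TableIso (rep (toℕ i) u) (rep (toℕ i′) v) S≅T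
    x≡x′ : n ∸ (2 + toℕ i) ≡ n ∸ (2 + toℕ i′)
    x≡x′ = ≤-antisym (TableIso⇒≤ {ω = rep (toℕ i) u} {rep (toℕ i′) v} (proj₂ iso) (rep-surj (toℕ i′) v))
      (TableIso⇒≤ {ω = rep (toℕ i′) v} {rep (toℕ i) u} (TableIso-sym {ω = rep (toℕ i) u} {rep (toℕ i′) v} (proj₂ iso)) (rep-surj (toℕ i) u))
    i≡i′ : i ≡ i′
    i≡i′ = Fin.toℕ-injective (suc-injective (suc-injective (+-cancelˡ-≡ (n ∸ (2 + toℕ i)) _ _
      (trans (order-eq i) (trans (sym (order-eq i′)) (cong (_+ suc (suc (toℕ i′))) (sym x≡x′)))))))
    same : ∀ {i i′} → i ≡ i′ → ∀ u v → semigroup (semigroupOf (i , u)) ≅± semigroup (semigroupOf (i′ , v)) → (i , u) ≡ (i′ , v)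
    same {i} refl u v S≅T = cong (i ,_) (lookup-once⇒≡ (λ r → Tables.∼? x (suc (toℕ i)) r ω) (reps (toℕ i))
        (Tables.surjOrbits-once x ω surj) u v (TableIso⇒∼ {x = x} (proj₂ (≅±⇒TableIso (rep (toℕ i) u) ω S≅T)) (rep-surj (toℕ i) u) surj)
        (Tables.∼-refl x ω))
      where
      x : ℕ
      x = n ∸ (2 + toℕ i)
      ω : Table x (suc (toℕ i))
      ω = rep (toℕ i) v
      surj : Tables.Surj x ω
      surj = rep-surj (toℕ i) v

  -- The classifying table hits all its labels, so `surj⇒≤bound` puts its index below `k`, and its
  -- orbit has a representative in the list.
  semigroupOf-surjective : ∀ S → ∃ λ iu → semigroup (semigroupOf iu) ≅± semigroup S
  semigroupOf-surjective S = let x , y , x+y≡n , ω , surj , iso = Classification.classify S in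
    locate x y x+y≡n (trans (sym (m+n∸n≡m x (2 + y))) (cong (_∸ (2 + y)) x+y≡n)) ω surj iso
    where
    locate : ∀ x y → x + suc (suc y) ≡ n → x ≡ n ∸ (2 + y) → (ω : Table x (suc y)) → Tables.Surj x ω →
      tableSemigroup {x} {suc y} ω ≅ semigroup S → ∃ λ iu → semigroup (semigroupOf iu) ≅± semigroup S
    locate x y x+y≡n refl ω surj iso = at (fromℕ< y<k) (sym (Fin.toℕ-fromℕ< y<k)) ω surj iso
      where
      2+y≤limit : 2 + y ≤ upperLimit n
      2+y≤limit = ≤bound⇒≤upperLimit (2 + y) n (subst (2 + y ≤_) x+y≡n (m≤n+m (2 + y) x))
        (subst ((2 + y) ≤bound_) x+y≡n (surj⇒≤bound x (suc y) ω surj))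
      y<k : y < k
      y<k = m+n≤o⇒m≤o∸n (suc y) (subst (_≤ upperLimit n) (+-comm 1 (suc y)) 2+y≤limit)
      at : ∀ {y} (i : Fin k) → y ≡ toℕ i → (ω : Table (n ∸ (2 + y)) (suc y)) → Tables.Surj (n ∸ (2 + y)) ω →
        tableSemigroup {n ∸ (2 + y)} {suc y} ω ≅ semigroup S → ∃ λ iu → semigroup (semigroupOf iu) ≅± semigroup S
      at i refl ω surj iso = let x = n ∸ (2 + toℕ i) ; u , r∼ω = once⇒lookup (λ r → Tables.∼? x (suc (toℕ i)) r ω) (reps (toℕ i)) (Tables.surjOrbits-once x ω surj) in
        (i , u) , ≅±-trans (semigroup (semigroupOf (i , u))) (tableSemigroup {x} {suc (toℕ i)} ω) (semigroup S)
          (∼⇒≅± {x} (rep (toℕ i) u) ω r∼ω) (inj₁ iso)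

  bijection : ∣ nilpotentSemigroups n ∣≡ sum (List.tabulate c)
  bijection = record
    { to        = semigroupOf ∘ unpair k c
    ; cong      = λ { {w} refl → inj₁ (≅-refl (semigroup (semigroupOf (unpair k c w)))) }
    ; bijective = (λ {v} {w} eq → trans (sym (pair-unpair k c v)) (trans
                    (cong (pair k c) (semigroupOf-injective (unpair k c v) (unpair k c w) eq)) (pair-unpair k c w)))
                , (λ S → let iu , eq = semigroupOf-surjective S in
                    pair k c iu , λ { refl → subst (λ iu → semigroup (semigroupOf iu) ≅± semigroup S) (sym (unpair-pair k c iu)) eq })
    }

theorem2p3 : (n : ℕ) → 1 ≤ n →
    ∃ λ (c : ℕ) → (∣ nilpotentSemigroups n ∣≡ c) ×
    (+ c / 1 ≡ Σℚ (range 2 (upperLimit n)) (λ m → L n m - L (n ∸ 1) (m ∸ 1)))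
theorem2p3 n _ = sum (List.tabulate c) , bijection ,
  trans (⟦⟧-def (sum (List.tabulate c))) (sym (Σℚ-applyUpTo (λ i → 2 + i) k (λ m → L n m - L (n ∸ 1) (m ∸ 1)) (length ∘ reps) (L-L≡surjOrbits n)))
  where open Count n
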